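{- Let $\mathcal{M}_D$ be the matroid of the Desargues configuration, i.e. the rank $3$ matroid on $\{0,1,\dots,9\}$ whose nonbases are $$\{0,2,7\},\{0,3,6\},\{0,5,8\},\{1,3,5\},\{1,4,9\},\{1,6,8\},\{2,3,4\},\{2,5,9\},\{4,6,7\},\{7,8,9\}.$$ Modulo lineality and intersecting with a sphere, the Dressian $\mathrm{Dr}_{\mathcal{M}_D}$ is a $3$-dimensional polyhedral complex with $70$ vertices, $370$ edges, $510$ two-dimensional cells, and $150$ three-dimensional cells.
   Context: For a matroid $\mathcal{M}$ of rank $d$ on a finite set $E$ with bases $\mathcal{B}$, let $G_{\mathcal{M}}$ be the set of polynomials in the variables $p_\sigma$, $\sigma\in\mathcal{B}$, obtained from the three-term Plücker relations $p_{Sij}p_{Skl}-p_{Sik}p_{Sjl}+p_{Sil}p_{Sjk}$ ($S\in\binom{E}{d-2}$, $i,j,k,l$ distinct in $E\setminus S$, $Sij=S\cup\{i,j\}$) by replacing $p_\sigma$ by $0$ if $\sigma\notin\mathcal{B}$. For such $f$ (with coefficients $\pm1$), $\mathrm{trop}(V(f))\subset\mathbb{R}^{\mathcal{B}}$ is the set of $w$ at which the minimum of the linear forms $u\cdot w$, over the monomials $p^u$ of $f$, is attained at least twice (all of $\mathbb{R}^{\mathcal{B}}$ if $f=0$). The Dressian is $\mathrm{Dr}_{\mathcal{M}}=\bigcap_{f\in G_{\mathcal{M}}}\mathrm{trop}(V(f))$. The Dressian is a polyhedral fan, with the fan structure given by the common refinement of the tropical hypersurfaces $\mathrm{trop}(V(f))$,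 $f\in G_{\mathcal{M}}$. Its lineality space is the largest linear subspace $L$ with $w+u\in\mathrm{Dr}_{\mathcal{M}}$ for all $w\in\mathrm{Dr}_{\mathcal{M}}$, $u\in L$. "Modulo lineality and intersecting with a sphere" means: take the image of the fan in $\mathbb{R}^{\mathcal{B}}/L$ and intersect with a sphere centered at the origin, so that cones of dimension $\dim L+i+1$ become cells of dimension $i$. -}

module Defs where

open import Data.Fin using (Fin; #_)
open import Data.Fin.Properties using (any?)
open import Data.Fin.Subset using (Subset; inside; outside; ⁅_⁆; _∪_; _─_; _-_; ∣_∣)
  renaming (_∈_ to _∈ₛ_; _∉_ to _∉ₛ_)
open import Data.Fin.Subset.Properties
  using (_∈?_; p─⊥≡p; p─q⊆p; x∈p∧x∉q⇒x∈p─q; x∈p∧x≢y⇒x∈p-y)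
open import Data.Bool.Properties using () renaming (_≟_ to _≟ᵇ_)
open import Data.List using (List; []; _∷_; _++_; map; foldr; mapMaybe; length; lookup)
open import Data.List.Membership.Propositional using (_∈_; _∉_)
open import Data.List.Membership.Propositional.Properties using (∈-map⁺; ∈-++⁺ˡ; ∈-++⁺ʳ)
open import Data.List.Relation.Unary.All as All using (All)
open import Data.List.Relation.Unary.Any using () renaming (here to hereₗ)
open import Data.List.Relation.Unary.Unique.Propositional using (Unique)
open import Data.Maybe as Maybe using (Maybe; just; nothing)
open import Data.Nat as ℕ using (ℕ; zero; suc)
import Data.Nat.Properties as ℕₚ
open import Data.Product using (Σ; ∃; _×_; _,_; proj₁; proj₂)
open import Data.Rational as ℚ using (ℚ; 0ℚ; 1ℚ; ½)
import Data.Rational.Properties as ℚₚ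
open import Data.Rational.Solver using (module +-*-Solver)
open import Data.Sign as Sign using (Sign)
open import Data.Sum using (_⊎_)
open import Data.Vec using ([]; _∷_; here; there)
import Data.Vec.Properties as Vecₚ
import Data.Vec.Functional as VF
open import Function using (_∘_)
open import Level using (0ℓ)
open import Relation.Binary.PropositionalEquality
open import Relation.Nullary using (¬_; yes; no)
open import Relation.Nullary.Decidable using (toWitness; ¬?; _×-dec_; _→-dec_)
open import Relation.Unary using (Pred; Decidable; _⊆_; _≐_)

-- The real numbers are Cauchy sequences of rationals, up to _≈ᴿ_.

IsCauchy : (ℕ → ℚ) → Set
IsCauchy s = ∀ ε → 0ℚ ℚ.< ε →
  ∃ λ N → ∀ m n → N ℕ.≤ m → N ℕ.≤ n → ℚ.∣ s m ℚ.- s n ∣ ℚ.≤ ε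

record ℝ : Set where
  constructor mkℝ
  field
    seq    : ℕ → ℚ
    cauchy : IsCauchy seq

open ℝ

infix  4 _≤ᴿ_ _≈ᴿ_
infixl 6 _+ᴿ_
infixl 7 _*ᴿ_

_≤ᴿ_ : ℝ → ℝ → Set
x ≤ᴿ y = ∀ ε → 0ℚ ℚ.< ε → ∃ λ N → ∀ n → N ℕ.≤ n → seq x n ℚ.≤ seq y n ℚ.+ ε

_≈ᴿ_ : ℝ → ℝ → Set
x ≈ᴿ y = x ≤ᴿ y × y ≤ᴿ x

private
  positive-* : ∀ {p q} → 0ℚ ℚ.< p → 0ℚ ℚ.< q → 0ℚ ℚ.< p ℚ.* q
  positive-* {p} {q} 0<p 0<q = ℚₚ.positive⁻¹ (p ℚ.* q)
    {{ℚₚ.pos*pos⇒pos p {{ℚ.positive 0<p}} q {{ℚ.positive 0<q}}}}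

  half : ∀ {ε} → 0ℚ ℚ.< ε → 0ℚ ℚ.< ε ℚ.* ½
  half 0<ε = positive-* 0<ε (ℚₚ.positive⁻¹ ½)

-- The proofs that sequences are Cauchy are abstract only to keep terms small.

abstract
  constant-cauchy : ∀ q → IsCauchy (λ _ → q)
  constant-cauchy q ε 0<ε = 0 , λ _ _ _ _ →
    subst (ℚ._≤ ε) (sym (cong ℚ.∣_∣ (ℚₚ.+-inverseʳ q))) (ℚₚ.<⇒≤ 0<ε)

  +-cauchy : ∀ x y → IsCauchy (λ n → seq x n ℚ.+ seq y n)
  +-cauchy x y ε 0<ε =
    let (N , p) = cauchy x (ε ℚ.* ½) (half 0<ε)
        (M , q) = cauchy y (ε ℚ.* ½) (half 0<ε)
    in N ℕ.⊔ M , λ m n N≤m N≤n → begin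
    ℚ.∣ (seq x m ℚ.+ seq y m) ℚ.- (seq x n ℚ.+ seq y n) ∣
      ≡⟨ cong ℚ.∣_∣ (solve 4 (λ a b c d → (a :+ b) :- (c :+ d) := (a :- c) :+ (b :- d))
           refl (seq x m) (seq y m) (seq x n) (seq y n)) ⟩
    ℚ.∣ (seq x m ℚ.- seq x n) ℚ.+ (seq y m ℚ.- seq y n) ∣
      ≤⟨ ℚₚ.∣p+q∣≤∣p∣+∣q∣ (seq x m ℚ.- seq x n) (seq y m ℚ.- seq y n) ⟩
    ℚ.∣ seq x m ℚ.- seq x n ∣ ℚ.+ ℚ.∣ seq y m ℚ.- seq y n ∣
      ≤⟨ ℚₚ.+-mono-≤
           (p m n (ℕₚ.m⊔n≤o⇒m≤o N M N≤m) (ℕₚ.m⊔n≤o⇒m≤o N M N≤n))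
           (q m n (ℕₚ.m⊔n≤o⇒n≤o N M N≤m) (ℕₚ.m⊔n≤o⇒n≤o N M N≤n)) ⟩
    ε ℚ.* ½ ℚ.+ ε ℚ.* ½
      ≡⟨ ℚₚ.*-distribˡ-+ ε ½ ½ ⟨
    ε ℚ.* 1ℚ
      ≡⟨ ℚₚ.*-identityʳ ε ⟩
    ε ∎
    where
    open ℚₚ.≤-Reasoning
    open +-*-Solver

private
  eventuallyBounded : ∀ x → ∃ λ B → 0ℚ ℚ.< B × ∃ λ N → ∀ n → N ℕ.≤ n → ℚ.∣ seq x n ∣ ℚ.≤ B
  eventuallyBounded x with cauchy x 1ℚ (ℚₚ.positive⁻¹ 1ℚ)
  ... | N , p = B , 0<B , N , bound
    where
    open ℚₚ.≤-Reasoning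
    open +-*-Solver
    B = 1ℚ ℚ.+ ℚ.∣ seq x N ∣
    0<B : 0ℚ ℚ.< B
    0<B = ℚₚ.+-mono-<-≤ (ℚₚ.positive⁻¹ 1ℚ) (ℚₚ.0≤∣p∣ (seq x N))
    bound : ∀ n → N ℕ.≤ n → ℚ.∣ seq x n ∣ ℚ.≤ B
    bound n N≤n = begin
      ℚ.∣ seq x n ∣
        ≡⟨ cong ℚ.∣_∣ (solve 2 (λ a b → a := (a :- b) :+ b) refl (seq x n) (seq x N)) ⟩
      ℚ.∣ (seq x n ℚ.- seq x N) ℚ.+ seq x N ∣
        ≤⟨ ℚₚ.∣p+q∣≤∣p∣+∣q∣ (seq x n ℚ.- seq x N) (seq x N) ⟩
      ℚ.∣ seq x n ℚ.- seq x N ∣ ℚ.+ ℚ.∣ seq x N ∣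
        ≤⟨ ℚₚ.+-monoˡ-≤ ℚ.∣ seq x N ∣ (p n N N≤n ℕₚ.≤-refl) ⟩
      B ∎

private
  reciprocal : ∀ C → 0ℚ ℚ.< C → ∃ λ i → 0ℚ ℚ.< i × C ℚ.* i ≡ 1ℚ
  reciprocal C 0<C = ℚ.1/ C , ℚₚ.positive⁻¹ (ℚ.1/ C) {{ℚₚ.1/pos⇒pos C}} , ℚₚ.*-inverseʳ C
    where
    instance
      C-positive : ℚ.Positive C
      C-positive = ℚ.positive 0<C
      C-nonZero : ℚ.NonZero C
      C-nonZero = ℚₚ.pos⇒nonZero C

  rearrange : ∀ A B ε i → (A ℚ.+ B) ℚ.* i ≡ 1ℚ → A ℚ.* (ε ℚ.* i) ℚ.+ B ℚ.* (ε ℚ.* i) ≡ ε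
  rearrange A B ε i eq = begin
    A ℚ.* (ε ℚ.* i) ℚ.+ B ℚ.* (ε ℚ.* i)
      ≡⟨ solve 4 (λ A B ε i → A :* (ε :* i) :+ B :* (ε :* i) := ε :* ((A :+ B) :* i))
           refl A B ε i ⟩
    ε ℚ.* ((A ℚ.+ B) ℚ.* i)
      ≡⟨ cong (ε ℚ.*_) eq ⟩
    ε ℚ.* 1ℚ
      ≡⟨ ℚₚ.*-identityʳ ε ⟩
    ε ∎
    where
    open ≡-Reasoning
    open +-*-Solver

  ∣*∣-mono : ∀ {p q r s} → 0ℚ ℚ.< q → ℚ.∣ p ∣ ℚ.≤ q → ℚ.∣ r ∣ ℚ.≤ s →
             ℚ.∣ p ℚ.* r ∣ ℚ.≤ q ℚ.* s
  ∣*∣-mono {p} {q} {r} {s} 0<q p≤q r≤s = begin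
    ℚ.∣ p ℚ.* r ∣
      ≡⟨ ℚₚ.∣p*q∣≡∣p∣*∣q∣ p r ⟩
    ℚ.∣ p ∣ ℚ.* ℚ.∣ r ∣
      ≤⟨ ℚₚ.*-monoʳ-≤-nonNeg ℚ.∣ r ∣ {{ℚₚ.∣-∣-nonNeg r}} p≤q ⟩
    q ℚ.* ℚ.∣ r ∣
      ≤⟨ ℚₚ.*-monoˡ-≤-nonNeg q {{ℚ.nonNegative (ℚₚ.<⇒≤ 0<q)}} r≤s ⟩
    q ℚ.* s ∎
    where open ℚₚ.≤-Reasoning

  product-close : ∀ a b c d {A B δ} → 0ℚ ℚ.< A → 0ℚ ℚ.< B →
                  ℚ.∣ a ∣ ℚ.≤ A → ℚ.∣ d ∣ ℚ.≤ B →
                  ℚ.∣ a ℚ.- c ∣ ℚ.≤ δ → ℚ.∣ b ℚ.- d ∣ ℚ.≤ δ →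
                  ℚ.∣ a ℚ.* b ℚ.- c ℚ.* d ∣ ℚ.≤ A ℚ.* δ ℚ.+ B ℚ.* δ
  product-close a b c d {A} {B} {δ} 0<A 0<B a≤A d≤B ac bd = begin
    ℚ.∣ a ℚ.* b ℚ.- c ℚ.* d ∣
      ≡⟨ cong ℚ.∣_∣ (solve 4 (λ a b c d →
           a :* b :- c :* d := a :* (b :- d) :+ d :* (a :- c)) refl a b c d) ⟩
    ℚ.∣ a ℚ.* (b ℚ.- d) ℚ.+ d ℚ.* (a ℚ.- c) ∣
      ≤⟨ ℚₚ.∣p+q∣≤∣p∣+∣q∣ (a ℚ.* (b ℚ.- d)) (d ℚ.* (a ℚ.- c)) ⟩
    ℚ.∣ a ℚ.* (b ℚ.- d) ∣ ℚ.+ ℚ.∣ d ℚ.* (a ℚ.- c) ∣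
      ≤⟨ ℚₚ.+-mono-≤ (∣*∣-mono 0<A a≤A bd) (∣*∣-mono 0<B d≤B ac) ⟩
    A ℚ.* δ ℚ.+ B ℚ.* δ ∎
    where
    open ℚₚ.≤-Reasoning
    open +-*-Solver

  IsCauchyAt : (ℕ → ℚ) → ℚ → Set
  IsCauchyAt s ε = ∃ λ N → ∀ m n → N ℕ.≤ m → N ℕ.≤ n → ℚ.∣ s m ℚ.- s n ∣ ℚ.≤ ε

  product-cauchy : ∀ x y {A B K L δ} → 0ℚ ℚ.< A → 0ℚ ℚ.< B →
                   (∀ n → K ℕ.≤ n → ℚ.∣ seq x n ∣ ℚ.≤ A) →
                   (∀ n → L ℕ.≤ n → ℚ.∣ seq y n ∣ ℚ.≤ B) →
                   IsCauchyAt (seq x) δ → IsCauchyAt (seq y) δ →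
                   IsCauchyAt (λ n → seq x n ℚ.* seq y n) (A ℚ.* δ ℚ.+ B ℚ.* δ)
  product-cauchy x y {K = K} {L = L} 0<A 0<B boundX boundY (P , closeX) (Q , closeY) =
    (K ℕ.⊔ L) ℕ.⊔ (P ℕ.⊔ Q) , λ m n N≤m N≤n →
      product-close (seq x m) (seq y m) (seq x n) (seq y n) 0<A 0<B
        (boundX m (ℕₚ.m⊔n≤o⇒m≤o K L (left N≤m))) (boundY n (ℕₚ.m⊔n≤o⇒n≤o K L (left N≤n)))
        (closeX m n (ℕₚ.m⊔n≤o⇒m≤o P Q (right N≤m)) (ℕₚ.m⊔n≤o⇒m≤o P Q (right N≤n)))
        (closeY m n (ℕₚ.m⊔n≤o⇒n≤o P Q (right N≤m)) (ℕₚ.m⊔n≤o⇒n≤o P Q (right N≤n)))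
    where
    left : ∀ {o} → (K ℕ.⊔ L) ℕ.⊔ (P ℕ.⊔ Q) ℕ.≤ o → K ℕ.⊔ L ℕ.≤ o
    left = ℕₚ.m⊔n≤o⇒m≤o (K ℕ.⊔ L) (P ℕ.⊔ Q)
    right : ∀ {o} → (K ℕ.⊔ L) ℕ.⊔ (P ℕ.⊔ Q) ℕ.≤ o → P ℕ.⊔ Q ℕ.≤ o
    right = ℕₚ.m⊔n≤o⇒n≤o (K ℕ.⊔ L) (P ℕ.⊔ Q)

abstract
  *-cauchy : ∀ x y → IsCauchy (λ n → seq x n ℚ.* seq y n)
  *-cauchy x y ε 0<ε =
    let (A , 0<A , _ , boundX) = eventuallyBounded x
        (B , 0<B , _ , boundY) = eventuallyBounded y
        (i , 0<i , eq)         = reciprocal (A ℚ.+ B) (ℚₚ.+-mono-< 0<A 0<B)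
        0<δ                    = positive-* 0<ε 0<i
    in subst (IsCauchyAt (λ n → seq x n ℚ.* seq y n)) (rearrange A B ε i eq)
         (product-cauchy x y 0<A 0<B boundX boundY
           (cauchy x (ε ℚ.* i) 0<δ) (cauchy y (ε ℚ.* i) 0<δ))

0ᴿ : ℝ
0ᴿ = mkℝ (λ _ → 0ℚ) (constant-cauchy 0ℚ)

_+ᴿ_ : ℝ → ℝ → ℝ
x +ᴿ y = mkℝ (λ n → seq x n ℚ.+ seq y n) (+-cauchy x y)

_*ᴿ_ : ℝ → ℝ → ℝ
x *ᴿ y = mkℝ (λ n → seq x n ℚ.* seq y n) (*-cauchy x y)

Point : Set → Set
Point X = X → ℝ

module _ {X : Set} where

  infix  4 _≈ᵥ_
  infixl 6 _+ᵥ_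
  infixl 7 _*ᵥ_

  _≈ᵥ_ : Point X → Point X → Set
  v ≈ᵥ w = ∀ x → v x ≈ᴿ w x

  0ᵥ : Point X
  0ᵥ _ = 0ᴿ

  _+ᵥ_ : Point X → Point X → Point X
  (v +ᵥ w) x = v x +ᴿ w x

  _*ᵥ_ : ℝ → Point X → Point X
  (c *ᵥ v) x = c *ᴿ v x

  linearCombination : ∀ {k} → (Fin k → ℝ) → (Fin k → Point X) → Point X
  linearCombination c v = VF.foldr _+ᵥ_ 0ᵥ (λ i → c i *ᵥ v i)

  record IsLinearSubspace (U : Pred (Point X) 0ℓ) : Set where
    field
      respects : ∀ {v w} → v ≈ᵥ w → U v → U w
      zero∈    : U 0ᵥ
      +-closed : ∀ {v w} → U v → U w → U (v +ᵥ w)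
      *-closed : ∀ c {v} → U v → U (c *ᵥ v)

  LinearlyIndependent : ∀ {k} → (Fin k → Point X) → Set
  LinearlyIndependent v = ∀ c → linearCombination c v ≈ᵥ 0ᵥ → ∀ i → c i ≈ᴿ 0ᴿ

  Span : Pred (Point X) 0ℓ → Pred (Point X) 0ℓ
  Span C w = ∃ λ k → ∃ λ (c : Fin k → ℝ) → ∃ λ (v : Fin k → Point X) →
             (∀ i → C (v i)) × w ≈ᵥ linearCombination c v

  HasDimension : Pred (Point X) 0ℓ → ℕ → Set
  HasDimension U k = ∃ λ (v : Fin k → Point X) →
    (∀ i → U (v i)) × LinearlyIndependent v ×
    (∀ w → U w → ∃ λ c → w ≈ᵥ linearCombination c v)

  HasConeDimension : Pred (Point X) 0ℓ → ℕ → Set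
  HasConeDimension C = HasDimension (Span C)

  IsLinealitySpace : Pred (Point X) 0ℓ → Pred (Point X) 0ℓ → Set₁
  IsLinealitySpace D L = Translates L × (∀ L′ → Translates L′ → L′ ⊆ L)
    where
    Translates : Pred (Point X) 0ℓ → Set
    Translates U = IsLinearSubspace U × (∀ w u → D w → U u → D (w +ᵥ u))

-- Coefficients are ±1, so their valuations vanish and signs play no role in
-- the tropicalization.  A monomial lists its variables with multiplicity.  The
-- terms of a polynomial are understood to have pairwise distinct monomials, so
-- that only the empty list is the zero polynomial.

Monomial : Set → Set
Monomial X = List X

Polynomial : Set → Set
Polynomial X = List (Sign × Monomial X)

-- A fan is given by its cones.  Different indices may give the same cone, so
-- cones are counted up to equality as sets.

record Fan (X : Set) : Set₁ where
  field
    Index : Set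
    cone  : Index → Pred (Point X) 0ℓ

open Fan public

module _ {X : Set} where

  -- The linear form w ↦ u·w attached to a monomial p^u.
  evaluate : Monomial X → Point X → ℝ
  evaluate u w = foldr (λ x s → w x +ᴿ s) 0ᴿ u

  AttainsMinimum : (f : Polynomial X) → Point X → Fin (length f) → Set
  AttainsMinimum f w i = ∀ j →
    evaluate (proj₂ (lookup f i)) w ≤ᴿ evaluate (proj₂ (lookup f j)) w

  TropicalHypersurface : Polynomial X → Pred (Point X) 0ℓ
  TropicalHypersurface f w =
    f ≡ [] ⊎
    ∃ λ i → ∃ λ j → i ≢ j × AttainsMinimum f w i × AttainsMinimum f w j

  -- The cones of trop(V(f)) are the normal cones (for the minimum) of the
  -- faces of the Newton polytope of f with at least two monomials.  For a set T
  -- of terms, the w at which all of T attains the minimum form the normal cone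
  -- of the smallest face containing T.  For f = 0 the only cone is the whole
  -- space.
  hypersurfaceFan : Polynomial X → Fan X
  hypersurfaceFan f = record
    { Index = Σ (Subset (length f)) λ T → f ≡ [] ⊎ 2 ℕ.≤ ∣ T ∣
    ; cone  = λ (T , _) w → ∀ {i} → i ∈ₛ T → AttainsMinimum f w i
    }

  commonRefinement : {I : Set} → (I → Fan X) → Fan X
  commonRefinement {I} F = record
    { Index = ∀ i → Index (F i)
    ; cone  = λ σ w → ∀ i → cone (F i) (σ i) w
    }

  HasConesOfDimension : Fan X → (k N : ℕ) → Set
  HasConesOfDimension F k N = ∃ λ (σ : Fin N → Index F) →
    (∀ i → HasConeDimension (cone F (σ i)) k) ×
    (∀ i j → i ≢ j → ¬ (cone F (σ i) ≐ cone F (σ j))) ×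
    (∀ τ → HasConeDimension (cone F τ) k → ∃ λ i → cone F τ ≐ cone F (σ i))

  -- Below, L is the lineality space.  In the image of F in ℝ^X/L, intersected
  -- with a sphere around the origin, a cell of dimension i is the trace of a
  -- cone of dimension dim L + i + 1.

  HasCells : Fan X → (L : Pred (Point X) 0ℓ) → (i N : ℕ) → Set
  HasCells F L i N = ∃ λ d → HasDimension L d × HasConesOfDimension F (d ℕ.+ i ℕ.+ 1) N

  HasSphericalDimension : Fan X → (L : Pred (Point X) 0ℓ) → (m : ℕ) → Set
  HasSphericalDimension F L m = ∃ λ d → HasDimension L d ×
    (∀ σ → ∃ λ k → k ℕ.≤ d ℕ.+ m ℕ.+ 1 × HasConeDimension (cone F σ) k) ×
    (∃ λ σ → HasConeDimension (cone F σ) (d ℕ.+ m ℕ.+ 1))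

record Matroid (n : ℕ) : Set₁ where
  field
    rank       : ℕ
    IsBasis    : Subset n → Set
    isBasis?   : Decidable IsBasis
    nonempty   : ∃ IsBasis
    equicard   : ∀ {A} → IsBasis A → ∣ A ∣ ≡ rank
    exchange   : ∀ {A B} → IsBasis A → IsBasis B → ∀ {x} → x ∈ₛ A ─ B →
                 ∃ λ y → y ∈ₛ B ─ A × IsBasis ((A - x) ∪ ⁅ y ⁆)

module _ {n : ℕ} (M : Matroid n) where

  open Matroid M

  -- The variable p_σ, or the coordinate σ.  The proof is irrelevant, so
  -- coordinates are equal as soon as the underlying sets are.
  record Basis : Set where
    constructor basis
    field
      set      : Subset n
      .isBasis : IsBasis set

  record PlückerIndex : Set where
    field
      S         : Subset n
      i j k l   : Fin n
      .size     : ∣ S ∣ ℕ.+ 2 ≡ rank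
      .distinct : Unique (i ∷ j ∷ k ∷ l ∷ [])
      .disjoint : All (_∉ₛ S) (i ∷ j ∷ k ∷ l ∷ [])

  threeTermRelation : PlückerIndex → Polynomial (Subset n)
  threeTermRelation P =
      (Sign.+ , p i j ∷ p k l ∷ [])
    ∷ (Sign.- , p i k ∷ p j l ∷ [])
    ∷ (Sign.+ , p i l ∷ p j k ∷ [])
    ∷ []
    where
    open PlückerIndex P
    p : Fin n → Fin n → Subset n
    p a b = S ∪ (⁅ a ⁆ ∪ ⁅ b ⁆)

  -- Setting p_σ = 0 for every nonbasis σ.

  restrictVariable : Subset n → Maybe Basis
  restrictVariable σ with isBasis? σ
  ... | yes b = just (basis σ b)
  ... | no  _ = nothing

  restrictMonomial : Monomial (Subset n) → Maybe (Monomial Basis)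
  restrictMonomial = foldr (λ σ → Maybe.zipWith _∷_ (restrictVariable σ)) (just [])

  restrict : Polynomial (Subset n) → Polynomial Basis
  restrict = mapMaybe λ (s , u) → Maybe.map (s ,_) (restrictMonomial u)

  G : PlückerIndex → Polynomial Basis
  G P = restrict (threeTermRelation P)

  Dressian : Pred (Point Basis) 0ℓ
  Dressian w = ∀ P → TropicalHypersurface (G P) w

  dressianFan : Fan Basis
  dressianFan = commonRefinement (hypersurfaceFan ∘ G)

triple : Fin 10 → Fin 10 → Fin 10 → Subset 10
triple a b c = ⁅ a ⁆ ∪ (⁅ b ⁆ ∪ ⁅ c ⁆)

desarguesNonbases : List (Subset 10)
desarguesNonbases =
    triple (# 0) (# 2) (# 7) ∷ triple (# 0) (# 3) (# 6)
  ∷ triple (# 0) (# 5) (# 8) ∷ triple (# 1) (# 3) (# 5)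
  ∷ triple (# 1) (# 4) (# 9) ∷ triple (# 1) (# 6) (# 8)
  ∷ triple (# 2) (# 3) (# 4) ∷ triple (# 2) (# 5) (# 9)
  ∷ triple (# 4) (# 6) (# 7) ∷ triple (# 7) (# 8) (# 9) ∷ []

DesarguesBasis : Subset 10 → Set
DesarguesBasis σ = ∣ σ ∣ ≡ 3 × σ ∉ desarguesNonbases

desarguesBasis? : Decidable DesarguesBasis
desarguesBasis? σ = (∣ σ ∣ ℕ.≟ 3) ×-dec ¬? (σ ∈ˡ? desarguesNonbases)
  where
  open import Data.List.Membership.DecPropositional (Vecₚ.≡-dec _≟ᵇ_) renaming (_∈?_ to _∈ˡ?_)

subsets : ∀ n → ℕ → List (Subset n)
subsets zero    zero    = [] ∷ []
subsets zero    (suc k) = []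
subsets (suc n) zero    = map (outside ∷_) (subsets n zero)
subsets (suc n) (suc k) = map (inside ∷_) (subsets n k) ++ map (outside ∷_) (subsets n (suc k))

subsets-complete : ∀ {n} (p : Subset n) {k} → ∣ p ∣ ≡ k → p ∈ subsets n k
subsets-complete []            {zero}  refl = hereₗ refl
subsets-complete (inside  ∷ p)         refl = ∈-++⁺ˡ (∈-map⁺ (inside ∷_) (subsets-complete p refl))
subsets-complete (outside ∷ p) {zero}  eq   = ∈-map⁺ (outside ∷_) (subsets-complete p eq)
subsets-complete (outside ∷ p) {suc k} eq   =
  ∈-++⁺ʳ (map (inside ∷_) (subsets _ k)) (∈-map⁺ (outside ∷_) (subsets-complete p eq))

─⇒∉ : ∀ {n} (p q : Subset n) {x} → x ∈ₛ p ─ q → x ∉ₛ q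
─⇒∉ (_ ∷ p) (outside ∷ q) (there x∈p─q) (there x∈q) = ─⇒∉ p q x∈p─q x∈q
─⇒∉ (_ ∷ p) (inside  ∷ q) (there x∈p─q) (there x∈q) = ─⇒∉ p q x∈p─q x∈q

card-removal : ∀ {n} {p : Subset n} {x} → x ∈ₛ p → suc ∣ p - x ∣ ≡ ∣ p ∣
card-removal {p = inside  ∷ p} here        = cong (suc ∘ ∣_∣) (p─⊥≡p p)
card-removal {p = inside  ∷ p} (there x∈p) = cong suc (card-removal x∈p)
card-removal {p = outside ∷ p} (there x∈p) = card-removal x∈p

Extends : Subset 10 → Subset 10 → Set
Extends P B = ∃ λ y → y ∈ₛ B ─ P × DesarguesBasis (P ∪ ⁅ y ⁆)

abstract
  extends : All (λ B → DesarguesBasis B → All (λ P → Extends P B) (subsets 10 2)) (subsets 10 3)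
  extends = toWitness
    {a? = All.all? (λ B → desarguesBasis? B →-dec
            All.all? (λ P → any? λ y → (y ∈? B ─ P) ×-dec desarguesBasis? (P ∪ ⁅ y ⁆))
              (subsets 10 2)) (subsets 10 3)} _

desargues-exchange : ∀ A B → DesarguesBasis A → DesarguesBasis B → ∀ {x} → x ∈ₛ A ─ B →
                     ∃ λ y → y ∈ₛ B ─ A × DesarguesBasis ((A - x) ∪ ⁅ y ⁆)
desargues-exchange A B (∣A∣≡3 , _) b {x} x∈A─B =
  let x∈A           = p─q⊆p A B x∈A─B
      ∣A-x∣≡2       = ℕₚ.suc-injective (trans (card-removal x∈A) ∣A∣≡3)
      (y , y∈ , yb) = All.lookup (All.lookup extends (subsets-complete B (proj₁ b)) b)
                                 (subsets-complete (A - x) ∣A-x∣≡2)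
      y∈B           = p─q⊆p B (A - x) y∈
      y≢x           = λ y≡x → ─⇒∉ A B x∈A─B (subst (_∈ₛ B) y≡x y∈B)
      y∉A           = λ y∈A → ─⇒∉ B (A - x) y∈ (x∈p∧x≢y⇒x∈p-y y∈A y≢x)
  in y , x∈p∧x∉q⇒x∈p─q y∈B y∉A , yb

desargues : Matroid 10
desargues = record
  { rank     = 3
  ; IsBasis  = DesarguesBasis
  ; isBasis? = desarguesBasis?
  ; nonempty = triple (# 0) (# 1) (# 2) , toWitness {a? = desarguesBasis? (triple (# 0) (# 1) (# 2))} _
  ; equicard = proj₁
  ; exchange = λ {A} {B} → desargues-exchange A B
  }

module Submission where

-- The Desargues matroid is the truncation of the graphic matroid of K₅.  A point
-- w of the Dressian satisfies the two-term relations exactly if w(σ) is a value x(F) of the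
-- hyperplane F of M(K₅) spanned by σ plus a sum of weights of the elements of σ; the
-- lineality space consists of the w for which x is constant.  In terms of the 15 values x(F)
-- the three-term relations are 25 lines {F,F′,F″}, on which x attains its minimum twice, and
-- 30 four-point conditions on the edges of a quadrilateral, which follow from the lines since
-- an ultrametric satisfies the four-point condition.  So the cone of w only depends on
-- the order of x on collinear hyperplanes.  The sets {x ≥ c} are closed under lines; all their
-- chains are enumerated, and their orders fall into 1 + 70 + 370 + 510 + 150 classes.  A class
-- with m + 1 levels has a cone of dimension 10 + m, spanned by the lineality space and the
-- indicators of the levels, because each level is connected by collinearity.  Over the Cauchy
-- reals the order is only ¬¬-decidable, but the cones are defined by ¬¬-stable inequalities.

-- Two obstacles shape the proof. Comparison of Cauchy reals is undecidable, so an argument about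
-- all real points of the Dressian yields a cell only up to double negation, whereas counting cones
-- needs actual witnesses. Hence every cell carries a point with natural coordinates: there
-- minimality of terms is decidable, and double negations can be removed by finite search. Secondly,
-- an index of the fan picks a set of terms for each Plücker relation independently, so there is no
-- evident list of cones. But each cone is closed under addition, and the sum of two of its points
-- is at least as generic as either; so the most generic cell lying in a cone determines the cone.
-- The dimension 10 of the lineality space comes from the weights: adding a constant to all ten of
-- them adds three times that constant to every coordinate, as does a shift of x. Normalizing the
-- weight of element 0 to 0 leaves nine weights and one shift. The long lists of numbers are
-- certificates only; whatever they have to satisfy is checked by evaluation.

open import Defs
open import Data.Product using (Σ; _×_)
open import Level using (0ℓ)
open import Relation.Unary using (Pred)

-- Order on the Cauchy reals

module Reals where

  open import Data.Nat as ℕ using (ℕ)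
  import Data.Nat.Properties as ℕₚ
  open import Data.Product using (∃; _×_; _,_; proj₁; proj₂)
  open import Data.Rational as ℚ using (ℚ; 0ℚ; 1ℚ; ½)
  import Data.Rational.Properties as ℚₚ
  open import Data.Rational.Solver using (module +-*-Solver)
  open import Data.Sum using (_⊎_; inj₁; inj₂; [_,_]′)
  open import Data.Empty using (⊥-elim)
  open import Function using (_∘_; case_of_)
  open import Relation.Binary.PropositionalEquality
  open import Relation.Nullary using (¬_)

  open ℝ

  private
    open +-*-Solver

    -- An inequality of reals amounts to asymptotic nonnegativity of the difference of the
    -- sequences. In this form inequalities add up, and linear arithmetic on reals reduces to
    -- identities of rationals at each index.
    Nonneg : (ℕ → ℚ) → Set
    Nonneg d = ∀ ε → 0ℚ ℚ.< ε → ∃ λ N → ∀ n → N ℕ.≤ n → 0ℚ ℚ.≤ d n ℚ.+ ε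

    half⁺ : ∀ {ε} → 0ℚ ℚ.< ε → 0ℚ ℚ.< ε ℚ.* ½
    half⁺ {ε} 0<ε = subst (ℚ._< ε ℚ.* ½) (ℚₚ.*-zeroˡ ½) (ℚₚ.*-monoˡ-<-pos ½ 0<ε)

    half+half : ∀ ε → ε ℚ.* ½ ℚ.+ ε ℚ.* ½ ≡ ε
    half+half ε = trans (sym (ℚₚ.*-distribˡ-+ ε ½ ½)) (ℚₚ.*-identityʳ ε)

    abstract
      ≤⇒nonneg : ∀ {x y} → x ≤ᴿ y → Nonneg (λ n → seq y n ℚ.- seq x n)
      ≤⇒nonneg {x} {y} x≤y ε 0<ε = let (N , p) = x≤y ε 0<ε in N , λ n N≤n →
        subst₂ ℚ._≤_ (ℚₚ.+-inverseʳ (seq x n))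
          (solve 3 (λ x y e → (y :+ e) :- x := (y :- x) :+ e) refl (seq x n) (seq y n) ε)
          (ℚₚ.+-monoˡ-≤ (ℚ.- seq x n) (p n N≤n))

      nonneg⇒≤ : ∀ {x y} → Nonneg (λ n → seq y n ℚ.- seq x n) → x ≤ᴿ y
      nonneg⇒≤ {x} {y} h ε 0<ε = let (N , p) = h ε 0<ε in N , λ n N≤n →
        subst₂ ℚ._≤_ (ℚₚ.+-identityˡ (seq x n))
          (solve 3 (λ x y e → ((y :- x) :+ e) :+ x := y :+ e) refl (seq x n) (seq y n) ε)
          (ℚₚ.+-monoˡ-≤ (seq x n) (p n N≤n))

      nonneg-≗ : ∀ {d e} → (∀ n → d n ≡ e n) → Nonneg d → Nonneg e
      nonneg-≗ eq h ε 0<ε = let (N , p) = h ε 0<ε in N , λ n N≤n →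
        subst (λ q → 0ℚ ℚ.≤ q ℚ.+ ε) (eq n) (p n N≤n)

      nonneg-+ : ∀ {d e} → Nonneg d → Nonneg e → Nonneg (λ n → d n ℚ.+ e n)
      nonneg-+ {d} {e} h k ε 0<ε =
        let (N , p) = h (ε ℚ.* ½) (half⁺ 0<ε)
            (M , q) = k (ε ℚ.* ½) (half⁺ 0<ε)
        in N ℕ.⊔ M , λ n N≤n → subst (0ℚ ℚ.≤_)
          (trans (solve 3 (λ a b c → (a :+ c) :+ (b :+ c) := (a :+ b) :+ (c :+ c)) refl
                   (d n) (e n) (ε ℚ.* ½))
                 (cong (d n ℚ.+ e n ℚ.+_) (half+half ε)))
          (ℚₚ.+-mono-≤ (p n (ℕₚ.m⊔n≤o⇒m≤o N M N≤n)) (q n (ℕₚ.m⊔n≤o⇒n≤o N M N≤n)))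

      nonneg-0 : Nonneg (λ _ → 0ℚ)
      nonneg-0 ε 0<ε = 0 , λ _ _ → subst (0ℚ ℚ.≤_) (sym (ℚₚ.+-identityˡ ε)) (ℚₚ.<⇒≤ 0<ε)

  abstract
    ≤-linear₀ : ∀ {x y} → (∀ n → seq y n ℚ.- seq x n ≡ 0ℚ) → x ≤ᴿ y
    ≤-linear₀ {x} {y} eq = nonneg⇒≤ {x} {y} (nonneg-≗ (sym ∘ eq) nonneg-0)

    ≤-linear₁ : ∀ {x y a b} → a ≤ᴿ b →
                (∀ n → seq y n ℚ.- seq x n ≡ seq b n ℚ.- seq a n) → x ≤ᴿ y
    ≤-linear₁ {x} {y} {a} {b} p eq =
      nonneg⇒≤ {x} {y} (nonneg-≗ (sym ∘ eq) (≤⇒nonneg {a} {b} p))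

    ≈-linear₁ : ∀ {x y a b} → a ≈ᴿ b →
                (∀ n → seq y n ℚ.- seq x n ≡ seq b n ℚ.- seq a n) → x ≈ᴿ y
    ≈-linear₁ {x} {y} {a} {b} (a≤b , b≤a) eq =
      ≤-linear₁ {x} {y} {a} {b} a≤b eq , ≤-linear₁ {y} {x} {b} {a} b≤a λ n →
        trans (flip (seq x n) (seq y n)) (trans (cong ℚ.-_ (eq n)) (sym (flip (seq a n) (seq b n))))
      where
      flip : ∀ p q → p ℚ.- q ≡ ℚ.- (q ℚ.- p)
      flip = solve 2 (λ p q → p :- q := :- (q :- p)) refl

    -- The certificate is an identity: the difference in the conclusion is the sum of those in the
    -- hypotheses, index by index. `≤-trans` and `+-mono-≤` are instances.
    ≤-linear₂ : ∀ {x y a b c d} → a ≤ᴿ b → c ≤ᴿ d →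
                (∀ n → seq y n ℚ.- seq x n ≡ (seq b n ℚ.- seq a n) ℚ.+ (seq d n ℚ.- seq c n)) →
                x ≤ᴿ y
    ≤-linear₂ {x} {y} {a} {b} {c} {d} p q eq = nonneg⇒≤ {x} {y}
      (nonneg-≗ (sym ∘ eq) (nonneg-+ {λ n → seq b n ℚ.- seq a n} {λ n → seq d n ℚ.- seq c n}
        (≤⇒nonneg {a} {b} p) (≤⇒nonneg {c} {d} q)))

    ≗⇒≤ : ∀ {x y} → (∀ n → seq x n ≡ seq y n) → x ≤ᴿ y
    ≗⇒≤ {x} {y} eq = ≤-linear₀ {x} {y} λ n →
      trans (cong (ℚ._- seq x n) (sym (eq n))) (ℚₚ.+-inverseʳ (seq x n))

    ≗⇒≈ : ∀ {x y} → (∀ n → seq x n ≡ seq y n) → x ≈ᴿ y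
    ≗⇒≈ {x} {y} eq = ≗⇒≤ {x} {y} eq , ≗⇒≤ {y} {x} (sym ∘ eq)

  ≤-refl : ∀ {x} → x ≤ᴿ x
  ≤-refl {x} = ≗⇒≤ {x} {x} λ _ → refl

  ≤-trans : ∀ {x y z} → x ≤ᴿ y → y ≤ᴿ z → x ≤ᴿ z
  ≤-trans {x} {y} {z} p q = ≤-linear₂ {x} {z} {x} {y} {y} {z} p q λ n →
    solve 3 (λ x y z → z :- x := (y :- x) :+ (z :- y)) refl (seq x n) (seq y n) (seq z n)

  ≈-refl : ∀ {x} → x ≈ᴿ x
  ≈-refl {x} = ≤-refl {x} , ≤-refl {x}

  ≈-sym : ∀ {x y} → x ≈ᴿ y → y ≈ᴿ x
  ≈-sym (p , q) = q , p

  ≈-trans : ∀ {x y z} → x ≈ᴿ y → y ≈ᴿ z → x ≈ᴿ z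
  ≈-trans {x} {y} {z} (p , p′) (q , q′) = ≤-trans {x} {y} {z} p q , ≤-trans {z} {y} {x} q′ p′

  ≤-resp-≈ : ∀ {x x′ y y′} → x ≈ᴿ x′ → y ≈ᴿ y′ → x ≤ᴿ y → x′ ≤ᴿ y′
  ≤-resp-≈ {x} {x′} {y} {y′} (_ , x′≤x) (y≤y′ , _) x≤y =
    ≤-trans {x′} {x} {y′} x′≤x (≤-trans {x} {y} {y′} x≤y y≤y′)

  +-mono-≤ : ∀ {x y u v} → x ≤ᴿ y → u ≤ᴿ v → x +ᴿ u ≤ᴿ y +ᴿ v
  +-mono-≤ {x} {y} {u} {v} p q = ≤-linear₂ {x +ᴿ u} {y +ᴿ v} {x} {y} {u} {v} p q λ n →
    solve 4 (λ x y u v → (y :+ v) :- (x :+ u) := (y :- x) :+ (v :- u)) refl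
      (seq x n) (seq y n) (seq u n) (seq v n)

  +-cancelˡ-≤ : ∀ z {x y} → z +ᴿ x ≤ᴿ z +ᴿ y → x ≤ᴿ y
  +-cancelˡ-≤ z {x} {y} p = ≤-linear₁ {x} {y} {z +ᴿ x} {z +ᴿ y} p λ n →
    solve 3 (λ x y z → y :- x := (z :+ y) :- (z :+ x)) refl (seq x n) (seq y n) (seq z n)

  +-cong : ∀ {x y u v} → x ≈ᴿ y → u ≈ᴿ v → x +ᴿ u ≈ᴿ y +ᴿ v
  +-cong {x} {y} {u} {v} (p , p′) (q , q′) =
    +-mono-≤ {x} {y} {u} {v} p q , +-mono-≤ {y} {x} {v} {u} p′ q′

  constᴿ : ℚ → ℝ
  constᴿ q = mkℝ (λ _ → q) (constant-cauchy q)

  1ᴿ : ℝ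
  1ᴿ = constᴿ 1ℚ

  abstract
    neg-cauchy : ∀ x → IsCauchy (λ n → ℚ.- seq x n)
    neg-cauchy x ε 0<ε = let (N , p) = cauchy x ε 0<ε in N , λ m n N≤m N≤n →
      subst (ℚ._≤ ε)
        (trans (sym (ℚₚ.∣-p∣≡∣p∣ (seq x m ℚ.- seq x n)))
          (cong ℚ.∣_∣ (solve 2 (λ a b → :- (a :- b) := (:- a) :- (:- b)) refl (seq x m) (seq x n))))
        (p m n N≤m N≤n)

  -ᴿ_ : ℝ → ℝ
  -ᴿ x = mkℝ (λ n → ℚ.- seq x n) (neg-cauchy x)

  -- Order on the reals is ¬¬-stable although it is not decidable; this is what
  -- makes the classical arguments below available.
  private
    Large : ℝ → ℝ → Set
    Large x y = ∃ λ ε → 0ℚ ℚ.< ε × ∃ λ N → ∀ n → N ℕ.≤ n → ε ℚ.≤ seq x n ℚ.- seq y n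

    abstract
      ∣p∣≤q⇒p≤q : ∀ {p q} → ℚ.∣ p ∣ ℚ.≤ q → p ℚ.≤ q
      ∣p∣≤q⇒p≤q {p} h = ℚₚ.≤-trans (case ℚₚ.≤-total 0ℚ p of λ
        { (inj₁ 0≤p) → ℚₚ.≤-reflexive (sym (ℚₚ.0≤p⇒∣p∣≡p 0≤p))
        ; (inj₂ p≤0) → ℚₚ.≤-trans p≤0 (ℚₚ.0≤∣p∣ p) }) h

      small-difference : ∀ {κ ε} x y X Y → κ ℚ.+ κ ℚ.≤ ε →
                         (x ℚ.- y) ℚ.- (X ℚ.- Y) ℚ.≤ κ → X ℚ.- Y ℚ.≤ κ → x ℚ.≤ y ℚ.+ ε
      small-difference {κ} {ε} x y X Y κ+κ≤ε near small = begin
        x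
          ≡⟨ solve 3 (λ x y z → x := y :+ (((x :- y) :- z) :+ z)) refl x y (X ℚ.- Y) ⟩
        y ℚ.+ (((x ℚ.- y) ℚ.- (X ℚ.- Y)) ℚ.+ (X ℚ.- Y))
          ≤⟨ ℚₚ.+-monoʳ-≤ y (ℚₚ.≤-trans (ℚₚ.+-mono-≤ near small) κ+κ≤ε) ⟩
        y ℚ.+ ε ∎
        where open ℚₚ.≤-Reasoning

      large-difference : ∀ {κ γ} x y X Y → γ ℚ.+ γ ≡ κ →
                         (X ℚ.- Y) ℚ.- (x ℚ.- y) ℚ.≤ γ → κ ℚ.≤ X ℚ.- Y → γ ℚ.≤ x ℚ.- y
      large-difference {κ} {γ} x y X Y γ+γ≡κ near big = begin
        γ
          ≡⟨ solve 1 (λ k → k := (k :+ k) :- k) refl γ ⟩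
        (γ ℚ.+ γ) ℚ.- γ
          ≡⟨ cong (ℚ._- γ) γ+γ≡κ ⟩
        κ ℚ.- γ
          ≤⟨ ℚₚ.+-mono-≤ big (ℚₚ.neg-antimono-≤ near) ⟩
        (X ℚ.- Y) ℚ.- ((X ℚ.- Y) ℚ.- (x ℚ.- y))
          ≡⟨ solve 2 (λ a b → a :- (a :- b) := b) refl (X ℚ.- Y) (x ℚ.- y) ⟩
        x ℚ.- y ∎
        where open ℚₚ.≤-Reasoning

      difference-cauchy : ∀ x y ε → 0ℚ ℚ.< ε → ∃ λ N → ∀ m n → N ℕ.≤ m → N ℕ.≤ n →
                          (seq x m ℚ.- seq y m) ℚ.- (seq x n ℚ.- seq y n) ℚ.≤ ε
      difference-cauchy x y ε 0<ε =
        let (N , p) = cauchy (x +ᴿ (-ᴿ y)) ε 0<ε in N , λ m n M≤m N≤n → ∣p∣≤q⇒p≤q (p m n M≤m N≤n)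

      -- A single rational comparison at an index N decides: beyond N the difference x - y moves by
      -- at most γ, so a difference of at most κ at N gives the ε-bound throughout, while one of at
      -- least κ leaves a gap of κ - γ = γ.
      ≤⊎large-aux : ∀ x y {ε κ γ} → 0ℚ ℚ.< γ → γ ℚ.+ γ ≡ κ → γ ℚ.≤ κ → κ ℚ.+ κ ℚ.≤ ε →
                (∃ λ N → ∀ n → N ℕ.≤ n → seq x n ℚ.≤ seq y n ℚ.+ ε) ⊎ Large x y
      ≤⊎large-aux x y {ε} {κ} {γ} 0<γ γ+γ≡κ γ≤κ κ+κ≤ε = decide (ℚₚ.≤-total (seq x N ℚ.- seq y N) κ)
        where
        N : ℕ
        N = proj₁ (difference-cauchy x y γ 0<γ)
        near : ∀ m n → N ℕ.≤ m → N ℕ.≤ n →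
               (seq x m ℚ.- seq y m) ℚ.- (seq x n ℚ.- seq y n) ℚ.≤ γ
        near = proj₂ (difference-cauchy x y γ 0<γ)
        decide : seq x N ℚ.- seq y N ℚ.≤ κ ⊎ κ ℚ.≤ seq x N ℚ.- seq y N →
                 (∃ λ N → ∀ n → N ℕ.≤ n → seq x n ℚ.≤ seq y n ℚ.+ ε) ⊎ Large x y
        decide (inj₁ small) = inj₁ (N , λ n N≤n →
          small-difference {κ} {ε} (seq x n) (seq y n) (seq x N) (seq y N)
            κ+κ≤ε (ℚₚ.≤-trans (near n N N≤n ℕₚ.≤-refl) γ≤κ) small)
        decide (inj₂ big) = inj₂ (γ , 0<γ , N , λ n N≤n →
          large-difference {κ} {γ} (seq x n) (seq y n) (seq x N) (seq y N)
            γ+γ≡κ (near N n ℕₚ.≤-refl N≤n) big)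

      half≤ : ∀ ε → 0ℚ ℚ.< ε → ε ℚ.* ½ ℚ.≤ ε
      half≤ ε 0<ε = subst₂ ℚ._≤_ (ℚₚ.+-identityˡ (ε ℚ.* ½)) (half+half ε)
        (ℚₚ.+-monoˡ-≤ (ε ℚ.* ½) (ℚₚ.<⇒≤ (half⁺ 0<ε)))

      ≤⊎large : ∀ x y ε → 0ℚ ℚ.< ε →
                (∃ λ N → ∀ n → N ℕ.≤ n → seq x n ℚ.≤ seq y n ℚ.+ ε) ⊎ Large x y
      ≤⊎large x y ε 0<ε = ≤⊎large-aux x y {ε} {ε ℚ.* ½} {(ε ℚ.* ½) ℚ.* ½}
        (half⁺ {ε ℚ.* ½} (half⁺ {ε} 0<ε)) (half+half (ε ℚ.* ½)) (half≤ (ε ℚ.* ½) (half⁺ {ε} 0<ε))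
        (ℚₚ.≤-reflexive (half+half ε))

      far⇒≰ : ∀ ε → 0ℚ ℚ.< ε → ∀ p q → ε ℚ.+ ε ℚ.≤ p ℚ.- q → ¬ (p ℚ.≤ q ℚ.+ ε)
      far⇒≰ ε 0<ε p q far p≤q+ε = ℚₚ.<-irrefl refl (begin-strict
        ε
          ≡⟨ ℚₚ.+-identityˡ ε ⟨
        0ℚ ℚ.+ ε
          <⟨ ℚₚ.+-monoˡ-< ε 0<ε ⟩
        ε ℚ.+ ε
          ≤⟨ far ⟩
        p ℚ.- q
          ≤⟨ ℚₚ.+-monoˡ-≤ (ℚ.- q) p≤q+ε ⟩
        (q ℚ.+ ε) ℚ.- q
          ≡⟨ solve 2 (λ y e → (y :+ e) :- y := e) refl q ε ⟩
        ε ∎)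
        where open ℚₚ.≤-Reasoning

      large⇒≰ : ∀ x y → Large x y → ¬ (x ≤ᴿ y)
      large⇒≰ x y (ε , 0<ε , N , p) x≤y =
        let (M , q) = x≤y (ε ℚ.* ½) (half⁺ {ε} 0<ε)
            n = N ℕ.⊔ M
        in far⇒≰ (ε ℚ.* ½) (half⁺ {ε} 0<ε) (seq x n) (seq y n)
             (ℚₚ.≤-trans (ℚₚ.≤-reflexive (half+half ε)) (p n (ℕₚ.m≤m⊔n N M)))
             (q n (ℕₚ.m≤n⊔m N M))

      large⇒≥ : ∀ x y → Large x y → y ≤ᴿ x
      large⇒≥ x y (ε , 0<ε , N , p) = nonneg⇒≤ {y} {x} λ δ 0<δ → N , λ n N≤n →
        ℚₚ.≤-trans (ℚₚ.<⇒≤ 0<δ)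
          (subst (ℚ._≤ seq x n ℚ.- seq y n ℚ.+ δ) (ℚₚ.+-identityˡ δ)
            (ℚₚ.+-monoˡ-≤ δ (ℚₚ.≤-trans (ℚₚ.<⇒≤ 0<ε) (p n N≤n))))

  abstract
    -- For each ε, `≤⊎large` yields either the required index or a gap that refutes x ≤ y and is
    -- excluded by the hypothesis. So the index is produced outright.
    ≤-stable : ∀ {x y} → ¬ ¬ (x ≤ᴿ y) → x ≤ᴿ y
    ≤-stable {x} {y} h ε 0<ε =
      [ (λ r → r) , (λ l → ⊥-elim (h (large⇒≰ x y l))) ]′ (≤⊎large x y ε 0<ε)

    ≰⇒≥ : ∀ {x y} → ¬ (x ≤ᴿ y) → y ≤ᴿ x
    ≰⇒≥ {x} {y} x≰y = ≤-stable {y} {x} λ y≰x → x≰y λ ε 0<ε →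
      [ (λ r → r) , (λ l → ⊥-elim (y≰x (large⇒≥ x y l))) ]′ (≤⊎large x y ε 0<ε)

  ≈-stable : ∀ {x y} → ¬ ¬ (x ≈ᴿ y) → x ≈ᴿ y
  ≈-stable {x} {y} h =
    ≤-stable {x} {y} (λ k → h (k ∘ proj₁)) , ≤-stable {y} {x} (λ k → h (k ∘ proj₂))

-- Ring structure of the reals and cancellation of nonzero factors

module RealRing where

  open import Algebra.Bundles using (CommutativeRing)
  open import Data.Nat as ℕ using (ℕ; zero; z≤n; s≤s)
  import Data.Nat.Properties as ℕₚ
  import Data.Integer as ℤ
  open import Data.Product using (∃; _×_; _,_; proj₁; proj₂)
  open import Data.Rational as ℚ using (ℚ; 0ℚ; 1ℚ; ½)
  import Data.Rational.Properties as ℚₚ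
  open import Data.Rational.Solver using (module +-*-Solver)
  open import Data.Sum using (_⊎_; inj₁; inj₂)
  open import Data.Empty using (⊥-elim)
  open import Function using (case_of_)
  open import Level using (0ℓ)
  open import Relation.Binary.PropositionalEquality
  open import Relation.Nullary using (¬_)
  open Reals

  open ℝ

  private
    open +-*-Solver

    Null : (ℕ → ℚ) → Set
    Null d = ∀ ε → 0ℚ ℚ.< ε → ∃ λ N → ∀ n → N ℕ.≤ n → ℚ.∣ d n ∣ ℚ.≤ ε

    abstract
      p≤q⇒∣p∣≤q : ∀ {p q} → p ℚ.≤ q → ℚ.- p ℚ.≤ q → ℚ.∣ p ∣ ℚ.≤ q
      p≤q⇒∣p∣≤q {p} {q} p≤q -p≤q with ℚₚ.∣p∣≡p∨∣p∣≡-p p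
      ... | inj₁ eq = subst (ℚ._≤ q) (sym eq) p≤q
      ... | inj₂ eq = subst (ℚ._≤ q) (sym eq) -p≤q

      p≤∣p∣ : ∀ p → p ℚ.≤ ℚ.∣ p ∣
      p≤∣p∣ p = case ℚₚ.≤-total 0ℚ p of λ
        { (inj₁ 0≤p) → ℚₚ.≤-reflexive (sym (ℚₚ.0≤p⇒∣p∣≡p 0≤p))
        ; (inj₂ p≤0) → ℚₚ.≤-trans p≤0 (ℚₚ.0≤∣p∣ p) }

      difference-≤ : ∀ p q {ε} → p ℚ.≤ q ℚ.+ ε → p ℚ.- q ℚ.≤ ε
      difference-≤ p q {ε} h = subst (p ℚ.- q ℚ.≤_)
        (solve 2 (λ q e → (q :+ e) :- q := e) refl q ε) (ℚₚ.+-monoˡ-≤ (ℚ.- q) h)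

      ≤-difference : ∀ p q {ε} → p ℚ.- q ℚ.≤ ε → p ℚ.≤ q ℚ.+ ε
      ≤-difference p q {ε} h = subst (ℚ._≤ q ℚ.+ ε)
        (solve 2 (λ p q → q :+ (p :- q) := p) refl p q) (ℚₚ.+-monoʳ-≤ q h)

      flip-difference : ∀ p q → ℚ.- (p ℚ.- q) ≡ q ℚ.- p
      flip-difference = solve 2 (λ p q → :- (p :- q) := q :- p) refl

      ≈⇒null : ∀ {x y} → x ≈ᴿ y → Null (λ n → seq x n ℚ.- seq y n)
      ≈⇒null {x} {y} (x≤y , y≤x) ε 0<ε =
        let (N , p) = x≤y ε 0<ε ; (M , q) = y≤x ε 0<ε in N ℕ.⊔ M , λ n N≤n →
          p≤q⇒∣p∣≤q (difference-≤ (seq x n) (seq y n) (p n (ℕₚ.m⊔n≤o⇒m≤o N M N≤n)))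
            (subst (ℚ._≤ ε) (sym (flip-difference (seq x n) (seq y n)))
              (difference-≤ (seq y n) (seq x n) (q n (ℕₚ.m⊔n≤o⇒n≤o N M N≤n))))

      null⇒≤ : ∀ {x y} → Null (λ n → seq x n ℚ.- seq y n) → x ≤ᴿ y
      null⇒≤ {x} {y} h ε 0<ε = let (N , p) = h ε 0<ε in N , λ n N≤n →
        ≤-difference (seq x n) (seq y n) (ℚₚ.≤-trans (p≤∣p∣ _) (p n N≤n))

      null-sym : ∀ x y → Null (λ n → seq x n ℚ.- seq y n) → Null (λ n → seq y n ℚ.- seq x n)
      null-sym x y h ε 0<ε = let (N , p) = h ε 0<ε in N , λ n N≤n →
        subst (ℚ._≤ ε) (trans (sym (ℚₚ.∣-p∣≡∣p∣ (seq x n ℚ.- seq y n)))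
          (cong ℚ.∣_∣ (flip-difference (seq x n) (seq y n)))) (p n N≤n)

      null⇒≈ : ∀ {x y} → Null (λ n → seq x n ℚ.- seq y n) → x ≈ᴿ y
      null⇒≈ {x} {y} h = null⇒≤ {x} {y} h , null⇒≤ {y} {x} (null-sym x y h)

      bounded : ∀ x → ∃ λ B → 0ℚ ℚ.< B × ∃ λ N → ∀ n → N ℕ.≤ n → ℚ.∣ seq x n ∣ ℚ.≤ B
      bounded x with cauchy x 1ℚ (ℚₚ.positive⁻¹ 1ℚ)
      ... | N , p = 1ℚ ℚ.+ ℚ.∣ seq x N ∣ ,
                    ℚₚ.+-mono-<-≤ (ℚₚ.positive⁻¹ 1ℚ) (ℚₚ.0≤∣p∣ (seq x N)) , N , λ n N≤n →
        subst (λ q → ℚ.∣ q ∣ ℚ.≤ 1ℚ ℚ.+ ℚ.∣ seq x N ∣)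
          (solve 2 (λ a b → (a :- b) :+ b := a) refl (seq x n) (seq x N))
          (ℚₚ.≤-trans (ℚₚ.∣p+q∣≤∣p∣+∣q∣ (seq x n ℚ.- seq x N) (seq x N))
            (ℚₚ.+-monoˡ-≤ ℚ.∣ seq x N ∣ (p n N N≤n ℕₚ.≤-refl)))

      *-pos : ∀ {p q} → 0ℚ ℚ.< p → 0ℚ ℚ.< q → 0ℚ ℚ.< p ℚ.* q
      *-pos {p} {q} 0<p 0<q = ℚₚ.positive⁻¹ (p ℚ.* q)
        {{ℚₚ.pos*pos⇒pos p {{ℚ.positive 0<p}} q {{ℚ.positive 0<q}}}}

      ∣*∣-≤ : ∀ p q {B δ} → 0ℚ ℚ.< B → ℚ.∣ p ∣ ℚ.≤ B → ℚ.∣ q ∣ ℚ.≤ δ →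
              ℚ.∣ p ℚ.* q ∣ ℚ.≤ B ℚ.* δ
      ∣*∣-≤ p q {B} {δ} 0<B p≤B q≤δ = subst (ℚ._≤ B ℚ.* δ) (sym (ℚₚ.∣p*q∣≡∣p∣*∣q∣ p q))
        (ℚₚ.≤-trans (ℚₚ.*-monoʳ-≤-nonNeg ℚ.∣ q ∣ {{ℚₚ.∣-∣-nonNeg q}} p≤B)
          (ℚₚ.*-monoˡ-≤-nonNeg B {{ℚ.nonNegative (ℚₚ.<⇒≤ 0<B)}} q≤δ))

      quotient : ∀ B ε → 0ℚ ℚ.< B → 0ℚ ℚ.< ε → ∃ λ δ → 0ℚ ℚ.< δ × B ℚ.* δ ≡ ε
      quotient B ε 0<B 0<ε = ε ℚ.* i , *-pos 0<ε 0<i , trans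
          (solve 3 (λ b e i → b :* (e :* i) := e :* (b :* i)) refl B ε i)
          (trans (cong (ε ℚ.*_) (ℚₚ.*-inverseʳ B)) (ℚₚ.*-identityʳ ε))
        where
        instance
          B-positive : ℚ.Positive B
          B-positive = ℚ.positive 0<B
          B-nonZero : ℚ.NonZero B
          B-nonZero = ℚₚ.pos⇒nonZero B
        i : ℚ
        i = ℚ.1/ B
        0<i : 0ℚ ℚ.< i
        0<i = ℚₚ.positive⁻¹ i {{ℚₚ.1/pos⇒pos B}}

      -- Multiplication is not uniformly continuous; the Cauchy property bounds x eventually, and
      -- the tolerance is divided by that bound.
      *-congˡ : ∀ x {y z} → y ≈ᴿ z → x *ᴿ y ≈ᴿ x *ᴿ z
      *-congˡ x {y} {z} y≈z = null⇒≈ {x *ᴿ y} {x *ᴿ z} λ ε 0<ε →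
        let (B , 0<B , M , bound) = bounded x
            (δ , 0<δ , eq)        = quotient B ε 0<B 0<ε
            (N , near)            = ≈⇒null {y} {z} y≈z δ 0<δ
        in M ℕ.⊔ N , λ n M≤n → subst₂ (λ p q → ℚ.∣ p ∣ ℚ.≤ q)
             (solve 3 (λ x y z → x :* (y :- z) := x :* y :- x :* z) refl (seq x n) (seq y n) (seq z n))
             eq
             (∣*∣-≤ (seq x n) (seq y n ℚ.- seq z n) 0<B
               (bound n (ℕₚ.m⊔n≤o⇒m≤o M N M≤n)) (near n (ℕₚ.m⊔n≤o⇒n≤o M N M≤n)))

  *-comm : ∀ x y → x *ᴿ y ≈ᴿ y *ᴿ x
  *-comm x y = ≗⇒≈ {x *ᴿ y} {y *ᴿ x} λ n → ℚₚ.*-comm (seq x n) (seq y n)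

  abstract
    *-cong : ∀ {x y u v} → x ≈ᴿ y → u ≈ᴿ v → x *ᴿ u ≈ᴿ y *ᴿ v
    *-cong {x} {y} {u} {v} x≈y u≈v = ≈-trans {x *ᴿ u} {x *ᴿ v} {y *ᴿ v} (*-congˡ x {u} {v} u≈v)
      (≈-trans {x *ᴿ v} {v *ᴿ x} {y *ᴿ v} (*-comm x v)
        (≈-trans {v *ᴿ x} {v *ᴿ y} {y *ᴿ v} (*-congˡ v {x} {y} x≈y) (*-comm v y)))

    neg-cong : ∀ {x y} → x ≈ᴿ y → -ᴿ x ≈ᴿ -ᴿ y
    neg-cong {x} {y} (p , q) =
      ≤-linear₁ { -ᴿ x } { -ᴿ y } {y} {x} q (λ n → eq (seq x n) (seq y n)) ,
      ≤-linear₁ { -ᴿ y } { -ᴿ x } {x} {y} p (λ n → eq (seq y n) (seq x n))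
      where
      eq : ∀ a b → (ℚ.- b) ℚ.- (ℚ.- a) ≡ a ℚ.- b
      eq = solve 2 (λ a b → (:- b) :- (:- a) := a :- b) refl

  ℝ-commutativeRing : CommutativeRing 0ℓ 0ℓ
  ℝ-commutativeRing = record
    { Carrier = ℝ ; _≈_ = _≈ᴿ_ ; _+_ = _+ᴿ_ ; _*_ = _*ᴿ_ ; -_ = -ᴿ_ ; 0# = 0ᴿ ; 1# = 1ᴿ
    ; isCommutativeRing = record
      { isRing = record
        { +-isAbelianGroup = record
          { isGroup = record
            { isMonoid = record
              { isSemigroup = record
                { isMagma = record
                  { isEquivalence = record
                    { refl = λ {x} → ≈-refl {x}
                    ; sym = λ {x} {y} → ≈-sym {x} {y}
                    ; trans = λ {x} {y} {z} → ≈-trans {x} {y} {z} }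
                  ; ∙-cong = λ {x} {y} {u} {v} → +-cong {x} {y} {u} {v} }
                ; assoc = λ x y z → ≗⇒≈ {(x +ᴿ y) +ᴿ z} {x +ᴿ (y +ᴿ z)} λ n →
                    ℚₚ.+-assoc (seq x n) (seq y n) (seq z n) }
              ; identity = (λ x → ≗⇒≈ {0ᴿ +ᴿ x} {x} λ n → ℚₚ.+-identityˡ (seq x n))
                         , (λ x → ≗⇒≈ {x +ᴿ 0ᴿ} {x} λ n → ℚₚ.+-identityʳ (seq x n)) }
            ; inverse = (λ x → ≗⇒≈ { -ᴿ x +ᴿ x} {0ᴿ} λ n → ℚₚ.+-inverseˡ (seq x n))
                      , (λ x → ≗⇒≈ {x +ᴿ (-ᴿ x)} {0ᴿ} λ n → ℚₚ.+-inverseʳ (seq x n))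
            ; ⁻¹-cong = λ {x} {y} → neg-cong {x} {y} }
          ; comm = λ x y → ≗⇒≈ {x +ᴿ y} {y +ᴿ x} λ n → ℚₚ.+-comm (seq x n) (seq y n) }
        ; *-cong = λ {x} {y} {u} {v} → *-cong {x} {y} {u} {v}
        ; *-assoc = λ x y z → ≗⇒≈ {(x *ᴿ y) *ᴿ z} {x *ᴿ (y *ᴿ z)} λ n →
            ℚₚ.*-assoc (seq x n) (seq y n) (seq z n)
        ; *-identity = (λ x → ≗⇒≈ {1ᴿ *ᴿ x} {x} λ n → ℚₚ.*-identityˡ (seq x n))
                     , (λ x → ≗⇒≈ {x *ᴿ 1ᴿ} {x} λ n → ℚₚ.*-identityʳ (seq x n))
        ; distrib = (λ x y z → ≗⇒≈ {x *ᴿ (y +ᴿ z)} {x *ᴿ y +ᴿ x *ᴿ z} λ n →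
                      ℚₚ.*-distribˡ-+ (seq x n) (seq y n) (seq z n))
                  , (λ x y z → ≗⇒≈ {(y +ᴿ z) *ᴿ x} {y *ᴿ x +ᴿ z *ᴿ x} λ n →
                      ℚₚ.*-distribʳ-+ (seq x n) (seq y n) (seq z n)) }
      ; *-comm = *-comm } }

  private
    abstract
      -- Without the double negation this would be Markov's principle. If there is no lower bound,
      -- then for each ε the term at a suitable Cauchy index is at most ε/2, since a value of at
      -- least ε/2 there would give the lower bound ε/4; hence the sequence is null.
      ¬null⇒bounded : ∀ x → ¬ (x ≈ᴿ 0ᴿ) →
        ¬ ¬ (∃ λ δ → 0ℚ ℚ.< δ × ∃ λ N → ∀ n → N ℕ.≤ n → δ ℚ.≤ ℚ.∣ seq x n ∣)
      ¬null⇒bounded x x≉0 k = x≉0 (null⇒≈ {x} {0ᴿ} null)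
        where
        null : Null (λ n → seq x n ℚ.- 0ℚ)
        null ε 0<ε = decide (ℚₚ.≤-total ℚ.∣ seq x N ∣ δ)
          where
          δ : ℚ
          δ = ε ℚ.* ½
          δ+δ≡ε : δ ℚ.+ δ ≡ ε
          δ+δ≡ε = trans (sym (ℚₚ.*-distribˡ-+ ε ½ ½)) (ℚₚ.*-identityʳ ε)
          0<δ : 0ℚ ℚ.< δ
          0<δ = *-pos {ε} {½} 0<ε (ℚₚ.positive⁻¹ ½)
          γ : ℚ
          γ = δ ℚ.* ½
          γ+γ≡δ : γ ℚ.+ γ ≡ δ
          γ+γ≡δ = trans (sym (ℚₚ.*-distribˡ-+ δ ½ ½)) (ℚₚ.*-identityʳ δ)
          0<γ : 0ℚ ℚ.< γ
          0<γ = *-pos {δ} {½} 0<δ (ℚₚ.positive⁻¹ ½)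
          γ≤δ : γ ℚ.≤ δ
          γ≤δ = subst₂ ℚ._≤_ (ℚₚ.+-identityˡ γ) γ+γ≡δ (ℚₚ.+-monoˡ-≤ γ (ℚₚ.<⇒≤ 0<γ))
          N : ℕ
          N = proj₁ (cauchy x γ 0<γ)
          near : ∀ m n → N ℕ.≤ m → N ℕ.≤ n → ℚ.∣ seq x m ℚ.- seq x n ∣ ℚ.≤ γ
          near = proj₂ (cauchy x γ 0<γ)
          triangle : ∀ p q → ℚ.∣ p ∣ ℚ.≤ ℚ.∣ p ℚ.- q ∣ ℚ.+ ℚ.∣ q ∣
          triangle p q = subst (λ r → ℚ.∣ r ∣ ℚ.≤ ℚ.∣ p ℚ.- q ∣ ℚ.+ ℚ.∣ q ∣)
            (solve 2 (λ p q → (p :- q) :+ q := p) refl p q) (ℚₚ.∣p+q∣≤∣p∣+∣q∣ (p ℚ.- q) q)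
          decide : ℚ.∣ seq x N ∣ ℚ.≤ δ ⊎ δ ℚ.≤ ℚ.∣ seq x N ∣ →
                   ∃ λ N → ∀ n → N ℕ.≤ n → ℚ.∣ seq x n ℚ.- 0ℚ ∣ ℚ.≤ ε
          decide (inj₁ small) = N , λ n N≤n →
            subst₂ (λ p q → ℚ.∣ p ∣ ℚ.≤ q)
              (sym (ℚₚ.+-identityʳ (seq x n))) δ+δ≡ε
              (ℚₚ.≤-trans (triangle (seq x n) (seq x N))
                (ℚₚ.+-mono-≤ (ℚₚ.≤-trans (near n N N≤n ℕₚ.≤-refl) γ≤δ) small))
          decide (inj₂ big) = ⊥-elim (k (γ , 0<γ , N , λ n N≤n →
            subst₂ ℚ._≤_
              (trans (cong (ℚ._- γ) (sym γ+γ≡δ)) (solve 1 (λ g → (g :+ g) :- g := g) refl γ))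
              (solve 2 (λ a b → (a :+ b) :- a := b) refl γ ℚ.∣ seq x n ∣)
              (ℚₚ.+-monoˡ-≤ (ℚ.- γ) (ℚₚ.≤-trans big
                (ℚₚ.≤-trans (triangle (seq x N) (seq x n))
                  (ℚₚ.+-monoˡ-≤ ℚ.∣ seq x n ∣ (near N n ℕₚ.≤-refl N≤n)))))))

      cancel : ∀ x y {δ ε} → 0ℚ ℚ.< δ → δ ℚ.≤ ℚ.∣ x ∣ → ℚ.∣ x ℚ.* y ℚ.- 0ℚ ∣ ℚ.≤ δ ℚ.* ε →
               ℚ.∣ y ℚ.- 0ℚ ∣ ℚ.≤ ε
      cancel x y {δ} {ε} 0<δ δ≤x xy≤ = subst (λ q → ℚ.∣ q ∣ ℚ.≤ ε) (sym (ℚₚ.+-identityʳ y))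
        (ℚₚ.*-cancelˡ-≤-pos δ {{ℚ.positive 0<δ}}
          (ℚₚ.≤-trans (ℚₚ.*-monoʳ-≤-nonNeg ℚ.∣ y ∣ {{ℚₚ.∣-∣-nonNeg y}} δ≤x)
            (subst (ℚ._≤ δ ℚ.* ε)
              (trans (cong ℚ.∣_∣ (ℚₚ.+-identityʳ (x ℚ.* y))) (ℚₚ.∣p*q∣≡∣p∣*∣q∣ x y)) xy≤)))

  abstract
    -- Equality is stable, so the lower bound for the absolute value of x, available up to double
    -- negation, may be used to divide.
    x*y≈0⇒y≈0 : ∀ x y → ¬ (x ≈ᴿ 0ᴿ) → x *ᴿ y ≈ᴿ 0ᴿ → y ≈ᴿ 0ᴿ
    x*y≈0⇒y≈0 x y x≉0 xy≈0 = ≈-stable {y} {0ᴿ} λ y≉0 →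
      ¬null⇒bounded x x≉0 λ (δ , 0<δ , N , far) → y≉0 (null⇒≈ {y} {0ᴿ} λ ε 0<ε →
        let (M , near) = ≈⇒null {x *ᴿ y} {0ᴿ} xy≈0 (δ ℚ.* ε) (*-pos {δ} {ε} 0<δ 0<ε)
        in N ℕ.⊔ M , λ n N≤n → cancel (seq x n) (seq y n) {δ} {ε} 0<δ
             (far n (ℕₚ.m⊔n≤o⇒m≤o N M N≤n)) (near n (ℕₚ.m⊔n≤o⇒n≤o N M N≤n)))

    1≉0 : ¬ (1ᴿ ≈ᴿ 0ᴿ)
    1≉0 1≈0 = let (N , p) = proj₁ 1≈0 ½ (ℚₚ.positive⁻¹ ½) in
      ℚₚ.<-irrefl refl (ℚₚ.<-≤-trans ½<1 (subst (1ℚ ℚ.≤_) (ℚₚ.+-identityˡ ½) (p N ℕₚ.≤-refl)))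
      where
      ½<1 : ½ ℚ.< 1ℚ
      ½<1 = ℚ.*<* (ℤ.+<+ (s≤s (s≤s z≤n)))

-- Linear algebra up to double negation

module LinearAlgebra where

  open import Algebra.Bundles using (CommutativeRing)
  open import Data.Fin using (Fin; zero; suc; punchIn)
  open import Data.Nat as ℕ using (ℕ; zero; suc; s≤s)
  import Data.Nat.Properties as ℕₚ
  open import Data.Product using (∃; _×_; _,_)
  import Data.Vec.Functional as VF
  open import Data.Vec.Functional.Properties using (insertAt-lookup; insertAt-punchIn)
  open import Function using (_∘_)
  open import Relation.Nullary using (¬_)

  -- Double-negation shift, valid because the index set is finite.
  ¬¬-∀ : ∀ {p} {n} {P : Fin n → Set p} → (∀ i → ¬ ¬ P i) → ¬ ¬ (∀ i → P i)
  ¬¬-∀ {n = zero}  _ k = k λ ()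
  ¬¬-∀ {n = suc n} h k = h zero λ p → ¬¬-∀ (h ∘ suc) λ q → k λ { zero → p ; (suc i) → q i }

  module Elimination {r ℓ} (R : CommutativeRing r ℓ) where
    open CommutativeRing R hiding (zero)
    open import Algebra.Properties.Semiring.Sum semiring public
      using (sum; sum-cong-≋; ∑-distrib-+; ∑-comm; sum-replicate-zero; sum-remove;
             *-distribˡ-sum; *-distribʳ-sum)
    open import Algebra.Properties.Ring ring using (-‿distribˡ-*; -‿distribʳ-*)
    open import Algebra.Solver.Ring.NaturalCoefficients.Default commutativeSemiring
      using (solve; _:+_; _:*_; _:=_)
    open import Relation.Binary.Reasoning.Setoid setoid

    sum-cong : ∀ {n} (f g : Fin n → Carrier) → (∀ i → f i ≈ g i) → sum f ≈ sum g
    sum-cong _ _ f≈g = sum-cong-≋ f≈g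

    sum-zero : ∀ {n} (f : Fin n → Carrier) → (∀ i → f i ≈ 0#) → sum f ≈ 0#
    sum-zero {n} f eq = trans (sum-cong-≋ eq) (sum-replicate-zero n)

    sum-compose : ∀ {k n} (A : Fin k → Fin n → Carrier) (c : Fin k → Carrier) (w : Fin n → Carrier) →
                  sum (λ i → c i * sum (λ j → A i j * w j)) ≈ sum (λ j → sum (λ i → A i j * c i) * w j)
    sum-compose A c w = begin
      sum (λ i → c i * sum (λ j → A i j * w j))
        ≈⟨ sum-cong-≋ (λ i → *-distribˡ-sum (c i) (λ j → A i j * w j)) ⟩
      sum (λ i → sum (λ j → c i * (A i j * w j)))
        ≈⟨ ∑-comm (λ i j → c i * (A i j * w j)) ⟩
      sum (λ j → sum (λ i → c i * (A i j * w j)))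
        ≈⟨ sum-cong-≋ (λ j → sum-cong-≋ λ i →
             solve 3 (λ c a w → c :* (a :* w) := (a :* c) :* w) refl (c i) (A i j) (w j)) ⟩
      sum (λ j → sum (λ i → (A i j * c i) * w j))
        ≈⟨ sum-cong-≋ (λ j → *-distribʳ-sum (w j) (λ i → A i j * c i)) ⟨
      sum (λ j → sum (λ i → A i j * c i) * w j) ∎

    -- Let the first row have pivot a and other entries C, and another row b and B. A vector c for
    -- the reduced system is lifted by scaling its entries with a and putting the negated sum of C c
    -- at the pivot column. The identity turns a row at the lifted vector into the reduced row at c.
    eliminate : ∀ {n} (a b : Carrier) (B C c : Fin n → Carrier) →
                b * - sum (λ i → C i * c i) + sum (λ i → B i * (a * c i)) ≈
                sum (λ i → (a * B i + - b * C i) * c i)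
    eliminate a b B C c = begin
      b * - sum (λ i → C i * c i) + sum (λ i → B i * (a * c i))
        ≈⟨ +-congʳ (trans (sym (-‿distribʳ-* b _)) (-‿distribˡ-* b _)) ⟩
      - b * sum (λ i → C i * c i) + sum (λ i → B i * (a * c i))
        ≈⟨ +-congʳ (*-distribˡ-sum (- b) (λ i → C i * c i)) ⟩
      sum (λ i → - b * (C i * c i)) + sum (λ i → B i * (a * c i))
        ≈⟨ ∑-distrib-+ (λ i → - b * (C i * c i)) (λ i → B i * (a * c i)) ⟨
      sum (λ i → - b * (C i * c i) + B i * (a * c i))
        ≈⟨ sum-cong-≋ (λ i → solve 5 (λ a b B C c →
             b :* (C :* c) :+ B :* (a :* c) := (a :* B :+ b :* C) :* c) refl a (- b) (B i) (C i) (c i)) ⟩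
      sum (λ i → (a * B i + - b * C i) * c i) ∎

    -- Elimination without division, hence valid over a domain in which equality
    -- is decidable only up to double negation.
    kernel : (∀ x y → ¬ (x ≈ 0#) → x * y ≈ 0# → y ≈ 0#) → ¬ (1# ≈ 0#) →
             ∀ {n k} → n ℕ.< k → (A : Fin n → Fin k → Carrier) →
             ¬ ¬ (∃ λ (c : Fin k → Carrier) → ¬ (∀ i → c i ≈ 0#) × (∀ j → sum (λ i → A j i * c i) ≈ 0#))
    kernel domain 1≉0 {zero}  {suc k} _ A none = none ((λ _ → 1#) , (λ c≈0 → 1≉0 (c≈0 zero)) , λ ())
    -- Either some entry of the first row serves as a pivot, or the whole row vanishes and imposes
    -- no condition. The case distinction is legitimate because the goal is a double negation.
    kernel domain 1≉0 {suc n} {suc k} (s≤s n<k) A none = ¬¬-∀ pivot λ row≈0 →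
      kernel domain 1≉0 (ℕₚ.m≤n⇒m≤1+n n<k) (A ∘ suc) λ (c , c≉0 , eqs) → none (c , c≉0 , λ
        { zero    → sum-zero _ λ i → trans (*-congʳ (row≈0 i)) (zeroˡ (c i))
        ; (suc j) → eqs j })
      where
      pivot : ∀ p → ¬ ¬ (A zero p ≈ 0#)
      pivot p a≉0 = kernel domain 1≉0 n<k
        (λ j i → a * A (suc j) (punchIn p i) + - A (suc j) p * A zero (punchIn p i))
        λ (c , c≉0 , eqs) →
          let s = - sum (λ i → A zero (punchIn p i) * c i)
              d = VF.insertAt (λ i → a * c i) p s
              row : ∀ j → sum (λ i → A j i * d i) ≈
                          sum (λ i → (a * A j (punchIn p i) + - A j p * A zero (punchIn p i)) * c i)
              row j = begin
                sum (λ i → A j i * d i)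
                  ≈⟨ sum-remove {i = p} (λ i → A j i * d i) ⟩
                A j p * d p + sum (λ i → A j (punchIn p i) * d (punchIn p i))
                  ≈⟨ +-cong (*-congˡ (reflexive (insertAt-lookup (λ i → a * c i) p s)))
                       (sum-cong-≋ λ i → *-congˡ (reflexive (insertAt-punchIn (λ i → a * c i) p s i))) ⟩
                A j p * - sum (λ i → A zero (punchIn p i) * c i) + sum (λ i → A j (punchIn p i) * (a * c i))
                  ≈⟨ eliminate a (A j p) (A j ∘ punchIn p) (A zero ∘ punchIn p) c ⟩
                sum (λ i → (a * A j (punchIn p i) + - A j p * A zero (punchIn p i)) * c i) ∎
          in none (d ,
               (λ d≈0 → c≉0 λ i → domain a (c i) a≉0
                 (trans (sym (reflexive (insertAt-punchIn (λ i → a * c i) p s i))) (d≈0 (punchIn p i)))) ,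
               λ { zero → trans (row zero) (sum-zero _ λ i → trans (*-congʳ
                     (trans (+-congˡ (sym (-‿distribˡ-* a _))) (-‿inverseʳ _))) (zeroˡ (c i)))
                 ; (suc j) → trans (row (suc j)) (eqs j) })
        where
        a : Carrier
        a = A zero p

-- Spans and the uniqueness of dimension

module VectorSpaces where

  open import Algebra.Bundles using (CommutativeRing)
  open import Data.Empty using (⊥-elim)
  open import Data.Fin using (Fin; zero; suc)
  open import Data.Nat as ℕ using (ℕ; zero; suc)
  import Data.Nat.Properties as ℕₚ
  open import Data.Product using (∃; _,_; proj₁; proj₂)
  open import Function using (_∘_)
  open import Level using (0ℓ)
  open import Relation.Binary.PropositionalEquality as ≡ using (_≡_)
  open import Relation.Nullary using (yes; no)
  open import Relation.Unary using (Pred; _⊆_; _≐_)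
  open Reals
  open RealRing
  open LinearAlgebra

  module ℝᶜ = CommutativeRing ℝ-commutativeRing
  open Elimination ℝ-commutativeRing using (sum; sum-cong; ∑-distrib-+; sum-compose; sum-zero; kernel; *-distribˡ-sum)
  open IsLinearSubspace

  module _ {X : Set} where

    lc-sum : ∀ {k} (c : Fin k → ℝ) (v : Fin k → Point X) x →
             linearCombination c v x ≡ sum (λ i → c i *ᴿ v i x)
    lc-sum {zero}  c v x = ≡.refl
    lc-sum {suc k} c v x = ≡.cong (c zero *ᴿ v zero x +ᴿ_) (lc-sum (c ∘ suc) (v ∘ suc) x)

    lc≈sum : ∀ {k} (c : Fin k → ℝ) (v : Fin k → Point X) x →
             linearCombination c v x ≈ᴿ sum (λ i → c i *ᴿ v i x)
    lc≈sum c v x = ≡.subst (linearCombination c v x ≈ᴿ_) (lc-sum c v x) (≈-refl {linearCombination c v x})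

    Spanned : ∀ {k} → (Fin k → Point X) → Pred (Point X) 0ℓ
    Spanned v w = ∃ λ c → w ≈ᵥ linearCombination c v

    spanned-isLinearSubspace : ∀ {k} (v : Fin k → Point X) → IsLinearSubspace (Spanned v)
    spanned-isLinearSubspace {k} v = record
      { respects = λ {w} {w′} w≈w′ (c , eq) → c , λ x →
          ≈-trans {w′ x} {w x} {linearCombination c v x} (≈-sym {w x} {w′ x} (w≈w′ x)) (eq x)
      ; zero∈ = (λ _ → 0ᴿ) , λ x → begin
          0ᴿ
            ≈⟨ sum-zero (λ i → 0ᴿ *ᴿ v i x) (λ i → ℝᶜ.zeroˡ (v i x)) ⟨
          sum (λ i → 0ᴿ *ᴿ v i x)
            ≈⟨ lc≈sum (λ _ → 0ᴿ) v x ⟨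
          linearCombination (λ _ → 0ᴿ) v x ∎
      ; +-closed = λ {w} {w′} (c , eq) (c′ , eq′) → (λ i → c i +ᴿ c′ i) , λ x → begin
          w x +ᴿ w′ x
            ≈⟨ +-cong {w x} {linearCombination c v x} {w′ x} {linearCombination c′ v x} (eq x) (eq′ x) ⟩
          linearCombination c v x +ᴿ linearCombination c′ v x
            ≡⟨ ≡.cong₂ _+ᴿ_ (lc-sum c v x) (lc-sum c′ v x) ⟩
          sum (λ i → c i *ᴿ v i x) +ᴿ sum (λ i → c′ i *ᴿ v i x)
            ≈⟨ ∑-distrib-+ (λ i → c i *ᴿ v i x) (λ i → c′ i *ᴿ v i x) ⟨
          sum (λ i → c i *ᴿ v i x +ᴿ c′ i *ᴿ v i x)
            ≈⟨ sum-cong (λ i → (c i +ᴿ c′ i) *ᴿ v i x) (λ i → c i *ᴿ v i x +ᴿ c′ i *ᴿ v i x)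
                 (λ i → ℝᶜ.distribʳ (v i x) (c i) (c′ i)) ⟨
          sum (λ i → (c i +ᴿ c′ i) *ᴿ v i x)
            ≡⟨ lc-sum (λ i → c i +ᴿ c′ i) v x ⟨
          linearCombination (λ i → c i +ᴿ c′ i) v x ∎
      ; *-closed = λ a {w} (c , eq) → (λ i → a *ᴿ c i) , λ x → begin
          a *ᴿ w x
            ≈⟨ *-cong {a} {a} {w x} {linearCombination c v x} (≈-refl {a}) (eq x) ⟩
          a *ᴿ linearCombination c v x
            ≡⟨ ≡.cong (a *ᴿ_) (lc-sum c v x) ⟩
          a *ᴿ sum (λ i → c i *ᴿ v i x)
            ≈⟨ *-distribˡ-sum a (λ i → c i *ᴿ v i x) ⟩
          sum (λ i → a *ᴿ (c i *ᴿ v i x))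
            ≈⟨ sum-cong (λ i → (a *ᴿ c i) *ᴿ v i x) (λ i → a *ᴿ (c i *ᴿ v i x))
                 (λ i → ℝᶜ.*-assoc a (c i) (v i x)) ⟨
          sum (λ i → (a *ᴿ c i) *ᴿ v i x)
            ≡⟨ lc-sum (λ i → a *ᴿ c i) v x ⟨
          linearCombination (λ i → a *ᴿ c i) v x ∎
      }
      where open import Relation.Binary.Reasoning.Setoid ℝᶜ.setoid

    lc-closed : ∀ {U : Pred (Point X) 0ℓ} → IsLinearSubspace U → ∀ {k} (c : Fin k → ℝ) (v : Fin k → Point X) →
                (∀ i → U (v i)) → U (linearCombination c v)
    lc-closed isU {zero}  c v v∈U = zero∈ isU
    lc-closed isU {suc k} c v v∈U =
      +-closed isU (*-closed isU (c zero) (v∈U zero)) (lc-closed isU (c ∘ suc) (v ∘ suc) (v∈U ∘ suc))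

    Span⊆ : ∀ {U C : Pred (Point X) 0ℓ} → IsLinearSubspace U → C ⊆ U → Span C ⊆ U
    Span⊆ isU C⊆U {w} (k , c , v , v∈C , w≈) =
      respects isU (λ x → ≈-sym {w x} {linearCombination c v x} (w≈ x)) (lc-closed isU c v λ i → C⊆U {v i} (v∈C i))

    singleton∈Span : ∀ {C : Pred (Point X) 0ℓ} {w} → C w → Span C w
    singleton∈Span {w = w} w∈C = 1 , (λ _ → 1ᴿ) , (λ _ → w) , (λ _ → w∈C) , λ x →
      ≈-sym {1ᴿ *ᴿ w x +ᴿ 0ᴿ} {w x} (ℝᶜ.trans {1ᴿ *ᴿ w x +ᴿ 0ᴿ} {1ᴿ *ᴿ w x} {w x}
        (ℝᶜ.+-identityʳ (1ᴿ *ᴿ w x)) (ℝᶜ.*-identityˡ (w x)))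

    HasDimension-resp-≐ : ∀ {U V : Pred (Point X) 0ℓ} {k} → U ≐ V → HasDimension U k → HasDimension V k
    HasDimension-resp-≐ (U⊆V , V⊆U) (v , v∈U , independent , spanning) =
      v , (λ i → U⊆V {v i} (v∈U i)) , independent , λ w w∈V → spanning w (V⊆U {w} w∈V)

    Span-mono : ∀ {C D : Pred (Point X) 0ℓ} → C ⊆ D → Span C ⊆ Span D
    Span-mono C⊆D (k , c , v , v∈C , w≈) = k , c , v , (λ i → C⊆D {v i} (v∈C i)) , w≈

    HasConeDimension-resp-≐ : ∀ {C D : Pred (Point X) 0ℓ} {k} → C ≐ D →
                              HasConeDimension C k → HasConeDimension D k
    HasConeDimension-resp-≐ {C} {D} (C⊆D , D⊆C) = HasDimension-resp-≐ {Span C} {Span D}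
      ((λ {w} → Span-mono {C} {D} (λ {v} → C⊆D {v}) {w}) , (λ {w} → Span-mono {D} {C} (λ {v} → D⊆C {v}) {w}))

    private
      -- If k > n, a kernel vector of the coefficient matrix gives a dependence among the k vectors.
      -- Its existence up to double negation is enough: k ≤ n is decidable, so only a contradiction
      -- has to be derived.
      ≤-dimension : ∀ {U : Pred (Point X) 0ℓ} {k n} → HasDimension U k → HasDimension U n → k ℕ.≤ n
      ≤-dimension {U} {k} {n} (v , v∈U , independent , _) (w , _ , _ , spanning) with k ℕ.≤? n
      ... | yes k≤n = k≤n
      ... | no  k≰n = ⊥-elim (kernel x*y≈0⇒y≈0 1≉0 (ℕₚ.≰⇒> k≰n) (λ j i → A i j)
                        λ (c , c≉0 , eqs) → c≉0 (independent c (vanishes c eqs)))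
        where
        A : Fin k → Fin n → ℝ
        A i = proj₁ (spanning (v i) (v∈U i))
        open import Relation.Binary.Reasoning.Setoid ℝᶜ.setoid
        vanishes : ∀ c → (∀ j → sum (λ i → A i j *ᴿ c i) ≈ᴿ 0ᴿ) → linearCombination c v ≈ᵥ 0ᵥ
        vanishes c eqs x = begin
          linearCombination c v x
            ≡⟨ lc-sum c v x ⟩
          sum (λ i → c i *ᴿ v i x)
            ≈⟨ sum-cong (λ i → c i *ᴿ v i x) (λ i → c i *ᴿ sum (λ j → A i j *ᴿ w j x)) (λ i →
                 *-cong {c i} {c i} {v i x} {sum (λ j → A i j *ᴿ w j x)} (≈-refl {c i})
                   (≡.subst (v i x ≈ᴿ_) (lc-sum (A i) w x) (proj₂ (spanning (v i) (v∈U i)) x))) ⟩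
          sum (λ i → c i *ᴿ sum (λ j → A i j *ᴿ w j x))
            ≈⟨ sum-compose A c (λ j → w j x) ⟩
          sum (λ j → sum (λ i → A i j *ᴿ c i) *ᴿ w j x)
            ≈⟨ sum-zero (λ j → sum (λ i → A i j *ᴿ c i) *ᴿ w j x) (λ j →
                 ℝᶜ.trans {sum (λ i → A i j *ᴿ c i) *ᴿ w j x} {0ᴿ *ᴿ w j x} {0ᴿ}
                   (*-cong {sum (λ i → A i j *ᴿ c i)} {0ᴿ} {w j x} {w j x} (eqs j) (≈-refl {w j x}))
                   (ℝᶜ.zeroˡ (w j x))) ⟩
          0ᴿ ∎

    HasDimension-unique : ∀ {U : Pred (Point X) 0ℓ} {k n} → HasDimension U k → HasDimension U n → k ≡ n
    HasDimension-unique d e = ℕₚ.≤-antisym (≤-dimension d e) (≤-dimension e d)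

-- Minimal terms at sums of points, and points with natural coordinates

module Tropical where

  open import Data.Empty using (⊥-elim)
  open import Data.Fin using (Fin; zero; suc)
  import Data.Fin.Properties as Finₚ
  open import Data.Fin.Subset as Subset using (Subset; inside; ∣_∣; _-_) renaming (_∈_ to _∈ₛ_)
  import Data.Fin.Subset.Properties as Subsetₚ
  import Data.Integer as ℤ
  open import Data.List using ([]; _∷_; length; lookup; foldr)
  open import Data.Nat as ℕ using (ℕ; zero; suc; z≤n; s≤s)
  import Data.Nat.Properties as ℕₚ
  open import Data.Product using (∃; _×_; _,_; proj₂)
  open import Data.Rational as ℚ using (ℚ; 0ℚ; 1ℚ; ½)
  import Data.Rational.Properties as ℚₚ
  open import Data.Rational.Solver using (module +-*-Solver)
  open import Data.Vec using ([]; _∷_; tabulate)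
  import Data.Vec.Properties as Vecₚ
  open import Function using (_∘_)
  open import Relation.Binary.PropositionalEquality
  open import Relation.Nullary using (¬_; Dec; yes; no; does)
  open import Relation.Nullary.Decidable using (map′)
  open Reals
  open RealRing
  open LinearAlgebra
  open VectorSpaces

  open ℝ
  open +-*-Solver using (solve; _:+_; _:-_; _:*_; :-_; _:=_)
  open IsLinearSubspace

  module _ {X : Set} where

    evaluate-cong : ∀ (u : Monomial X) {v w} → v ≈ᵥ w → evaluate u v ≈ᴿ evaluate u w
    evaluate-cong []      v≈w = ≈-refl {0ᴿ}
    evaluate-cong (x ∷ u) {v} {w} v≈w =
      +-cong {v x} {w x} {evaluate u v} {evaluate u w} (v≈w x) (evaluate-cong u v≈w)

    evaluate-0 : ∀ (u : Monomial X) → evaluate u 0ᵥ ≈ᴿ 0ᴿ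
    evaluate-0 []      = ≈-refl {0ᴿ}
    evaluate-0 (x ∷ u) = ≈-trans {0ᴿ +ᴿ evaluate u 0ᵥ} {0ᴿ +ᴿ 0ᴿ} {0ᴿ}
      (+-cong {0ᴿ} {0ᴿ} {evaluate u 0ᵥ} {0ᴿ} (≈-refl {0ᴿ}) (evaluate-0 u)) (ℝᶜ.+-identityˡ 0ᴿ)


    evaluate-+ : ∀ (u : Monomial X) v w → evaluate u (v +ᵥ w) ≈ᴿ evaluate u v +ᴿ evaluate u w
    evaluate-+ u v w = ≗⇒≈ {evaluate u (v +ᵥ w)} {evaluate u v +ᴿ evaluate u w} (go u)
      where
      go : ∀ u n → seq (evaluate u (v +ᵥ w)) n ≡ seq (evaluate u v) n ℚ.+ seq (evaluate u w) n
      go []      n = refl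
      go (x ∷ u) n = trans (cong (seq (v x) n ℚ.+ seq (w x) n ℚ.+_) (go u n))
        (solve 4 (λ a b c d → (a :+ b) :+ (c :+ d) := (a :+ c) :+ (b :+ d)) refl
          (seq (v x) n) (seq (w x) n) (seq (evaluate u v) n) (seq (evaluate u w) n))

    evaluate-* : ∀ (u : Monomial X) c v → evaluate u (c *ᵥ v) ≈ᴿ c *ᴿ evaluate u v
    evaluate-* u c v = ≗⇒≈ {evaluate u (c *ᵥ v)} {c *ᴿ evaluate u v} (go u)
      where
      go : ∀ u n → seq (evaluate u (c *ᵥ v)) n ≡ seq c n ℚ.* seq (evaluate u v) n
      go []      n = sym (ℚₚ.*-zeroʳ (seq c n))
      go (x ∷ u) n = trans (cong (seq c n ℚ.* seq (v x) n ℚ.+_) (go u n))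
        (sym (ℚₚ.*-distribˡ-+ (seq c n) (seq (v x) n) (seq (evaluate u v) n)))

    term : (f : Polynomial X) → Fin (length f) → Monomial X
    term f i = proj₂ (lookup f i)

    AttainsMinimum-stable : ∀ f {w} {i} → ¬ ¬ AttainsMinimum {X} f w i → AttainsMinimum f w i
    AttainsMinimum-stable f {w} {i} h j =
      ≤-stable {evaluate (term f i) w} {evaluate (term f j) w} λ k → h λ att → k (att j)

    AttainsMinimum-resp-≈ : ∀ f {v w i} → v ≈ᵥ w → AttainsMinimum {X} f v i → AttainsMinimum f w i
    AttainsMinimum-resp-≈ f {v} {w} {i} v≈w att j =
      ≤-resp-≈ {evaluate (term f i) v} {evaluate (term f i) w} {evaluate (term f j) v} {evaluate (term f j) w}
        (evaluate-cong (term f i) v≈w) (evaluate-cong (term f j) v≈w) (att j)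

    AttainsMinimum-+ : ∀ f {v w i} → AttainsMinimum {X} f v i → AttainsMinimum f w i →
                       AttainsMinimum f (v +ᵥ w) i
    AttainsMinimum-+ f {v} {w} {i} p q j = ≤-resp-≈
      {e v i +ᴿ e w i} {e (v +ᵥ w) i} {e v j +ᴿ e w j} {e (v +ᵥ w) j}
      (≈-sym {e (v +ᵥ w) i} {e v i +ᴿ e w i} (evaluate-+ (term f i) v w))
      (≈-sym {e (v +ᵥ w) j} {e v j +ᴿ e w j} (evaluate-+ (term f j) v w))
      (+-mono-≤ {e v i} {e v j} {e w i} {e w j} (p j) (q j))
      where
      e : Point X → Fin (length f) → ℝ
      e v i = evaluate (term f i) v

    -- At a the value of the sum is the least conceivable one, namely the sum of both minima. A term
    -- i minimal for v + w cannot exceed it, and since w is at least as large at i as at a, v is at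
    -- most as large at i as at a.
    AttainsMinimum-+⁻ : ∀ f {v w i a} → AttainsMinimum {X} f v a → AttainsMinimum f w a →
                        AttainsMinimum f (v +ᵥ w) i → AttainsMinimum f v i
    AttainsMinimum-+⁻ f {v} {w} {i} {a} p q r j = ≤-linear₃ (r′ a) (q i) (p j)
      where
      e : Point X → Fin (length f) → ℝ
      e v i = evaluate (term f i) v
      r′ : ∀ j → e v i +ᴿ e w i ≤ᴿ e v j +ᴿ e w j
      r′ j = ≤-resp-≈ {e (v +ᵥ w) i} {e v i +ᴿ e w i} {e (v +ᵥ w) j} {e v j +ᴿ e w j}
        (evaluate-+ (term f i) v w) (evaluate-+ (term f j) v w) (r j)
      ≤-linear₃ : e v i +ᴿ e w i ≤ᴿ e v a +ᴿ e w a → e w a ≤ᴿ e w i → e v a ≤ᴿ e v j → e v i ≤ᴿ e v j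
      ≤-linear₃ h k l = ≤-trans {e v i} {e v a} {e v j}
        (≤-linear₂ {e v i} {e v a} {e v i +ᴿ e w i} {e v a +ᴿ e w a} {e w a} {e w i} h k λ n →
          solve 4 (λ vi va wi wa → va :- vi := ((va :+ wa) :- (vi :+ wi)) :+ (wi :- wa)) refl
            (seq (e v i) n) (seq (e v a) n) (seq (e w i) n) (seq (e w a) n)) l

  natℚ : ℕ → ℚ
  natℚ zero    = 0ℚ
  natℚ (suc n) = 1ℚ ℚ.+ natℚ n

  abstract
    natℚ-+ : ∀ m n → natℚ (m ℕ.+ n) ≡ natℚ m ℚ.+ natℚ n
    natℚ-+ zero    n = sym (ℚₚ.+-identityˡ (natℚ n))
    natℚ-+ (suc m) n = trans (cong (1ℚ ℚ.+_) (natℚ-+ m n)) (sym (ℚₚ.+-assoc 1ℚ (natℚ m) (natℚ n)))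

    private
      0≤1 : 0ℚ ℚ.≤ 1ℚ
      0≤1 = ℚₚ.<⇒≤ (ℚₚ.positive⁻¹ 1ℚ)

      ½<1 : ½ ℚ.< 1ℚ
      ½<1 = ℚ.*<* (ℤ.+<+ (s≤s (s≤s z≤n)))

      natℚ-nonneg : ∀ n → 0ℚ ℚ.≤ natℚ n
      natℚ-nonneg zero    = ℚₚ.≤-refl
      natℚ-nonneg (suc n) = subst (ℚ._≤ 1ℚ ℚ.+ natℚ n) (ℚₚ.+-identityˡ 0ℚ)
        (ℚₚ.+-mono-≤ {0ℚ} {1ℚ} {0ℚ} {natℚ n} 0≤1 (natℚ-nonneg n))

      natℚ-mono : ∀ {m n} → m ℕ.≤ n → natℚ m ℚ.≤ natℚ n
      natℚ-mono {n = n} z≤n = natℚ-nonneg n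
      natℚ-mono (s≤s m≤n)   = ℚₚ.+-monoʳ-≤ 1ℚ (natℚ-mono m≤n)

  natᴿ : ℕ → ℝ
  natᴿ n = constᴿ (natℚ n)

  abstract
    natᴿ-mono : ∀ {m n} → m ℕ.≤ n → natᴿ m ≤ᴿ natᴿ n
    natᴿ-mono {m} {n} m≤n ε 0<ε = 0 , λ _ _ → subst (ℚ._≤ natℚ n ℚ.+ ε) (ℚₚ.+-identityʳ (natℚ m))
      (ℚₚ.+-mono-≤ {natℚ m} {natℚ n} {0ℚ} {ε} (natℚ-mono m≤n) (ℚₚ.<⇒≤ 0<ε))

    -- If n < m, the gap of at least 1 contradicts the inequality with tolerance 1/2. This makes the
    -- order between natural values decidable inside the reals.
    natᴿ-cancel : ∀ {m n} → natᴿ m ≤ᴿ natᴿ n → m ℕ.≤ n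
    natᴿ-cancel {m} {n} h = ℕₚ.≮⇒≥ λ n<m →
      let (N , p) = h ½ (ℚₚ.positive⁻¹ ½) in
      ℚₚ.<-irrefl refl (ℚₚ.<-≤-trans {natℚ n ℚ.+ ½} {natℚ n ℚ.+ 1ℚ} {natℚ n ℚ.+ ½}
        (ℚₚ.+-monoʳ-< (natℚ n) ½<1)
        (ℚₚ.≤-trans {natℚ n ℚ.+ 1ℚ} {natℚ m} {natℚ n ℚ.+ ½}
          (subst (ℚ._≤ natℚ m) (ℚₚ.+-comm 1ℚ (natℚ n)) (natℚ-mono n<m)) (p N ℕₚ.≤-refl)))

  module _ {X : Set} where

    natural : (X → ℕ) → Point X
    natural n x = natᴿ (n x)

    evaluateℕ : Monomial X → (X → ℕ) → ℕ
    evaluateℕ u n = foldr (λ x s → n x ℕ.+ s) 0 u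

    abstract
      evaluate-natural : ∀ u n → evaluate u (natural n) ≈ᴿ natᴿ (evaluateℕ u n)
      evaluate-natural u n = ≗⇒≈ {evaluate u (natural n)} {natᴿ (evaluateℕ u n)} (go u)
        where
        go : ∀ u k → seq (evaluate u (natural n)) k ≡ natℚ (evaluateℕ u n)
        go []      k = refl
        go (x ∷ u) k = trans (cong (natℚ (n x) ℚ.+_) (go u k)) (sym (natℚ-+ (n x) (evaluateℕ u n)))

      natural-+ : ∀ m n → natural (λ x → m x ℕ.+ n x) ≈ᵥ natural m +ᵥ natural n
      natural-+ m n x = ≗⇒≈ {natᴿ (m x ℕ.+ n x)} {natᴿ (m x) +ᴿ natᴿ (n x)} λ _ → natℚ-+ (m x) (n x)

      attainsMinimum? : ∀ f n i → Dec (AttainsMinimum f (natural n) i)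
      attainsMinimum? f n i = Finₚ.all? λ j → map′
        (λ p → ≤-resp-≈ {e i} {E i} {e j} {E j} (≈-sym {E i} {e i} (evaluate-natural (term f i) n))
                 (≈-sym {E j} {e j} (evaluate-natural (term f j) n)) (natᴿ-mono p))
        (λ p → natᴿ-cancel (≤-resp-≈ {E i} {e i} {E j} {e j} (evaluate-natural (term f i) n)
                 (evaluate-natural (term f j) n) p))
        (evaluateℕ (term f i) n ℕ.≤? evaluateℕ (term f j) n)
        where
        e E : Fin (length f) → ℝ
        e i = natᴿ (evaluateℕ (term f i) n)
        E i = evaluate (term f i) (natural n)

    minimizers : (f : Polynomial X) → (X → ℕ) → Subset (length f)
    minimizers f n = tabulate λ i → does (attainsMinimum? f n i)

    ∈minimizers⁺ : ∀ f n {i} → AttainsMinimum f (natural n) i → i ∈ₛ minimizers f n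
    ∈minimizers⁺ f n {i} att = Vecₚ.lookup⇒[]= i _ (trans (Vecₚ.lookup∘tabulate _ i) (dec-true att))
      where
      dec-true : AttainsMinimum f (natural n) i → does (attainsMinimum? f n i) ≡ inside
      dec-true att with attainsMinimum? f n i
      ... | yes _ = refl
      ... | no ¬p = ⊥-elim (¬p att)

    ∈minimizers⁻ : ∀ f n {i} → i ∈ₛ minimizers f n → AttainsMinimum f (natural n) i
    ∈minimizers⁻ f n {i} i∈ = dec-true⁻ (trans (sym (Vecₚ.lookup∘tabulate _ i)) (Vecₚ.[]=⇒lookup i∈))
      where
      dec-true⁻ : does (attainsMinimum? f n i) ≡ inside → AttainsMinimum f (natural n) i
      dec-true⁻ eq with attainsMinimum? f n i
      dec-true⁻ _  | yes p = p
      dec-true⁻ () | no _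

  twoElements⇒2≤∣p∣ : ∀ {n} {p : Subset n} {i j} → i ≢ j → i ∈ₛ p → j ∈ₛ p → 2 ℕ.≤ ∣ p ∣
  twoElements⇒2≤∣p∣ {p = p} {i} {j} i≢j i∈p j∈p =
    ℕₚ.≤-trans (s≤s (ℕₚ.≤-trans (s≤s z≤n)
      (Subsetₚ.x∈p⇒∣p-x∣<∣p∣ (Subsetₚ.x∈p∧x≢y⇒x∈p-y j∈p (i≢j ∘ sym)))))
      (Subsetₚ.x∈p⇒∣p-x∣<∣p∣ i∈p)

  nonempty⁺ : ∀ {n} (p : Subset n) → 1 ℕ.≤ ∣ p ∣ → ∃ λ i → i ∈ₛ p
  nonempty⁺ {n} p 1≤∣p∣ with Subsetₚ.nonempty? p
  ... | yes i = i
  ... | no ¬i = ⊥-elim (ℕₚ.<-irrefl refl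
    (subst (1 ℕ.≤_) (trans (cong ∣_∣ (Subsetₚ.Empty-unique ¬i)) (Subsetₚ.∣⊥∣≡0 n)) 1≤∣p∣))

  2≤∣p∣⇒twoElements : ∀ {n} (p : Subset n) → 2 ℕ.≤ ∣ p ∣ → ∃ λ i → ∃ λ j → i ≢ j × i ∈ₛ p × j ∈ₛ p
  2≤∣p∣⇒twoElements p 2≤∣p∣ =
    let (i , i∈p) = nonempty⁺ p (ℕₚ.≤-trans (s≤s z≤n) 2≤∣p∣)
        (j , j∈)  = nonempty⁺ (p - i)
          (ℕₚ.≤-pred (subst (2 ℕ.≤_) (sym (card-removal i∈p)) 2≤∣p∣))
    in i , j , (λ i≡j → ─⇒∉ p _ j∈ (subst (_∈ₛ Subset.⁅ i ⁆) i≡j (Subsetₚ.x∈⁅x⁆ i))) , i∈p , Subsetₚ.p─q⊆p p _ j∈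

-- The Dressian fan of a matroid: lineality space and classification of cones

module MatroidFans where

  open import Data.Empty using (⊥-elim)
  open import Data.Fin as Fin using (Fin; zero; suc)
  import Data.Fin.Properties as Finₚ
  open import Data.Fin.Subset using (Subset; inside; outside; ∣_∣; _-_) renaming (_∉_ to _∉ₛ_)
  import Data.Fin.Subset.Properties as Subsetₚ
  open import Data.List using (List; []; _∷_; length)
  open import Data.List.Properties using (length-mapMaybe)
  open import Data.List.Membership.Propositional using (_∈_; find; lose)
  open import Data.List.Relation.Unary.All as All using (All; []; _∷_)
  open import Data.List.Relation.Unary.AllPairs using (allPairs?)
  open import Data.List.Relation.Unary.Any as Any using (Any; here; there)
  open import Data.List.Relation.Unary.Unique.Propositional using (Unique)
  import Data.Maybe as Maybe
  open import Data.Nat as ℕ using (ℕ; zero; suc; z≤n; s≤s)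
  import Data.Nat.Properties as ℕₚ
  open import Data.Product using (Σ; ∃; _×_; _,_; proj₁; proj₂)
  open import Data.Sum using (_⊎_; inj₁; inj₂)
  open import Data.Vec using ([]; _∷_)
  open import Function using (_∘_)
  open import Level using (0ℓ)
  open import Relation.Binary.PropositionalEquality
  open import Relation.Nullary using (¬_; Dec; yes; no; recompute)
  open import Relation.Nullary.Decidable using (map′; _×-dec_; _→-dec_; ¬?)
  open import Relation.Unary using (Pred; Decidable; _⊆_; _≐_)
  import Data.Rational as ℚ
  import Data.Rational.Properties as ℚₚ
  open import Data.Rational.Solver using (module +-*-Solver)
  open Reals
  open RealRing
  open LinearAlgebra
  open VectorSpaces
  open Tropical

  open ℝ
  open +-*-Solver using (solve; _:+_; _:-_; _:*_; :-_; _:=_)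

  allSubset? : ∀ {n p} {P : Pred (Subset n) p} → Decidable P → Dec (∀ S → P S)
  allSubset? {zero}  P? = map′ (λ p → λ { [] → p }) (λ f → f []) (P? [])
  allSubset? {suc n} P? = map′ (λ { (p , q) (inside ∷ S) → p S ; (p , q) (outside ∷ S) → q S })
    (λ f → f ∘ (inside ∷_) , f ∘ (outside ∷_))
    (allSubset? (P? ∘ (inside ∷_)) ×-dec allSubset? (P? ∘ (outside ∷_)))

  -- Four distinct indices do not fit into three. It will make the terms minimal at v and those
  -- minimal at -v overlap.
  pigeonhole₃ : ∀ {k} → k ℕ.≤ 3 → {i j i′ j′ : Fin k} → i ≢ j → i′ ≢ j′ →
                (i ≡ i′ ⊎ i ≡ j′) ⊎ (j ≡ i′ ⊎ j ≡ j′)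
  pigeonhole₃ {k} k≤3 {i} {j} {i′} {j′} i≢j i′≢j′ with i Fin.≟ i′ | i Fin.≟ j′ | j Fin.≟ i′ | j Fin.≟ j′
  ... | yes p | _ | _ | _ = inj₁ (inj₁ p)
  ... | no  _ | yes p | _ | _ = inj₁ (inj₂ p)
  ... | no  _ | no  _ | yes p | _ = inj₂ (inj₁ p)
  ... | no  _ | no  _ | no  _ | yes p = inj₂ (inj₂ p)
  ... | no i≢i′ | no i≢j′ | no j≢i′ | no j≢j′ =
    let (a , b , a<b , eq) = Finₚ.pigeonhole (s≤s k≤3) four in ⊥-elim (distinct a b a<b eq)
    where
    four : Fin 4 → Fin k
    four zero                   = i
    four (suc zero)             = j
    four (suc (suc zero))       = i′
    four (suc (suc (suc zero))) = j′
    distinct : ∀ a b → a Fin.< b → four a ≢ four b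
    distinct zero (suc zero) _ = i≢j
    distinct zero (suc (suc zero)) _ = i≢i′
    distinct zero (suc (suc (suc zero))) _ = i≢j′
    distinct (suc zero) (suc (suc zero)) _ = j≢i′
    distinct (suc zero) (suc (suc (suc zero))) _ = j≢j′
    distinct (suc (suc zero)) (suc (suc (suc zero))) _ = i′≢j′
    distinct (suc zero) (suc zero) (s≤s ())
    distinct (suc (suc zero)) (suc zero) (s≤s ())
    distinct (suc (suc zero)) (suc (suc zero)) (s≤s (s≤s ()))
    distinct (suc (suc (suc zero))) (suc zero) (s≤s ())
    distinct (suc (suc (suc zero))) (suc (suc zero)) (s≤s (s≤s ()))
    distinct (suc (suc (suc zero))) (suc (suc (suc zero))) (s≤s (s≤s (s≤s ())))

  module _ {n : ℕ} (M : Matroid n) where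

    open Matroid M using (rank)

    private
      X : Set
      X = Basis M

      Valid : Subset n → (i j k l : Fin n) → Set
      Valid S i j k l = ∣ S ∣ ℕ.+ 2 ≡ rank × Unique (i ∷ j ∷ k ∷ l ∷ []) × All (_∉ₛ S) (i ∷ j ∷ k ∷ l ∷ [])

      valid? : ∀ S i j k l → Dec (Valid S i j k l)
      valid? S i j k l = (∣ S ∣ ℕ.+ 2 ℕ.≟ rank) ×-dec
        allPairs? (λ x y → ¬? (x Fin.≟ y)) (i ∷ j ∷ k ∷ l ∷ []) ×-dec
        All.all? (λ x → ¬? (x Subsetₚ.∈? S)) (i ∷ j ∷ k ∷ l ∷ [])

      index : ∀ S i j k l → .(Valid S i j k l) → PlückerIndex M
      index S i j k l v = record
        { S = S ; i = i ; j = j ; k = k ; l = l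
        ; size = proj₁ v ; distinct = proj₁ (proj₂ v) ; disjoint = proj₂ (proj₂ v) }

    -- Validity of an index is decidable, so its irrelevant proofs can be recomputed and the search
    -- runs over the set and the four elements only.
    allPlückerIndex? : ∀ {p} {Q : Pred (PlückerIndex M) p} → Decidable Q → Dec (∀ P → Q P)
    allPlückerIndex? {Q = Q} Q? = map′
      (λ { h record { S = S ; i = i ; j = j ; k = k ; l = l
                    ; size = size ; distinct = distinct ; disjoint = disjoint } →
           h S i j k l (recompute (valid? S i j k l) (size , distinct , disjoint)) })
      (λ h S i j k l v → h (index S i j k l v))
      (allSubset? λ S → Finₚ.all? λ i → Finₚ.all? λ j → Finₚ.all? λ k → Finₚ.all? λ l → inner S i j k l)
      where
      inner : ∀ S i j k l → Dec (∀ (v : Valid S i j k l) → Q (index S i j k l v))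
      inner S i j k l with valid? S i j k l
      ... | yes v = map′ (λ q _ → q) (λ h → h v) (Q? (index S i j k l v))
      ... | no ¬v = yes λ v → ⊥-elim (¬v v)

    infix 4 _≼_

    -- For v in the Dressian this says that w lies in the smallest cone containing v. So v and w lie
    -- in the relative interior of the same cone if each is ≼ the other.
    _≼_ : Point X → Point X → Set
    v ≼ w = ∀ P i → AttainsMinimum (G M P) v i → AttainsMinimum (G M P) w i

    Lineality : Pred (Point X) 0ℓ
    Lineality w = ∀ P i → AttainsMinimum (G M P) w i

    length-G : ∀ P → length (G M P) ℕ.≤ 3
    length-G P = length-mapMaybe (λ (s , u) → Maybe.map (s ,_) (restrictMonomial M u)) (threeTermRelation M P)

    lineality-isLinearSubspace : IsLinearSubspace Lineality
    lineality-isLinearSubspace = record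
      { respects = λ v≈w v∈L P i → AttainsMinimum-resp-≈ (G M P) v≈w (v∈L P i)
      ; zero∈    = λ P i j → ≤-resp-≈ {0ᴿ} {evaluate (term (G M P) i) 0ᵥ} {0ᴿ} {evaluate (term (G M P) j) 0ᵥ}
          (≈-sym {evaluate (term (G M P) i) 0ᵥ} {0ᴿ} (evaluate-0 (term (G M P) i)))
          (≈-sym {evaluate (term (G M P) j) 0ᵥ} {0ᴿ} (evaluate-0 (term (G M P) j))) (≤-refl {0ᴿ})
      ; +-closed = λ v∈L w∈L P i → AttainsMinimum-+ (G M P) (v∈L P i) (w∈L P i)
      ; *-closed = λ c {v} v∈L P i j →
          let e k = evaluate (term (G M P) k) v
              E k = evaluate (term (G M P) k) (c *ᵥ v)
          in proj₁ (≈-trans {E i} {c *ᴿ e i} {E j} (evaluate-* (term (G M P) i) c v)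
               (≈-trans {c *ᴿ e i} {c *ᴿ e j} {E j}
                 (*-cong {c} {c} {e i} {e j} (≈-refl {c}) (v∈L P i j , v∈L P j i))
                 (≈-sym {E j} {c *ᴿ e j} (evaluate-* (term (G M P) j) c v))))
      }

    lineality-translates : ∀ w u → Dressian M w → Lineality u → Dressian M (w +ᵥ u)
    lineality-translates w u w∈D u∈L P with w∈D P
    ... | inj₁ eq = inj₁ eq
    ... | inj₂ (i , j , i≢j , p , q) = inj₂ (i , j , i≢j ,
            AttainsMinimum-+ (G M P) p (u∈L P i) , AttainsMinimum-+ (G M P) q (u∈L P j))

    private
      -1ᴿ : ℝ
      -1ᴿ = -ᴿ 1ᴿ

      evaluate-neg : ∀ (u : Monomial X) v → evaluate u (-1ᴿ *ᵥ v) ≈ᴿ -ᴿ evaluate u v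
      evaluate-neg u v = ≈-trans {evaluate u (-1ᴿ *ᵥ v)} { -1ᴿ *ᴿ evaluate u v} { -ᴿ evaluate u v}
        (evaluate-* u -1ᴿ v) (≗⇒≈ { -1ᴿ *ᴿ evaluate u v} { -ᴿ evaluate u v} λ k →
          trans (sym (ℚₚ.neg-distribˡ-* ℚ.1ℚ (seq (evaluate u v) k)))
            (cong ℚ.-_ (ℚₚ.*-identityˡ (seq (evaluate u v) k))))

      -- Among at most three terms, a term minimal at v is also minimal at -v.
      opposite : ∀ P v → TropicalHypersurface (G M P) v → TropicalHypersurface (G M P) (-1ᴿ *ᵥ v) →
                 ∀ i → AttainsMinimum (G M P) v i
      opposite P v (inj₁ eq) _ i = ⊥-elim (Finₚ.¬Fin0 (subst (Fin ∘ length) eq i))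
      opposite P v (inj₂ _) (inj₁ eq) i = ⊥-elim (Finₚ.¬Fin0 (subst (Fin ∘ length) eq i))
      opposite P v (inj₂ (i , j , i≢j , p , q)) (inj₂ (i′ , j′ , i′≢j′ , p′ , q′)) t =
        shared (pigeonhole₃ (length-G P) i≢j i′≢j′)
        where
        e : Fin (length (G M P)) → ℝ
        e k = evaluate (term (G M P) k) v
        E : Fin (length (G M P)) → ℝ
        E k = evaluate (term (G M P) k) (-1ᴿ *ᵥ v)
        maximal : ∀ {a} → AttainsMinimum (G M P) (-1ᴿ *ᵥ v) a → ∀ k → e k ≤ᴿ e a
        maximal {a} h k = ≤-linear₁ {e k} {e a} { -ᴿ e a} { -ᴿ e k}
          (≤-resp-≈ {E a} { -ᴿ e a} {E k} { -ᴿ e k}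
            (evaluate-neg (term (G M P) a) v) (evaluate-neg (term (G M P) k) v) (h k))
          λ m → solve 2 (λ a b → b :- a := (:- a) :- (:- b)) refl (seq (e k) m) (seq (e a) m)
        all-minimal : ∀ {a} → AttainsMinimum (G M P) v a → AttainsMinimum (G M P) (-1ᴿ *ᵥ v) a →
                      AttainsMinimum (G M P) v t
        all-minimal {a} m m′ k = ≤-trans {e t} {e a} {e k} (maximal m′ t) (m k)
        shared : (i ≡ i′ ⊎ i ≡ j′) ⊎ (j ≡ i′ ⊎ j ≡ j′) → AttainsMinimum (G M P) v t
        shared (inj₁ (inj₁ refl)) = all-minimal p p′
        shared (inj₁ (inj₂ refl)) = all-minimal p q′
        shared (inj₂ (inj₁ refl)) = all-minimal q p′
        shared (inj₂ (inj₂ refl)) = all-minimal q q′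

    TropicalHypersurface-resp-≈ : ∀ (f : Polynomial X) {v w} → v ≈ᵥ w →
                                  TropicalHypersurface f v → TropicalHypersurface f w
    TropicalHypersurface-resp-≈ f v≈w (inj₁ eq) = inj₁ eq
    TropicalHypersurface-resp-≈ f v≈w (inj₂ (i , j , i≢j , p , q)) =
      inj₂ (i , j , i≢j , AttainsMinimum-resp-≈ f v≈w p , AttainsMinimum-resp-≈ f v≈w q)

    -- For maximality, let translations by L′ preserve the Dressian and let u be in L′. Translating
    -- the origin shows that u and -u are both in the Dressian, and by `opposite` all terms of every
    -- relation tie at u.
    isLinealitySpace : Dressian M 0ᵥ → IsLinealitySpace (Dressian M) Lineality
    isLinealitySpace 0∈D = (lineality-isLinearSubspace , lineality-translates) , maximal
      where
      maximal : ∀ L′ → IsLinearSubspace L′ × (∀ w u → Dressian M w → L′ u → Dressian M (w +ᵥ u)) →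
                L′ ⊆ Lineality
      maximal L′ (isL′ , translates) {u} u∈L′ P = opposite P u
        (TropicalHypersurface-resp-≈ (G M P) (λ x → ℝᶜ.+-identityˡ (u x)) (translates 0ᵥ u 0∈D u∈L′ P))
        (TropicalHypersurface-resp-≈ (G M P) (λ x → ℝᶜ.+-identityˡ ((-1ᴿ *ᵥ u) x))
          (translates 0ᵥ (-1ᴿ *ᵥ u) 0∈D (IsLinearSubspace.*-closed isL′ -1ᴿ u∈L′) P))

    cone⊆Dressian : ∀ τ {w} → cone (dressianFan M) τ w → Dressian M w
    cone⊆Dressian τ w∈τ P with proj₂ (τ P)
    ... | inj₁ eq    = inj₁ eq
    ... | inj₂ 2≤∣T∣ =
      let (i , j , i≢j , i∈T , j∈T) = 2≤∣p∣⇒twoElements (proj₁ (τ P)) 2≤∣T∣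
      in inj₂ (i , j , i≢j , w∈τ P i∈T , w∈τ P j∈T)

    lineality⊆cone : ∀ τ {w} → Lineality w → cone (dressianFan M) τ w
    lineality⊆cone τ w∈L P {i} _ = w∈L P i

    natural∈cone? : ∀ τ (n : X → ℕ) → Dec (cone (dressianFan M) τ (natural n))
    natural∈cone? τ n = map′ (λ h P {i} → h P i) (λ h P i → h P {i})
      (allPlückerIndex? λ P → Finₚ.all? λ i →
        (i Subsetₚ.∈? proj₁ (τ P)) →-dec attainsMinimum? (G M P) n i)

    -- The cone of the fan with the given point in its relative interior.
    coneIndex : (n : X → ℕ) → Dressian M (natural n) → Fan.Index (dressianFan M)
    coneIndex n n∈D P = minimizers (G M P) n , atLeastTwo (n∈D P)
      where
      atLeastTwo : TropicalHypersurface (G M P) (natural n) → G M P ≡ [] ⊎ 2 ℕ.≤ ∣ minimizers (G M P) n ∣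
      atLeastTwo (inj₁ eq) = inj₁ eq
      atLeastTwo (inj₂ (i , j , i≢j , p , q)) =
        inj₂ (twoElements⇒2≤∣p∣ i≢j (∈minimizers⁺ (G M P) n p) (∈minimizers⁺ (G M P) n q))

    ≼⇒∈cone : ∀ n n∈D {w} → natural n ≼ w → cone (dressianFan M) (coneIndex n n∈D) w
    ≼⇒∈cone n n∈D n≼w P i∈T = n≼w P _ (∈minimizers⁻ (G M P) n i∈T)

    ∈cone⇒≼ : ∀ n n∈D {w} → cone (dressianFan M) (coneIndex n n∈D) w → natural n ≼ w
    ∈cone⇒≼ n n∈D w∈cone P i p = w∈cone P (∈minimizers⁺ (G M P) n p)

    ≐⇒≼ : ∀ m m∈D n n∈D → cone (dressianFan M) (coneIndex m m∈D) ≐ cone (dressianFan M) (coneIndex n n∈D) →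
          natural n ≼ natural m
    ≐⇒≼ m m∈D n n∈D (m⊆n , _) =
      ∈cone⇒≼ n n∈D (m⊆n {natural m} (≼⇒∈cone m m∈D {natural m} λ _ _ p → p))

    ≼-stable : ∀ {v w} → ¬ ¬ (v ≼ w) → v ≼ w
    ≼-stable {v} {w} h P i p = AttainsMinimum-stable (G M P) λ k → h λ v≼w → k (v≼w P i p)

    ≼-natural? : ∀ m n → Dec (natural m ≼ natural n)
    ≼-natural? m n = allPlückerIndex? λ P → Finₚ.all? λ i →
      attainsMinimum? (G M P) m i →-dec attainsMinimum? (G M P) n i

    -- The hypothesis `real` supplies a cell only up to double negation. This suffices: equivalence
    -- of natural points is decidable, so for them a cell can be searched for, and ≼ is stable, so
    -- inclusions of cones may use `real` at arbitrary points.
    module Classification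
      {A : Set} (cells : List A) (point : A → X → ℕ)
      (inDressian : ∀ {a} → a ∈ cells → Dressian M (natural (point a)))
      (real : ∀ w → Dressian M w → ¬ ¬ (∃ λ a → a ∈ cells × w ≼ natural (point a) × natural (point a) ≼ w))
      where

      private
        Equivalent : (X → ℕ) → A → Set
        Equivalent n a = natural n ≼ natural (point a) × natural (point a) ≼ natural n

        integral : ∀ n → Dressian M (natural n) → ∃ λ a → a ∈ cells × Equivalent n a
        integral n n∈D = decide (Any.any? (λ a → ≼-natural? n (point a) ×-dec ≼-natural? (point a) n) cells)
          where
          decide : Dec (Any (Equivalent n) cells) → ∃ λ a → a ∈ cells × Equivalent n a
          decide (yes p) = find p
          decide (no ¬p) = ⊥-elim (real (natural n) n∈D λ (a , a∈ , e) → ¬p (lose a∈ e))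

        module _ (τ : Fan.Index (dressianFan M)) where

          C : Pred (Point X) 0ℓ
          C = cone (dressianFan M) τ

          ≼-closed : ∀ {v w} → C v → v ≼ w → C w
          ≼-closed v∈C v≼w P i∈T = v≼w P _ (v∈C P i∈T)

          -- Both points are minimal at a common term, so the terms minimal at
          -- their sum are those minimal at both.
          summand : ∀ {v w} → C v → C w → (v +ᵥ w) ≼ v
          summand {v} {w} v∈C w∈C P i p = split (proj₂ (τ P))
            where
            split : G M P ≡ [] ⊎ 2 ℕ.≤ ∣ proj₁ (τ P) ∣ → AttainsMinimum (G M P) v i
            split (inj₁ eq)    = ⊥-elim (Finₚ.¬Fin0 (subst (Fin ∘ length) eq i))
            split (inj₂ 2≤∣T∣) =
              let (a , a∈T) = nonempty⁺ (proj₁ (τ P)) (ℕₚ.≤-trans (s≤s z≤n) 2≤∣T∣)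
              in AttainsMinimum-+⁻ (G M P) {v} {w} {i} {a} (v∈C P a∈T) (w∈C P a∈T) p

          Above : A → A → Set
          Above a b = natural (point a) ≼ natural (point b)

          -- The sum of both points stays in the cone and is ≼ each of them by `summand`; c is the
          -- listed cell equivalent to that sum.
          join : ∀ {a b} → C (natural (point a)) → C (natural (point b)) →
                 ∃ λ c → c ∈ cells × C (natural (point c)) × Above c a × Above c b
          join {a} {b} a∈C b∈C =
            let s = λ x → point a x ℕ.+ point b x
                u = natural (point a)
                v = natural (point b)
                s≈ = natural-+ (point a) (point b)
                s∈C : C (natural s)
                s∈C P i∈T = AttainsMinimum-resp-≈ (G M P) {u +ᵥ v} {natural s}
                  (λ x → ≈-sym {natural s x} {(u +ᵥ v) x} (s≈ x))
                  (AttainsMinimum-+ (G M P) (a∈C P i∈T) (b∈C P i∈T))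
                (c , c∈ , s≼c , c≼s) = integral s (cone⊆Dressian τ {natural s} s∈C)
            in c , c∈ , ≼-closed {natural s} {natural (point c)} s∈C s≼c ,
               (λ P i p → summand {u} {v} a∈C b∈C P i
                 (AttainsMinimum-resp-≈ (G M P) s≈ (c≼s P i p))) ,
               (λ P i p → summand {v} {u} b∈C a∈C P i
                 (AttainsMinimum-resp-≈ (G M P)
                   (λ x → ≈-trans {natural s x} {(u +ᵥ v) x} {(v +ᵥ u) x} (s≈ x) (ℝᶜ.+-comm (u x) (v x)))
                   (c≼s P i p)))

          -- The origin lies in every cone. Its cell starts the recursion of `largest`.
          start : ∃ λ c → c ∈ cells × C (natural (point c))
          start =
            let z = λ _ → 0
                z∈L : Lineality (natural z)
                z∈L = IsLinearSubspace.zero∈ lineality-isLinearSubspace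
                (c , c∈ , z≼c , _) = integral z (cone⊆Dressian τ {natural z} (lineality⊆cone τ {natural z} z∈L))
            in c , c∈ , ≼-closed {natural z} {natural (point c)} (lineality⊆cone τ {natural z} z∈L) z≼c

          largest : ∀ xs → ∃ λ c → c ∈ cells × C (natural (point c)) ×
                    (∀ {a} → a ∈ xs → C (natural (point a)) → Above c a)
          largest [] = let (c , c∈ , c∈C) = start in c , c∈ , c∈C , λ ()
          largest (x ∷ xs) = extend (largest xs) (natural∈cone? τ (point x))
            where
            Largest : List A → Set
            Largest ys = ∃ λ c → c ∈ cells × C (natural (point c)) ×
                         (∀ {a} → a ∈ ys → C (natural (point a)) → Above c a)
            extend : Largest xs → Dec (C (natural (point x))) → Largest (x ∷ xs)
            extend (c , c∈ , c∈C , above) (no x∉C) = c , c∈ , c∈C , λ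
              { (here refl) x∈C → ⊥-elim (x∉C x∈C) ; (there a∈) → above a∈ }
            extend (c , c∈ , c∈C , above) (yes x∈C) =
              let (d , d∈ , d∈C , d≼c , d≼x) = join c∈C x∈C in d , d∈ , d∈C , λ
              { (here refl) _ → d≼x ; (there a∈) a∈C P i p → above a∈ a∈C P i (d≼c P i p) }

      -- Any w in the cone of τ is equivalent to a cell d, which then also lies in that cone. As c
      -- was chosen with c ≼ d for every such d, it follows that c ≼ w; so τ gives the smallest cone
      -- containing c.
      classify : ∀ τ → ∃ λ a → Σ (a ∈ cells) λ a∈ →
                 cone (dressianFan M) τ ≐ cone (dressianFan M) (coneIndex (point a) (inDressian a∈))
      classify τ =
        let (c , c∈ , c∈C , above) = largest τ cells
        in c , c∈ ,
           (λ {w} w∈C → ≼⇒∈cone (point c) (inDressian c∈) {w} (≼-stable {natural (point c)} {w} λ k →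
             real w (cone⊆Dressian τ {w} w∈C) λ (d , d∈ , w≼d , d≼w) →
               k λ P i p → d≼w P i (above d∈ (≼-closed τ {w} {natural (point d)} w∈C w≼d) P i p))) ,
           (λ {w} w∈c → ≼-closed τ {natural (point c)} {w} c∈C
             (∈cone⇒≼ (point c) (inDressian c∈) {w} w∈c))

-- Hyperplanes of M(K₅) and the shapes of the Plücker relations

module Configuration where

  open import Data.Bool using (Bool; true; false; if_then_else_; _xor_; _∧_; _∨_; not)
  open import Data.Fin as Fin using (Fin; zero; suc; #_)
  import Data.Fin.Properties as Finₚ
  open import Data.Fin.Subset using (Subset; ∁; ∣_∣)
  import Data.Fin.Subset.Properties as Subsetₚ
  open import Data.Bool.ListAction using (any)
  open import Data.List using (List; []; _∷_; _++_; catMaybes)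
  open import Data.List.Relation.Unary.All using (All; []; _∷_)
  import Data.Maybe.Properties as Maybeₚ
  open import Data.Maybe as Maybe using (Maybe; just; nothing; is-just; _<∣>_)
  open import Data.Nat as ℕ using (ℕ; zero; suc)
  open import Data.Product using (∃; _×_; _,_; proj₁; proj₂)
  open import Data.Sum using (_⊎_; inj₁; inj₂)
  open import Data.Vec as Vec using (Vec; []; _∷_; tabulate; lookup; zipWith)
  import Data.Vec.Properties as Vecₚ
  import Data.Bool.Properties as Boolₚ
  open import Function using (_∘_)
  open import Relation.Binary.PropositionalEquality
  open import Relation.Nullary using (Dec; yes; no; does)
  open import Relation.Nullary.Decidable using (dec-false; dec⇒maybe; _×-dec_; _⊎-dec_)
  open Tropical
  open MatroidFans

  Flat : Set
  Flat = Fin 15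

  -- The elements are labelled by the edges of K₅ so that the nonbases are the triangles.
  edge : Fin 10 → Fin 5 × Fin 5
  edge e = lookup
    ( (# 0 , # 1) ∷ (# 2 , # 3) ∷ (# 0 , # 4) ∷ (# 0 , # 2) ∷ (# 2 , # 4)
    ∷ (# 0 , # 3) ∷ (# 1 , # 2) ∷ (# 1 , # 4) ∷ (# 1 , # 3) ∷ (# 3 , # 4) ∷ []) e

  -- A hyperplane of M(K₅) is a bipartition of the vertices, given by its smaller part.
  part : Flat → Subset 5
  part F = lookup (Vec.fromList (subsets 5 1 ++ subsets 5 2)) F

  hyperplane : Flat → Subset 10
  hyperplane F = tabulate λ e →
    not (lookup (part F) (proj₁ (edge e)) xor lookup (part F) (proj₂ (edge e)))

  -- The last index is the default when the predicate holds nowhere.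
  first : ∀ {n} → (Fin (suc n) → Bool) → Fin (suc n)
  first {zero}  p = zero
  first {suc n} p = if p zero then zero else suc (first (p ∘ suc))

  -- A basis has rank 3 in M(K₅), a matroid of rank 4, so exactly one hyperplane contains it, and
  -- that is its span.
  flat : Subset 10 → Flat
  flat σ = first λ F → does (σ Subsetₚ.⊆? hyperplane F)

  findPart : Subset 5 → Maybe Flat
  findPart A = dec⇒maybe (Finₚ.any? λ F → Vecₚ.≡-dec Boolₚ._≟_ (part F) A) Maybe.>>= (just ∘ proj₁)

  -- Three hyperplanes are collinear if their parts add up to ∅ or everything
  -- modulo 2 and they are not three edges of a triangle of K₅.
  third : Flat → Flat → Maybe Flat
  third F F′ = if (∣ part F ∣ ℕ.≡ᵇ 2) ∧ (∣ part F′ ∣ ℕ.≡ᵇ 2) ∧ (∣ C ∣ ℕ.≡ᵇ 2) then nothing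
               else findPart C <∣> findPart (∁ C)
    where
    C : Subset 5
    C = zipWith _xor_ (part F) (part F′)

  data Line (F F′ F″ : Flat) : Set where
    collinear : third F F′ ≡ just F″ → Line F F′ F″

  closure : Fin 10 → Fin 10 → Fin 10 → Maybe Flat
  closure s a b = Maybe.map (λ β → flat (Basis.set β)) (restrictVariable desargues (triple s a b))

  -- The pair (f , g) stands for the linear form x f + x g, so its order is immaterial; hence
  -- `SameForm`.
  Form : Set
  Form = Flat × Flat

  -- A relation only involves the flats spanned by its bases, once a summand
  -- common to all its terms has been removed.
  forms : (Fin 10 → Fin 10 → Maybe Flat) → (i j k l : Fin 10) → List Form
  forms c i j k l = catMaybes
    (Maybe.zip (c i j) (c k l) ∷ Maybe.zip (c i k) (c j l) ∷ Maybe.zip (c i l) (c j k) ∷ [])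

  SameForm : Form → Form → Set
  SameForm (f , g) (f′ , g′) = (f ≡ f′ × g ≡ g′) ⊎ (f ≡ g′ × g ≡ f′)

  sameForm? : ∀ p q → Dec (SameForm p q)
  sameForm? (f , g) (f′ , g′) = ((f Fin.≟ f′) ×-dec (g Fin.≟ g′)) ⊎-dec ((f Fin.≟ g′) ×-dec (g Fin.≟ f′))

  -- The cases reflect the position of i, j, k, l in the contraction of M(K₅) by s. If two are
  -- parallel, one term vanishes and the other two agree as forms (`binomial`). If three are
  -- collinear, they and s span a hyperplane h that occurs in every term, while a, b, c contain s,
  -- the fourth element and one of the three (`line`). In general position the six hyperplanes
  -- through s and two of the elements are the vertices of a quadrilateral, whose four lines belong
  -- to i, j, k, l in this order (`quad`).
  data Kind (L : Flat → Flat → Flat → Set) : List Form → Set where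
    binomial : ∀ {p q} → SameForm p q → Kind L (p ∷ q ∷ [])
    line     : ∀ {p q r} h {a b c} → SameForm p (h , a) → SameForm q (h , b) → SameForm r (h , c) →
               L a b c → Kind L (p ∷ q ∷ r ∷ [])
    quad     : ∀ {f f′ g g′ h h′} → L f g h → L f g′ h′ → L f′ g h′ → L f′ g′ h →
               Kind L ((f , f′) ∷ (g , g′) ∷ (h , h′) ∷ [])

  mapKind : ∀ {L L′ : Flat → Flat → Flat → Set} → (∀ {a b c} → L a b c → L′ a b c) →
            ∀ {qs} → Kind L qs → Kind L′ qs
  mapKind f (binomial p)         = binomial p
  mapKind f (line h p q r l)     = line h p q r (f l)
  mapKind f (quad l₁ l₂ l₃ l₄)   = quad (f l₁) (f l₂) (f l₃) (f l₄)

  other : (h : Flat) (p : Form) → Maybe (∃ λ a → SameForm p (h , a))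
  other h (f , g) = decide (f Fin.≟ h) (g Fin.≟ h)
    where
    decide : Dec (f ≡ h) → Dec (g ≡ h) → Maybe (∃ λ a → SameForm (f , g) (h , a))
    decide (yes f≡h) _         = just (g , inj₁ (f≡h , refl))
    decide (no _)    (yes g≡h) = just (f , inj₂ (refl , g≡h))
    decide (no _)    (no _)    = nothing

  module _ {L : Flat → Flat → Flat → Set} (line? : ∀ a b c → Dec (L a b c)) where

    private
      lineAt : ∀ h p q r → Maybe (Kind L (p ∷ q ∷ r ∷ []))
      lineAt h p q r =
        other h p Maybe.>>= λ (a , p≡) → other h q Maybe.>>= λ (b , q≡) → other h r Maybe.>>= λ (c , r≡) →
        Maybe.map (line h p≡ q≡ r≡) (dec⇒maybe (line? a b c))

      quad? : ∀ p q r → Maybe (Kind L (p ∷ q ∷ r ∷ []))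
      quad? (f , f′) (g , g′) (h , h′) =
        dec⇒maybe (line? f g h) Maybe.>>= λ l₁ → dec⇒maybe (line? f g′ h′) Maybe.>>= λ l₂ →
        dec⇒maybe (line? f′ g h′) Maybe.>>= λ l₃ → Maybe.map (quad l₁ l₂ l₃) (dec⇒maybe (line? f′ g′ h))

    kind? : ∀ qs → Maybe (Kind L qs)
    kind? (p ∷ q ∷ [])     = Maybe.map binomial (dec⇒maybe (sameForm? p q))
    -- The hyperplane common to all terms of a `line` must be an entry of the first form.
    kind? (p ∷ q ∷ r ∷ []) = lineAt (proj₁ p) p q r <∣> lineAt (proj₂ p) p q r <∣> quad? p q r
    kind? _                = nothing

  table : ∀ {A : Set} {n} → (Fin n → Fin n → A) → Vec (Vec A n) n
  table f = tabulate λ i → tabulate (f i)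

  entry : ∀ {A : Set} {n} → Vec (Vec A n) n → Fin n → Fin n → A
  entry t i j = lookup (lookup t i) j

  entry-table : ∀ {A : Set} {n} (f : Fin n → Fin n → A) i j → entry (table f) i j ≡ f i j
  entry-table f i j = trans (cong (λ r → lookup r j) (Vecₚ.lookup∘tabulate (λ i → tabulate (f i)) i))
                            (Vecₚ.lookup∘tabulate (f i) j)

  all : ∀ {n} → (Fin n → Bool) → Bool
  all {zero}  p = true
  all {suc n} p = p zero ∧ all (p ∘ suc)

  all-sound : ∀ {n} (p : Fin n → Bool) → all p ≡ true → ∀ i → p i ≡ true
  all-sound p eq zero    = Boolₚ.∧-conicalˡ (p zero) _ eq
  all-sound p eq (suc i) = all-sound (p ∘ suc) (Boolₚ.∧-conicalʳ (p zero) _ eq) i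

  allFresh : ∀ {n} → List (Fin n) → (Fin n → Bool) → Bool
  allFresh xs p = all λ i → any (λ x → does (i Fin.≟ x)) xs ∨ p i

  allFresh-sound : ∀ {n} xs (p : Fin n → Bool) → allFresh xs p ≡ true → ∀ {i} → All (i ≢_) xs → p i ≡ true
  allFresh-sound xs p eq {i} fresh =
    subst (λ b → b ∨ p i ≡ true) (none xs fresh)
      (all-sound (λ i → any (λ x → does (i Fin.≟ x)) xs ∨ p i) eq i)
    where
    none : ∀ xs → All (i ≢_) xs → any (λ x → does (i Fin.≟ x)) xs ≡ false
    none []       []           = refl
    none (x ∷ xs) (i≢x ∷ rest) = cong₂ _∨_ (dec-false (i Fin.≟ x) i≢x) (none xs rest)

  -- Tables of lines and closures are arguments here so that they are computed only once.
  private
    LineTable ClosureTable : Set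
    LineTable    = Vec (Vec (Maybe Flat) 15) 15
    ClosureTable = Vec (Vec (Maybe Flat) 10) 10

    tableLine? : (t : LineTable) → ∀ a b c → Dec (entry t a b ≡ just c)
    tableLine? t a b c = Maybeₚ.≡-dec Fin._≟_ (entry t a b) (just c)

    module _ (t : LineTable) (cl : ClosureTable) (s : Fin 10) where
      check₄ : (i j k l : Fin 10) → Bool
      check₄ i j k l = is-just (kind? (tableLine? t) (forms (entry cl) i j k l))
      check₃ : (i j k : Fin 10) → Bool
      check₃ i j k = allFresh (s ∷ i ∷ j ∷ k ∷ []) (check₄ i j k)
      check₂ : (i j : Fin 10) → Bool
      check₂ i j = allFresh (s ∷ i ∷ j ∷ []) (check₃ i j)
      check₁ : (i : Fin 10) → Bool
      check₁ i = allFresh (s ∷ i ∷ []) (check₂ i)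
      check₀ : Bool
      check₀ = allFresh (s ∷ []) check₁

    abstract
      kinds-checked : all (λ s → check₀ (table third) (table (closure s)) s) ≡ true
      kinds-checked = refl

  forms-cong : ∀ {c c′ : Fin 10 → Fin 10 → Maybe Flat} → (∀ a b → c a b ≡ c′ a b) →
               ∀ i j k l → forms c i j k l ≡ forms c′ i j k l
  forms-cong {c} {c′} eq i j k l
    rewrite eq i j | eq k l | eq i k | eq j l | eq i l | eq j k = refl

  private
    extract : ∀ {A : Set} (m : Maybe A) → is-just m ≡ true → A
    extract (just x) _ = x

    tableKind : ∀ t cl s i j k l → check₀ t cl s ≡ true →
                All (i ≢_) (s ∷ []) → All (j ≢_) (s ∷ i ∷ []) → All (k ≢_) (s ∷ i ∷ j ∷ []) →
                All (l ≢_) (s ∷ i ∷ j ∷ k ∷ []) →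
                Kind (λ a b c → entry t a b ≡ just c) (forms (entry cl) i j k l)
    tableKind t cl s i j k l eq i# j# k# l# =
      extract (kind? (tableLine? t) (forms (entry cl) i j k l))
        (allFresh-sound (s ∷ i ∷ j ∷ k ∷ []) (check₄ t cl s i j k)
          (allFresh-sound (s ∷ i ∷ j ∷ []) (check₃ t cl s i j)
            (allFresh-sound (s ∷ i ∷ []) (check₂ t cl s i)
              (allFresh-sound (s ∷ []) (check₁ t cl s) eq i#) j#) k#) l#)

    fromTables : ∀ {f : Flat → Flat → Maybe Flat} {c : Fin 10 → Fin 10 → Maybe Flat} {t cl} →
                 (∀ a b → entry t a b ≡ f a b) → (∀ a b → entry cl a b ≡ c a b) → ∀ i j k l →
                 Kind (λ a b c → entry t a b ≡ just c) (forms (entry cl) i j k l) →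
                 Kind (λ F F′ F″ → f F F′ ≡ just F″) (forms c i j k l)
    fromTables t≡ cl≡ i j k l κ = subst (Kind _) (forms-cong cl≡ i j k l)
      (mapKind (λ {a} {b} eq → trans (sym (t≡ a b)) eq) κ)

  abstract
    -- Established by evaluating `kind?` at all 10·9·8·7·6 quintuples of distinct elements.
    kind : ∀ s i j k l → All (i ≢_) (s ∷ []) → All (j ≢_) (s ∷ i ∷ []) → All (k ≢_) (s ∷ i ∷ j ∷ []) →
           All (l ≢_) (s ∷ i ∷ j ∷ k ∷ []) → Kind Line (forms (closure s) i j k l)
    kind s i j k l i# j# k# l# = mapKind collinear
      (fromTables {third} {closure s} {table third} {table (closure s)} (entry-table third) (entry-table (closure s)) i j k l
        (tableKind (table third) (table (closure s)) s i j k l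
          (all-sound (λ s → check₀ (table third) (table (closure s)) s) kinds-checked s) i# j# k# l#))

-- Points given by hyperplane values and weights

module Parametrization where

  open import Data.Empty using (⊥-elim)
  open import Data.Fin as Fin using (Fin; zero; suc)
  import Data.Fin.Properties as Finₚ
  open import Data.Fin.Subset as Subset using (Subset; inside; outside; ⁅_⁆; _∪_; ∣_∣) renaming (_∉_ to _∉ₛ_)
  import Data.Fin.Subset.Properties as Subsetₚ
  open import Data.List as List using (List; []; _∷_; length)
  open import Data.List.Relation.Binary.Pointwise as Pointwise using (Pointwise; []; _∷_)
  open import Data.List.Relation.Unary.All as All using (All; []; _∷_)
  open import Data.List.Relation.Unary.AllPairs as AllPairs using (AllPairs; []; _∷_; allPairs?)
  open import Data.List.Relation.Unary.Any using (here; there)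
  open import Data.List.Relation.Unary.Unique.Propositional using (Unique)
  open import Data.Maybe as Maybe using (Maybe; just; nothing)
  open import Data.Nat as ℕ using (ℕ; zero; suc)
  import Data.Nat.Properties as ℕₚ
  open import Data.Product using (∃; _×_; _,_)
  open import Data.Rational as ℚ using (ℚ; 0ℚ)
  import Data.Rational.Properties as ℚₚ
  open import Data.Rational.Solver using (module +-*-Solver)
  open import Data.Sign as Sign using (Sign)
  open import Data.Sum using ([_,_]′)
  open import Data.Vec as Vec using (Vec; []; _∷_)
  open import Function using (_∘_; id)
  open import Relation.Binary.PropositionalEquality
  open import Relation.Nullary using (¬_; Dec; yes; no; recompute)
  open import Relation.Nullary.Decidable using (¬?)
  open Reals
  open RealRing
  open VectorSpaces
  open Tropical
  open MatroidFans
  open Configuration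

  open ℝ
  open +-*-Solver using (solve; _:+_; _:-_; _:=_)

  E₁₀ : Set
  E₁₀ = Fin 10

  X : Set
  X = Basis desargues

  Distinct : (s i j k l : E₁₀) → Set
  Distinct s i j k l = Unique (s ∷ i ∷ j ∷ k ∷ l ∷ [])

  distinct? : ∀ s i j k l → Dec (Distinct s i j k l)
  distinct? s i j k l = allPairs? (λ x y → ¬? (x Fin.≟ y)) (s ∷ i ∷ j ∷ k ∷ l ∷ [])

  private
    ∉-singleton : ∀ {n} {x s : Fin n} → s ≢ x → x ∉ₛ ⁅ s ⁆
    ∉-singleton s≢x x∈ = s≢x (sym (Subsetₚ.x∈⁅y⁆⇒x≡y _ x∈))

    ∉-singleton⁻ : ∀ {n} {x s : Fin n} → x ∉ₛ ⁅ s ⁆ → s ≢ x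
    ∉-singleton⁻ {x = x} x∉ refl = x∉ (Subsetₚ.x∈⁅x⁆ x)

  index : ∀ s i j k l → .(Distinct s i j k l) → PlückerIndex desargues
  index s i j k l d = record
    { S = ⁅ s ⁆ ; i = i ; j = j ; k = k ; l = l
    ; size     = cong (ℕ._+ 2) (Subsetₚ.∣⁅x⁆∣≡1 s)
    ; distinct = AllPairs.tail d
    ; disjoint = All.map ∉-singleton (AllPairs.head d) }

  private
    ∣S∣≡0⇒S≡⊥ : ∀ {n} (S : Subset n) → ∣ S ∣ ≡ 0 → S ≡ Subset.⊥
    ∣S∣≡0⇒S≡⊥ []            _  = refl
    ∣S∣≡0⇒S≡⊥ (outside ∷ S) eq = cong (outside ∷_) (∣S∣≡0⇒S≡⊥ S eq)

    singleton : ∀ {n} (S : Subset n) → ∣ S ∣ ≡ 1 → ∃ λ s → S ≡ ⁅ s ⁆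
    singleton (inside  ∷ S) eq = zero , cong (inside ∷_) (∣S∣≡0⇒S≡⊥ S (cong ℕ.pred eq))
    singleton (outside ∷ S) eq = let (s , S≡) = singleton S eq in suc s , cong (outside ∷_) S≡

  -- In rank 3 the set S is a singleton.
  index-elim : ∀ {q} (Q : PlückerIndex desargues → Set q) →
               (∀ s i j k l (d : Distinct s i j k l) → Q (index s i j k l d)) → ∀ P → Q P
  index-elim Q h record { S = S ; i = i ; j = j ; k = k ; l = l
                        ; size = size ; distinct = distinct ; disjoint = disjoint }
    with singleton S (ℕₚ.+-cancelʳ-≡ 2 ∣ S ∣ 1 (recompute (∣ S ∣ ℕ.+ 2 ℕ.≟ 3) size))
  ... | s , refl = h s i j k l (recompute (distinct? s i j k l) (All.map ∉-singleton⁻ disjoint ∷ distinct))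

  weight : ∀ {n} → Subset n → (Fin n → ℝ) → ℝ
  weight []            t = 0ᴿ
  weight (inside  ∷ σ) t = t zero +ᴿ weight σ (t ∘ suc)
  weight (outside ∷ σ) t = weight σ (t ∘ suc)

  private
    weight-⊥ : ∀ {n} (t : Fin n → ℝ) m → seq (weight Subset.⊥ t) m ≡ 0ℚ
    weight-⊥ {zero}  t m = refl
    weight-⊥ {suc n} t m = weight-⊥ (t ∘ suc) m

    weight-⁅⁆ : ∀ {n} a (t : Fin n → ℝ) m → seq (weight ⁅ a ⁆ t) m ≡ seq (t a) m
    weight-⁅⁆ zero    t m = trans (cong (seq (t zero) m ℚ.+_) (weight-⊥ (t ∘ suc) m))
                                  (ℚₚ.+-identityʳ (seq (t zero) m))
    weight-⁅⁆ (suc a) t m = weight-⁅⁆ a (t ∘ suc) m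

    weight-∪ : ∀ {n} a (σ : Subset n) → a ∉ₛ σ → ∀ t m →
               seq (weight (⁅ a ⁆ ∪ σ) t) m ≡ seq (t a) m ℚ.+ seq (weight σ t) m
    weight-∪ zero    (inside  ∷ σ) a∉σ t m = ⊥-elim (a∉σ Vec.here)
    weight-∪ zero    (outside ∷ σ) a∉σ t m =
      cong (λ ρ → seq (t zero) m ℚ.+ seq (weight ρ (t ∘ suc)) m) (Subsetₚ.∪-identityˡ σ)
    weight-∪ (suc a) (outside ∷ σ) a∉σ t m = weight-∪ a σ (a∉σ ∘ Vec.there) (t ∘ suc) m
    weight-∪ (suc a) (inside  ∷ σ) a∉σ t m =
      trans (cong (seq (t zero) m ℚ.+_) (weight-∪ a σ (a∉σ ∘ Vec.there) (t ∘ suc) m))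
        (solve 3 (λ x y z → x :+ (y :+ z) := y :+ (x :+ z)) refl
          (seq (t zero) m) (seq (t (suc a)) m) (seq (weight σ (t ∘ suc)) m))

  abstract
    weight-triple : ∀ {a b c} → a ≢ b → a ≢ c → b ≢ c → ∀ t m →
                    seq (weight (triple a b c) t) m ≡ seq (t a) m ℚ.+ (seq (t b) m ℚ.+ seq (t c) m)
    weight-triple {a} {b} {c} a≢b a≢c b≢c t m =
      trans (weight-∪ a (⁅ b ⁆ ∪ ⁅ c ⁆)
              (λ a∈ → [ (λ p → a≢b (Subsetₚ.x∈⁅y⁆⇒x≡y b p)) , (λ p → a≢c (Subsetₚ.x∈⁅y⁆⇒x≡y c p)) ]′
                        (Subsetₚ.x∈p∪q⁻ ⁅ b ⁆ ⁅ c ⁆ a∈)) t m)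
        (cong (seq (t a) m ℚ.+_) (trans (weight-∪ b ⁅ c ⁆ (b≢c ∘ Subsetₚ.x∈⁅y⁆⇒x≡y c) t m)
          (cong (seq (t b) m ℚ.+_) (weight-⁅⁆ c t m))))

  -- The points satisfying the two-term relations: a function of the flat spanned
  -- by a basis plus a sum of weights of its elements, normalized at element 0.
  extend : (Fin 9 → ℝ) → E₁₀ → ℝ
  extend t zero    = 0ᴿ
  extend t (suc e) = t e

  φ : (Fin 9 → ℝ) → (Flat → ℝ) → Point X
  φ t x β = x (flat (Basis.set β)) +ᴿ weight (Basis.set β) (extend t)

  value : (Flat → ℝ) → Form → ℝ
  value x (f , g) = x f +ᴿ x g

  Attains : (qs : List Form) → (Flat → ℝ) → Fin (length qs) → Set
  Attains qs x i = ∀ j → value x (List.lookup qs i) ≤ᴿ value x (List.lookup qs j)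

  variable-yes : ∀ {σ} (b : DesarguesBasis σ) → restrictVariable desargues σ ≡ just (basis σ b)
  variable-yes {σ} b = generic desargues b
    where
    generic : ∀ {n} (M : Matroid n) {σ} (b : Matroid.IsBasis M σ) → restrictVariable M σ ≡ just (basis σ b)
    generic M {σ} b with Matroid.isBasis? M σ
    ... | yes _ = refl
    ... | no ¬b = ⊥-elim (¬b b)

  variable-no : ∀ {σ} → ¬ DesarguesBasis σ → restrictVariable desargues σ ≡ nothing
  variable-no {σ} ¬b = generic desargues ¬b
    where
    generic : ∀ {n} (M : Matroid n) {σ} → ¬ Matroid.IsBasis M σ → restrictVariable M σ ≡ nothing
    generic M {σ} ¬b with Matroid.isBasis? M σ
    ... | yes b = ⊥-elim (¬b b)
    ... | no _  = refl

  variable-set : ∀ {σ β} → restrictVariable desargues σ ≡ just β → Basis.set β ≡ σ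
  variable-set eq = generic desargues eq
    where
    generic : ∀ {n} (M : Matroid n) {σ β} → restrictVariable M σ ≡ just β → Basis.set β ≡ σ
    generic M {σ} eq with Matroid.isBasis? M σ
    generic M refl | yes _ = refl
    generic M ()   | no _

  private
    module _ {A B : Set} (R : A → B → Set) where

      -- Restriction drops a term exactly when `forms` drops the corresponding pair of hyperplanes,
      -- so the two filtered lists stay aligned.
      data Both : Maybe A → Maybe B → Set where
        just    : ∀ {a b} → R a b → Both (just a) (just b)
        nothing : Both nothing nothing

      consᵐ : ∀ {m m′} {xs : List A} {ys : List B} → Both m m′ → Pointwise R xs ys →
              Pointwise R (Maybe.maybe′ _∷_ id m xs) (Maybe.maybe′ _∷_ id m′ ys)
      consᵐ (just r) rs = r ∷ rs
      consᵐ nothing  rs = rs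

    monomial : Maybe X → Maybe X → Maybe (Monomial X)
    monomial m m′ = Maybe.zipWith _∷_ m (Maybe.zipWith _∷_ m′ (just []))

    module _ (s i j k l : E₁₀) (d : Distinct s i j k l) where

      -- The weight of the multiset s, s, i, j, k, l. The two bases in each term use exactly these
      -- elements, so the weights add the same constant to all terms and drop out of every
      -- comparison.
      K : (E₁₀ → ℝ) → ℝ
      K t = (t s +ᴿ (t i +ᴿ t j)) +ᴿ (t s +ᴿ (t k +ᴿ t l))

      R : Sign × Monomial X → Form → Set
      R (_ , u) q = ∀ t x m → seq (evaluate u (φ t x)) m ≡
                              seq (value x q) m ℚ.+ seq (K (extend t)) m

      entry-both : ∀ sg {σ ρ} →
        (∀ t m → seq (weight σ t) m ℚ.+ seq (weight ρ t) m ≡ seq (K t) m) →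
        (m m′ : Maybe X) → (∀ {β} → m ≡ just β → Basis.set β ≡ σ) → (∀ {β} → m′ ≡ just β → Basis.set β ≡ ρ) →
        Both R (Maybe.map (sg ,_) (monomial m m′))
               (Maybe.zip (Maybe.map (λ β → flat (Basis.set β)) m) (Maybe.map (λ β → flat (Basis.set β)) m′))
      entry-both sg {σ} {ρ} eq (just β) (just γ) β≡ γ≡ = just λ t x m →
        let t̂ = extend t
            xβ = seq (x (flat (Basis.set β))) m ; wβ = seq (weight (Basis.set β) t̂) m
            xγ = seq (x (flat (Basis.set γ))) m ; wγ = seq (weight (Basis.set γ) t̂) m
        in trans (cong (xβ ℚ.+ wβ ℚ.+_) (ℚₚ.+-identityʳ (xγ ℚ.+ wγ)))
             (trans (solve 4 (λ a b c d → (a :+ b) :+ (c :+ d) := (a :+ c) :+ (b :+ d)) refl xβ wβ xγ wγ)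
               (cong (xβ ℚ.+ xγ ℚ.+_) (trans
                 (cong₂ (λ B C → seq (weight B t̂) m ℚ.+ seq (weight C t̂) m) (β≡ refl) (γ≡ refl)) (eq t̂ m))))
      entry-both sg eq (just _) nothing _ _ = nothing
      entry-both sg eq nothing  _       _ _ = nothing

      weights : ∀ {a b c e} → s ≢ a → s ≢ b → a ≢ b → s ≢ c → s ≢ e → c ≢ e → ∀ t m →
                seq (weight (triple s a b) t) m ℚ.+ seq (weight (triple s c e) t) m ≡
                (seq (t s) m ℚ.+ (seq (t a) m ℚ.+ seq (t b) m)) ℚ.+ (seq (t s) m ℚ.+ (seq (t c) m ℚ.+ seq (t e) m))
      weights s≢a s≢b a≢b s≢c s≢e c≢e t m =
        cong₂ ℚ._+_ (weight-triple s≢a s≢b a≢b t m) (weight-triple s≢c s≢e c≢e t m)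

      represented : Pointwise R (G desargues (index s i j k l d)) (forms (closure s) i j k l)
      represented = go d
        where
        v : E₁₀ → E₁₀ → Maybe X
        v a b = restrictVariable desargues (triple s a b)
        go : Distinct s i j k l → Pointwise R (G desargues (index s i j k l d)) (forms (closure s) i j k l)
        go ((s≢i ∷ s≢j ∷ s≢k ∷ s≢l ∷ []) ∷ (i≢j ∷ i≢k ∷ i≢l ∷ []) ∷ (j≢k ∷ j≢l ∷ []) ∷ (k≢l ∷ []) ∷ _) =
          consᵐ R (entry-both Sign.+ (weights s≢i s≢j i≢j s≢k s≢l k≢l)
                     (v i j) (v k l) variable-set variable-set)
          (consᵐ R (entry-both Sign.- (λ t m → trans (weights s≢i s≢k i≢k s≢j s≢l j≢l t m)
                     (solve 5 (λ s i j k l → (s :+ (i :+ k)) :+ (s :+ (j :+ l)) := (s :+ (i :+ j)) :+ (s :+ (k :+ l)))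
                        refl (seq (t s) m) (seq (t i) m) (seq (t j) m) (seq (t k) m) (seq (t l) m)))
                     (v i k) (v j l) variable-set variable-set)
          (consᵐ R (entry-both Sign.+ (λ t m → trans (weights s≢i s≢l i≢l s≢j s≢k j≢k t m)
                     (solve 5 (λ s i j k l → (s :+ (i :+ l)) :+ (s :+ (j :+ k)) := (s :+ (i :+ j)) :+ (s :+ (k :+ l)))
                        refl (seq (t s) m) (seq (t i) m) (seq (t j) m) (seq (t k) m) (seq (t l) m)))
                     (v i l) (v j k) variable-set variable-set) []))

      length-forms : length (G desargues (index s i j k l d)) ≡ length (forms (closure s) i j k l)
      length-forms = Pointwise.Pointwise-length represented

  module _ (s i j k l : E₁₀) (d : Distinct s i j k l) where

    private
      f : Polynomial X
      f = G desargues (index s i j k l d)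
      qs : List Form
      qs = forms (closure s) i j k l

    toForm : Fin (length f) → Fin (length qs)
    toForm = Fin.cast (length-forms s i j k l d)

    fromForm : Fin (length qs) → Fin (length f)
    fromForm = Fin.cast (sym (length-forms s i j k l d))

    to∘from : ∀ p → toForm (fromForm p) ≡ p
    to∘from p = Finₚ.cast-involutive (length-forms s i j k l d) (sym (length-forms s i j k l d)) p

    toForm-injective : ∀ {p q} → toForm p ≡ toForm q → p ≡ q
    toForm-injective {p} {q} eq = trans (sym (from∘to p)) (trans (cong fromForm eq) (from∘to q))
      where
      from∘to : ∀ p → fromForm (toForm p) ≡ p
      from∘to p = Finₚ.cast-involutive (sym (length-forms s i j k l d)) (length-forms s i j k l d) p

    private
      value-eq : ∀ t x p m → seq (evaluate (term f p) (φ t x)) m ≡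
                 seq (value x (List.lookup qs (toForm p))) m ℚ.+ seq (K s i j k l d (extend t)) m
      value-eq t x p m = Pointwise.lookup⁺ (represented s i j k l d) p t x m

      shift : ∀ a b c a′ b′ → a′ ≡ a ℚ.+ c → b′ ≡ b ℚ.+ c → b ℚ.- a ≡ b′ ℚ.- a′
      shift a b c _ _ refl refl = solve 3 (λ a b c → b :- a := (b :+ c) :- (a :+ c)) refl a b c

    attains⁺ : ∀ t x {p} → AttainsMinimum f (φ t x) p → Attains qs x (toForm p)
    attains⁺ t x {p} h q = subst (λ q → V (toForm p) ≤ᴿ V q) (to∘from q)
      (≤-linear₁ {V (toForm p)} {V (toForm q′)} {E p} {E q′} (h q′) λ m →
        shift (seq (V (toForm p)) m) (seq (V (toForm q′)) m) (seq (K s i j k l d (extend t)) m)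
          (seq (E p) m) (seq (E q′) m) (value-eq t x p m) (value-eq t x q′ m))
      where
      q′ : Fin (length f)
      q′ = fromForm q
      V : Fin (length qs) → ℝ
      V q = value x (List.lookup qs q)
      E : Fin (length f) → ℝ
      E q = evaluate (term f q) (φ t x)

    attains⁻ : ∀ t x {p} → Attains qs x (toForm p) → AttainsMinimum f (φ t x) p
    attains⁻ t x {p} h q = ≤-linear₁ {E p} {E q} {V (toForm p)} {V (toForm q)} (h (toForm q)) λ m →
        sym (shift (seq (V (toForm p)) m) (seq (V (toForm q)) m) (seq (K s i j k l d (extend t)) m)
          (seq (E p) m) (seq (E q) m) (value-eq t x p m) (value-eq t x q m))
      where
      V : Fin (length qs) → ℝ
      V q = value x (List.lookup qs q)
      E : Fin (length f) → ℝ
      E q = evaluate (term f q) (φ t x)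

-- Recovering weights and hyperplane values from a point of the Dressian

module Coordinates where

  open import Data.Bool using (if_then_else_)
  import Data.Bool.Properties as Boolₚ
  import Data.List.Relation.Unary.All.Properties as Allₚ
  open import Data.Empty using (⊥-elim)
  open import Data.Fin as Fin using (Fin; zero; suc; #_)
  import Data.Fin.Properties as Finₚ
  open import Data.Fin.Subset using (Subset)
  open import Data.List as List using (List; []; _∷_; _++_)
  open import Data.List.Membership.Propositional using (_∈_)
  open import Data.List.Relation.Unary.All as All using (All; []; _∷_)
  open import Data.List.Relation.Unary.AllPairs using ([]; _∷_)
  open import Data.Maybe as Maybe using (Maybe; just; nothing)
  open import Data.Nat as ℕ using (ℕ; zero; suc)
  open import Data.Nat.DivMod using (_/_; _mod_)
  open import Data.Product using (∃; _×_; _,_; proj₁; proj₂)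
  open import Data.Rational as ℚ using (ℚ; 0ℚ)
  import Data.Rational.Properties as ℚₚ
  open import Data.Rational.Solver using (module +-*-Solver)
  open import Data.Sign as Sign using (Sign)
  open import Data.Sum using (_⊎_; inj₁; inj₂)
  open import Data.Vec as Vec using (Vec; []; _∷_)
  import Data.Vec.Properties as Vecₚ
  open import Function using (_∘_; id)
  open import Relation.Binary.PropositionalEquality
  open import Relation.Nullary using (¬_; Dec; yes; no; does; recompute)
  open import Relation.Nullary.Decidable using (toWitness; _×-dec_; _⊎-dec_; _→-dec_; ¬?)
  open import Data.List.Membership.DecPropositional (Vecₚ.≡-dec {n = 10} Boolₚ._≟_) using (_∈?_)
  open Reals
  open RealRing
  open VectorSpaces
  open Tropical
  open MatroidFans
  open Configuration
  open Parametrization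

  open ℝ
  open +-*-Solver using (solve; con; _:+_; _:-_; _:=_)

  digit : ∀ place .{{_ : ℕ.NonZero place}} → ℕ → E₁₀
  digit place n = (n / place) mod 10

  -- The digits of n are the elements of a basis spanning F.
  abstract
    representative : Flat → Subset 10
    representative F = triple (digit 100 n) (digit 10 n) (digit 1 n)
      where
      n : ℕ
      n = Vec.lookup (876 ∷ 543 ∷ 750 ∷ 632 ∷ 865 ∷ 410 ∷ 983 ∷ 754 ∷ 621 ∷ 652 ∷ 832 ∷ 751 ∷ 721
                          ∷ 840 ∷ 930 ∷ []) F

  -- Bases {e,a,b} and {0,a,b} spanning the same flat determine the weight of e.
  abstract
    linked : E₁₀ → Fin 9 → Subset 10
    linked e₀ e = triple e₀ (digit 10 n) (digit 1 n)
      where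
      n : ℕ
      n = Vec.lookup (56 ∷ 57 ∷ 69 ∷ 26 ∷ 68 ∷ 23 ∷ 59 ∷ 59 ∷ 57 ∷ []) e

  at : Point X → Subset 10 → ℝ
  at w σ with desarguesBasis? σ
  ... | yes b = w (basis σ b)
  -- A dummy value for nonbases; the sets to which `at` is applied are checked to be bases in
  -- `representative-ok` and `linked-ok`.
  ... | no _  = 0ᴿ

  at-basis : ∀ w {σ} (b : DesarguesBasis σ) → at w σ ≡ w (basis σ b)
  at-basis w {σ} b with desarguesBasis? σ
  ... | yes _ = refl
  ... | no ¬b = ⊥-elim (¬b b)

  weights : Point X → Fin 9 → ℝ
  weights w e = at w (linked (suc e) e) +ᴿ (-ᴿ at w (linked zero e))

  flatValues : Point X → Flat → ℝ
  flatValues w F = at w (representative F) +ᴿ (-ᴿ weight (representative F) (extend (weights w)))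

  private
    abstract
      representative-ok : ∀ F → DesarguesBasis (representative F) × flat (representative F) ≡ F
      representative-ok = toWitness {a? = Finₚ.all? λ F →
        desarguesBasis? (representative F) ×-dec (flat (representative F) Fin.≟ F)} _

      linked-ok : ∀ e → DesarguesBasis (linked (suc e) e) × DesarguesBasis (linked zero e) ×
                  flat (linked (suc e) e) ≡ flat (linked zero e)
      linked-ok = toWitness {a? = Finₚ.all? λ e → desarguesBasis? (linked (suc e) e) ×-dec
        desarguesBasis? (linked zero e) ×-dec (flat (linked (suc e) e) Fin.≟ flat (linked zero e))} _

      linked-distinct : ∀ (e : Fin 9) → let n = Vec.lookup (56 ∷ 57 ∷ 69 ∷ 26 ∷ 68 ∷ 23 ∷ 59 ∷ 59 ∷ 57 ∷ []) e in
        (suc e ≢ digit 10 n × suc e ≢ digit 1 n) × (zero ≢ digit 10 n × zero ≢ digit 1 n) × digit 10 n ≢ digit 1 n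
      linked-distinct = toWitness {a? = Finₚ.all? λ e →
        let n = Vec.lookup (56 ∷ 57 ∷ 69 ∷ 26 ∷ 68 ∷ 23 ∷ 59 ∷ 59 ∷ 57 ∷ []) e in
        (¬? (suc e Fin.≟ digit 10 n) ×-dec ¬? (suc e Fin.≟ digit 1 n)) ×-dec
        (¬? (zero Fin.≟ digit 10 n) ×-dec ¬? (zero Fin.≟ digit 1 n)) ×-dec ¬? (digit 10 n Fin.≟ digit 1 n)} _

      linked-weight : ∀ t (e : Fin 9) m → seq (weight (linked (suc e) e) (extend t)) m ≡
                      seq (t e) m ℚ.+ seq (weight (linked zero e) (extend t)) m
      linked-weight t e m = let ((p , q) , (p′ , q′) , r) = linked-distinct e in
        trans (weight-triple p q r (extend t) m)
          (cong (seq (t e) m ℚ.+_) (sym (trans (weight-triple p′ q′ r (extend t) m)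
            (ℚₚ.+-identityˡ _))))

  data Step : Set where
    link     : Fin 9 → Step
    relation : ℕ → Step

  -- In this order each step determines the value at a new basis: a linked one, or
  -- {s,i,j} in the two-term relation with digits s, i, j, k and l.
  steps : List Step
  steps =
    List.map link
      (# 1 ∷ # 4 ∷ # 5 ∷ # 8 ∷ []) ++
    List.map relation
      (36920 ∷ 56927 ∷ 70152 ∷ 84506 ∷ []) ++
    List.map link
      (# 2 ∷ # 6 ∷ # 7 ∷ []) ++
    List.map relation
      (2639 ∷ 3896 ∷ 36820 ∷ 50296 ∷ 52809 ∷ 50498 ∷ 50698 ∷ 57809 ∷ 63520 ∷ 76985 ∷ 80245 ∷
       80725 ∷ 80925 ∷ 83504 ∷ 83790 ∷ 86970 ∷ 90785 ∷ 93785 ∷ []) ++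
    List.map link
      (# 0 ∷ # 3 ∷ []) ++
    List.map relation
      (1275 ∷ 6721 ∷ 2917 ∷ 3526 ∷ 3725 ∷ 23701 ∷ 26701 ∷ 27810 ∷ 27910 ∷ 20436 ∷ 24703 ∷ 24803 ∷
       26950 ∷ 28950 ∷ 36720 ∷ 45672 ∷ 50136 ∷ 53701 ∷ 51803 ∷ 51463 ∷ 60185 ∷ 61708 ∷ 61908 ∷
       60472 ∷ 63450 ∷ 65740 ∷ 64807 ∷ 64907 ∷ 61472 ∷ 62814 ∷ 61348 ∷ 70412 ∷ 71460 ∷ 73460 ∷
       74806 ∷ 74906 ∷ 80125 ∷ 81206 ∷ 81306 ∷ 81406 ∷ 81706 ∷ 81906 ∷ 84970 ∷ 91780 ∷ 1362 ∷
       3416 ∷ 13405 ∷ 13705 ∷ 10946 ∷ 13946 ∷ 15963 ∷ 31240 ∷ 32510 ∷ 35901 ∷ 34802 ∷ 41230 ∷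
       40916 ∷ 42503 ∷ 42916 ∷ 43916 ∷ 45916 ∷ 51203 ∷ 91204 ∷ 92305 ∷ [])

  private
    Extended : (s i j k l : E₁₀) → List (Subset 10) → Set
    Extended s i j k l known =
      Distinct s i j k l ×
      (DesarguesBasis (triple s i j) × DesarguesBasis (triple s k l) ×
       DesarguesBasis (triple s i k) × DesarguesBasis (triple s j l)) ×
      ¬ (DesarguesBasis (triple s i l) × DesarguesBasis (triple s j k)) ×
      triple s k l ∈ known × triple s i k ∈ known × triple s j l ∈ known

    extended? : ∀ s i j k l known → Dec (Extended s i j k l known)
    extended? s i j k l known = distinct? s i j k l ×-dec
      (desarguesBasis? (triple s i j) ×-dec desarguesBasis? (triple s k l) ×-dec
       desarguesBasis? (triple s i k) ×-dec desarguesBasis? (triple s j l)) ×-dec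
      ¬? (desarguesBasis? (triple s i l) ×-dec desarguesBasis? (triple s j k)) ×-dec
      (triple s k l ∈? known) ×-dec (triple s i k ∈? known) ×-dec (triple s j l ∈? known)

    Linked : Fin 9 → List (Subset 10) → Set
    Linked e known = linked (suc e) e ∈ known ⊎ linked zero e ∈ known

    linked? : ∀ e known → Dec (Linked e known)
    linked? e known = (linked (suc e) e ∈? known) ⊎-dec (linked zero e ∈? known)

    when : ∀ {A : Set} {p} {P : Set p} → Dec P → A → A → A
    when p? x y = if does p? then x else y

    -- A step whose preconditions fail leaves the list unchanged. Soundness of a run is thus
    -- independent of the numbers in `steps`, and only the final coverage of all bases has to be
    -- evaluated.
    add : (s i j k l : E₁₀) → List (Subset 10) → List (Subset 10)
    add s i j k l known = when (extended? s i j k l known) (triple s i j ∷ known) known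

    addLinked : Fin 9 → List (Subset 10) → List (Subset 10)
    addLinked e known = when (linked? e known) (linked (suc e) e ∷ linked zero e ∷ known) known

    addRelation : ℕ → List (Subset 10) → List (Subset 10)
    addRelation n = add (digit 10000 n) (digit 1000 n) (digit 100 n) (digit 10 n) (digit 1 n)

    run : List Step → List (Subset 10) → List (Subset 10)
    run []                known = known
    run (link e ∷ ss)     known = run ss (addLinked e known)
    run (relation n ∷ ss) known = run ss (addRelation n known)

  -- The third monomial contains a nonbasis and vanishes. With two terms left, a minimum attained
  -- twice is an equality.
  binomial-relation : ∀ s i j k l (d : Distinct s i j k l) {w} →
    TropicalHypersurface (G desargues (index s i j k l d)) w →
    (ij : DesarguesBasis (triple s i j)) (kl : DesarguesBasis (triple s k l))
    (ik : DesarguesBasis (triple s i k)) (jl : DesarguesBasis (triple s j l)) →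
    ¬ (DesarguesBasis (triple s i l) × DesarguesBasis (triple s j k)) →
    w (basis (triple s i j) ij) +ᴿ w (basis (triple s k l) kl) ≈ᴿ
    w (basis (triple s i k) ik) +ᴿ w (basis (triple s j l) jl)
  binomial-relation s i j k l d {w} w∈trop ij kl ik jl none =
    two (subst (λ f → TropicalHypersurface f w) G≡ w∈trop)
    where
    V : Set
    V = Maybe X
    mono : V → V → Maybe (Monomial X)
    mono m m′ = Maybe.zipWith _∷_ m (Maybe.zipWith _∷_ m′ (just []))
    build : V → V → V → V → V → V → Polynomial X
    build a b c d e f = Maybe.maybe′ _∷_ id (Maybe.map (Sign.+ ,_) (mono a b))
      (Maybe.maybe′ _∷_ id (Maybe.map (Sign.- ,_) (mono c d))
        (Maybe.maybe′ _∷_ id (Maybe.map (Sign.+ ,_) (mono e f)) []))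
    v : E₁₀ → E₁₀ → V
    v a b = restrictVariable desargues (triple s a b)
    β γ δ ε : X
    β = basis (triple s i j) ij
    γ = basis (triple s k l) kl
    δ = basis (triple s i k) ik
    ε = basis (triple s j l) jl
    missing : Maybe.map (Sign.+ ,_) (mono (v i l) (v j k)) ≡ nothing
    missing = absent (desarguesBasis? (triple s i l)) (desarguesBasis? (triple s j k))
      where
      absent : Dec (DesarguesBasis (triple s i l)) → Dec (DesarguesBasis (triple s j k)) →
               Maybe.map (Sign.+ ,_) (mono (v i l) (v j k)) ≡ nothing
      absent (no ¬b) _ = cong (λ m → Maybe.map (Sign.+ ,_) (mono m (v j k))) (variable-no ¬b)
      absent (yes b) (no ¬c) = cong₂ (λ m m′ → Maybe.map (Sign.+ ,_) (mono m m′)) (variable-yes b) (variable-no ¬c)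
      absent (yes b) (yes c) = ⊥-elim (none (b , c))
    target : Polynomial X
    target = (Sign.+ , β ∷ γ ∷ []) ∷ (Sign.- , δ ∷ ε ∷ []) ∷ []
    G≡ : G desargues (index s i j k l d) ≡ target
    G≡ = trans
      (cong₂ (λ a b → build a b (v i k) (v j l) (v i l) (v j k)) (variable-yes ij) (variable-yes kl))
      (trans (cong₂ (λ c d → build (just β) (just γ) c d (v i l) (v j k)) (variable-yes ik) (variable-yes jl))
        (cong (λ m → (Sign.+ , β ∷ γ ∷ []) ∷ (Sign.- , δ ∷ ε ∷ []) ∷ Maybe.maybe′ _∷_ id m []) missing))
    strip : ∀ {p q r u} → p +ᴿ (q +ᴿ 0ᴿ) ≤ᴿ r +ᴿ (u +ᴿ 0ᴿ) → p +ᴿ q ≤ᴿ r +ᴿ u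
    strip {p} {q} {r} {u} h = ≤-linear₁ {p +ᴿ q} {r +ᴿ u} {p +ᴿ (q +ᴿ 0ᴿ)} {r +ᴿ (u +ᴿ 0ᴿ)} h λ m →
      cong₂ (λ x y → seq r m ℚ.+ x ℚ.- (seq p m ℚ.+ y))
        (sym (ℚₚ.+-identityʳ (seq u m))) (sym (ℚₚ.+-identityʳ (seq q m)))
    equal : AttainsMinimum target w zero → AttainsMinimum target w (suc zero) → w β +ᴿ w γ ≈ᴿ w δ +ᴿ w ε
    equal p q = strip {w β} {w γ} {w δ} {w ε} (p (suc zero)) , strip {w δ} {w ε} {w β} {w γ} (q zero)
    two : TropicalHypersurface target w → w β +ᴿ w γ ≈ᴿ w δ +ᴿ w ε
    two (inj₂ (zero     , zero     , i≢j , _ , _)) = ⊥-elim (i≢j refl)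
    two (inj₂ (zero     , suc zero , _   , p , q)) = equal p q
    two (inj₂ (suc zero , zero     , _   , p , q)) = equal q p
    two (inj₂ (suc zero , suc zero , i≢j , _ , _)) = ⊥-elim (i≢j refl)

  private
    distinct-forms : ∀ s i j k l (ij : DesarguesBasis (triple s i j)) (kl : DesarguesBasis (triple s k l))
      (ik : DesarguesBasis (triple s i k)) (jl : DesarguesBasis (triple s j l)) →
      ¬ (DesarguesBasis (triple s i l) × DesarguesBasis (triple s j k)) →
      forms (closure s) i j k l ≡
      (flat (triple s i j) , flat (triple s k l)) ∷ (flat (triple s i k) , flat (triple s j l)) ∷ []
    distinct-forms s i j k l ij kl ik jl none = go (closed ij) (closed kl) (closed ik) (closed jl) missing
      where
      closed : ∀ {a b} → DesarguesBasis (triple s a b) → closure s a b ≡ just (flat (triple s a b))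
      closed b = cong (Maybe.map (λ β → flat (Basis.set β))) (variable-yes b)
      open-closure : ∀ {a b} → ¬ DesarguesBasis (triple s a b) → closure s a b ≡ nothing
      open-closure ¬b = cong (Maybe.map (λ β → flat (Basis.set β))) (variable-no ¬b)
      missing : Maybe.zip (closure s i l) (closure s j k) ≡ nothing
      missing = absent (desarguesBasis? (triple s i l)) (desarguesBasis? (triple s j k))
        where
        absent : Dec (DesarguesBasis (triple s i l)) → Dec (DesarguesBasis (triple s j k)) →
                 Maybe.zip (closure s i l) (closure s j k) ≡ nothing
        absent (no ¬b) _       = cong (λ m → Maybe.zip m (closure s j k)) (open-closure ¬b)
        absent (yes b) (no ¬c) = cong₂ Maybe.zip (closed b) (open-closure ¬c)
        absent (yes b) (yes c) = ⊥-elim (none (b , c))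
      go : ∀ {a b c d : Maybe Flat} {m : Maybe Form} {A B C D} → a ≡ just A → b ≡ just B → c ≡ just C → d ≡ just D →
           m ≡ nothing → List.catMaybes (Maybe.zip a b ∷ Maybe.zip c d ∷ m ∷ []) ≡ (A , B) ∷ (C , D) ∷ []
      go refl refl refl refl refl = refl

    sameValue : ∀ (x : Flat → ℝ) {p q} → SameForm p q → ∀ m → seq (value x p) m ≡ seq (value x q) m
    sameValue x (inj₁ (refl , refl)) m = refl
    sameValue x {f , g} (inj₂ (refl , refl)) m = ℚₚ.+-comm (seq (x f) m) (seq (x g) m)

    -- The hyperplane parts agree because a relation with two terms can only be `binomial`; the
    -- weight parts agree because both products use the same elements.
    φ-binomial : ∀ s i j k l (d : Distinct s i j k l) t x
      (ij : DesarguesBasis (triple s i j)) (kl : DesarguesBasis (triple s k l))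
      (ik : DesarguesBasis (triple s i k)) (jl : DesarguesBasis (triple s j l)) →
      ¬ (DesarguesBasis (triple s i l) × DesarguesBasis (triple s j k)) →
      φ t x (basis (triple s i j) ij) +ᴿ φ t x (basis (triple s k l) kl) ≈ᴿ
      φ t x (basis (triple s i k) ik) +ᴿ φ t x (basis (triple s j l) jl)
    φ-binomial s i j k l d@((s≢i ∷ s≢j ∷ s≢k ∷ s≢l ∷ []) ∷ (i≢j ∷ i≢k ∷ i≢l ∷ []) ∷ (j≢k ∷ j≢l ∷ []) ∷ (k≢l ∷ []) ∷ _)
      t x ij kl ik jl none =
      ≗⇒≈ {φ t x (basis (triple s i j) ij) +ᴿ φ t x (basis (triple s k l) kl)}
          {φ t x (basis (triple s i k) ik) +ᴿ φ t x (basis (triple s j l) jl)} λ m →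
        combine (xf i j m) (xf k l m) (xf i k m) (xf j l m) (wt i j m) (wt k l m) (wt i k m) (wt j l m)
          (sameValue x (same (subst (Kind Line) (distinct-forms s i j k l ij kl ik jl none)
            (kind s i j k l ((s≢i ∘ sym) ∷ []) ((s≢j ∘ sym) ∷ (i≢j ∘ sym) ∷ [])
              ((s≢k ∘ sym) ∷ (i≢k ∘ sym) ∷ (j≢k ∘ sym) ∷ [])
              ((s≢l ∘ sym) ∷ (i≢l ∘ sym) ∷ (j≢l ∘ sym) ∷ (k≢l ∘ sym) ∷ [])))) m)
          (trans (cong₂ ℚ._+_ (weight-triple s≢i s≢j i≢j t̂ m) (weight-triple s≢k s≢l k≢l t̂ m))
            (trans (solve 5 (λ s i j k l → (s :+ (i :+ j)) :+ (s :+ (k :+ l)) := (s :+ (i :+ k)) :+ (s :+ (j :+ l)))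
                     refl (seq (t̂ s) m) (seq (t̂ i) m) (seq (t̂ j) m) (seq (t̂ k) m) (seq (t̂ l) m))
              (sym (cong₂ ℚ._+_ (weight-triple s≢i s≢k i≢k t̂ m) (weight-triple s≢j s≢l j≢l t̂ m)))))
      where
      t̂ : E₁₀ → ℝ
      t̂ = extend t
      xf wt : E₁₀ → E₁₀ → ℕ → ℚ
      xf a b m = seq (x (flat (triple s a b))) m
      wt a b m = seq (weight (triple s a b) t̂) m
      same : ∀ {p q} → Kind Line (p ∷ q ∷ []) → SameForm p q
      same (binomial p≡q) = p≡q
      combine : ∀ a b c d a′ b′ c′ d′ → a ℚ.+ b ≡ c ℚ.+ d → a′ ℚ.+ b′ ≡ c′ ℚ.+ d′ →
                (a ℚ.+ a′) ℚ.+ (b ℚ.+ b′) ≡ (c ℚ.+ c′) ℚ.+ (d ℚ.+ d′)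
      combine a b c d a′ b′ c′ d′ p q =
        trans (exchange a a′ b b′) (trans (cong₂ ℚ._+_ p q) (exchange c d c′ d′))
        where
        exchange : ∀ a b c d → (a ℚ.+ b) ℚ.+ (c ℚ.+ d) ≡ (a ℚ.+ c) ℚ.+ (b ℚ.+ d)
        exchange = solve 4 (λ a b c d → (a :+ b) :+ (c :+ d) := (a :+ c) :+ (b :+ d)) refl

  -- At the representatives v agrees with w by the choice of hyperplane values, and the choice of
  -- weights transfers agreement between linked bases. A two-term relation, which v and w both
  -- satisfy, transfers it from three bases to the fourth.
  module Fitting {w : Point X} (w∈D : Dressian desargues w) where

    v : Point X
    v = φ (weights w) (flatValues w)

    Fit : Subset 10 → Set
    Fit σ = (b : DesarguesBasis σ) → w (basis σ b) ≈ᴿ v (basis σ b)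

    fit-representative : ∀ F → Fit (representative F)
    fit-representative F b = ≗⇒≈ {w β} {v β} λ m → sym
      (trans (cong (λ F → seq (flatValues w F) m ℚ.+ W m) (proj₂ (representative-ok F)))
        (trans (solve 2 (λ a b → (a :- b) :+ b := a) refl (seq (at w (representative F)) m) (W m))
          (cong (λ r → seq r m) (at-basis w b))))
      where
      β : X
      β = basis (representative F) b
      W : ℕ → ℚ
      W m = seq (weight (representative F) (extend (weights w))) m

    module _ (e : Fin 9) where
      σ σ′ : Subset 10
      σ  = linked (suc e) e
      σ′ = linked zero e
      b : DesarguesBasis σ
      b = proj₁ (linked-ok e)
      b′ : DesarguesBasis σ′
      b′ = proj₁ (proj₂ (linked-ok e))

      link-difference : ∀ m → seq (v (basis σ b)) m ℚ.- seq (w (basis σ b)) m ≡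
                              seq (v (basis σ′ b′)) m ℚ.- seq (w (basis σ′ b′)) m
      link-difference m = trans
        (cong₂ (λ F W → seq (flatValues w F) m ℚ.+ W ℚ.- wσ) (proj₂ (proj₂ (linked-ok e)))
          (trans (linked-weight (weights w) e m) (cong₂ (λ p q → (seq p m ℚ.- seq q m) ℚ.+ W′)
            (at-basis w b) (at-basis w b′))))
        (solve 4 (λ x p q r → (x :+ ((p :- q) :+ r)) :- p := (x :+ r) :- q) refl
          (seq (flatValues w (flat σ′)) m) wσ wσ′ W′)
        where
        wσ wσ′ W′ : ℚ
        wσ  = seq (w (basis σ b)) m
        wσ′ = seq (w (basis σ′ b′)) m
        W′  = seq (weight σ′ (extend (weights w))) m

      fit-link⁺ : Fit σ′ → Fit σ
      fit-link⁺ fit _ = ≈-linear₁ {w (basis σ b)} {v (basis σ b)} {w (basis σ′ b′)} {v (basis σ′ b′)}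
        (fit b′) link-difference

      fit-link⁻ : Fit σ → Fit σ′
      fit-link⁻ fit _ = ≈-linear₁ {w (basis σ′ b′)} {v (basis σ′ b′)} {w (basis σ b)} {v (basis σ b)}
        (fit b) (sym ∘ link-difference)

    fit-relation : ∀ s i j k l → Distinct s i j k l →
      DesarguesBasis (triple s i j) × DesarguesBasis (triple s k l) ×
      DesarguesBasis (triple s i k) × DesarguesBasis (triple s j l) →
      ¬ (DesarguesBasis (triple s i l) × DesarguesBasis (triple s j k)) →
      Fit (triple s k l) → Fit (triple s i k) → Fit (triple s j l) → Fit (triple s i j)
    fit-relation s i j k l d (ij , kl , ik , jl) none fitkl fitik fitjl _ = cancel
      {w (basis _ ij)} {w (basis _ kl)} {w (basis _ ik)} {w (basis _ jl)}
      {v (basis _ ij)} {v (basis _ kl)} {v (basis _ ik)} {v (basis _ jl)}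
      (binomial-relation s i j k l d {w} (w∈D (index s i j k l d)) ij kl ik jl none)
      (φ-binomial s i j k l d (weights w) (flatValues w) ij kl ik jl none)
      (fitkl kl) (fitik ik) (fitjl jl)
      where
      cancel : ∀ {a b c d a′ b′ c′ d′} → a +ᴿ b ≈ᴿ c +ᴿ d → a′ +ᴿ b′ ≈ᴿ c′ +ᴿ d′ →
               b ≈ᴿ b′ → c ≈ᴿ c′ → d ≈ᴿ d′ → a ≈ᴿ a′
      cancel {a} {b} {c} {d} {a′} {b′} {c′} {d′} p q b≈ c≈ d≈ =
        ≈-linear₁ {a} {a′} {a +ᴿ b} {a′ +ᴿ b}
          (≈-trans {a +ᴿ b} {c +ᴿ d} {a′ +ᴿ b} p
            (≈-trans {c +ᴿ d} {c′ +ᴿ d′} {a′ +ᴿ b} (+-cong {c} {c′} {d} {d′} c≈ d≈)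
              (≈-trans {c′ +ᴿ d′} {a′ +ᴿ b′} {a′ +ᴿ b} (≈-sym {a′ +ᴿ b′} {c′ +ᴿ d′} q)
                (+-cong {a′} {a′} {b′} {b} (≈-refl {a′}) (≈-sym {b} {b′} b≈)))))
          λ m → solve 3 (λ a a′ b → a′ :- a := (a′ :+ b) :- (a :+ b)) refl (seq a m) (seq a′ m) (seq b m)

    when-sound : ∀ {A : Set} {p q} {P : Set p} {Q : A → Set q} (p? : Dec P) {x y} → (P → Q x) → Q y → Q (when p? x y)
    when-sound (yes p) h _ = h p
    when-sound (no _)  _ q = q

    add-sound : ∀ s i j k l {known} → All Fit known → All Fit (add s i j k l known)
    add-sound s i j k l {known} fits = when-sound {Q = All Fit} (extended? s i j k l known)
      (λ (d , bases , none , kl∈ , ik∈ , jl∈) → fit-relation s i j k l d bases none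
        (All.lookup fits kl∈) (All.lookup fits ik∈) (All.lookup fits jl∈) ∷ fits) fits

    addLinked-sound : ∀ e {known} → All Fit known → All Fit (addLinked e known)
    addLinked-sound e {known} fits = when-sound {Q = All Fit} (linked? e known)
      (λ { (inj₁ σ∈) → let fit = All.lookup fits σ∈ in fit ∷ fit-link⁻ e fit ∷ fits
         ; (inj₂ σ∈) → let fit = All.lookup fits σ∈ in fit-link⁺ e fit ∷ fit ∷ fits }) fits

    run-sound : ∀ ss {known} → All Fit known → All Fit (run ss known)
    run-sound []                fits = fits
    run-sound (link e ∷ ss)     fits = run-sound ss (addLinked-sound e fits)
    run-sound (relation n ∷ ss) fits = run-sound ss
      (add-sound (digit 10000 n) (digit 1000 n) (digit 100 n) (digit 10 n) (digit 1 n) fits)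

  private
    covers? : ∀ known → Dec (All (λ σ → DesarguesBasis σ → σ ∈ known) (subsets 10 3))
    covers? known = All.all? (λ σ → desarguesBasis? σ →-dec (σ ∈? known)) (subsets 10 3)

    abstract
      representatives : List (Subset 10)
      representatives = List.map representative (List.allFin 15)

      representatives-fit : ∀ {w} (w∈D : Dressian desargues w) → All (Fitting.Fit w∈D) representatives
      representatives-fit w∈D = Allₚ.map⁺ {P = Fitting.Fit w∈D} {f = representative}
        (All.universal (Fitting.fit-representative w∈D) (List.allFin 15))

    Known : List (Subset 10) → Set
    Known known = (∀ {w} (w∈D : Dressian desargues w) → All (Fitting.Fit w∈D) known)

    all-known : ∀ ss {known} → Known known → Known (run ss known)
    all-known ss fits w∈D = Fitting.run-sound w∈D ss (fits w∈D)

    abstract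
      -- There are 110 bases: 15 representatives, one new basis for each of the 9 links, and one for
      -- each of the 86 two-term relations. The first two groups match the 24 parameters of φ.
      known : ∃ λ known → Known known × All (λ σ → DesarguesBasis σ → σ ∈ known) (subsets 10 3)
      known = run steps representatives , all-known steps representatives-fit ,
              toWitness {a? = covers? (run steps representatives)} _

    fit : ∀ {w} (w∈D : Dressian desargues w) σ → Fitting.Fit w∈D σ
    fit w∈D σ b = All.lookup (proj₁ (proj₂ known) w∈D)
      (All.lookup (proj₂ (proj₂ known)) (subsets-complete σ (proj₁ b)) b) b

  dressian⇒φ : ∀ {w} → Dressian desargues w → w ≈ᵥ φ (weights w) (flatValues w)
  dressian⇒φ {w} w∈D (basis σ b) = fit w∈D σ (recompute (desarguesBasis? σ) b)

  representative-basis : ∀ F → ∃ λ (β : Basis desargues) → flat (Basis.set β) ≡ F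
  representative-basis F = basis (representative F) (proj₁ (representative-ok F)) , proj₂ (representative-ok F)

  -- Linked bases span the same hyperplane and differ by exchanging one element for element 0, which
  -- has weight 0. So the difference of the two coordinates is the weight.
  linked-determines : ∀ {t x e} → φ t x ≈ᵥ 0ᵥ → t e ≈ᴿ 0ᴿ
  linked-determines {t} {x} {e} φ≈0 = ≈-linear₁ {t e} {0ᴿ} {φ t x β} {φ t x β′}
    (≈-trans {φ t x β} {0ᴿ} {φ t x β′} (φ≈0 β) (≈-sym {φ t x β′} {0ᴿ} (φ≈0 β′)))
    λ m → trans (solve 3 (λ t f w → con 0ℚ :- t := (f :+ w) :- (f :+ (t :+ w))) refl
        (seq (t e) m) (seq (x (flat (linked zero e))) m) (seq (weight (linked zero e) (extend t)) m))
      (cong₂ (λ F W → seq (φ t x β′) m ℚ.- (seq (x F) m ℚ.+ W))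
        (sym (proj₂ (proj₂ (linked-ok e)))) (sym (linked-weight t e m)))
    where
    β β′ : X
    β  = basis (linked (suc e) e) (proj₁ (linked-ok e))
    β′ = basis (linked zero e) (proj₁ (proj₂ (linked-ok e)))

-- Ultrametrics on the lines and comparisons of sums

module LineOrder where

  open import Data.Fin as Fin using (Fin; zero; suc)
  import Data.Fin.Properties as Finₚ
  open import Data.List using (List; []; _∷_)
  open import Data.List.Relation.Binary.Pointwise using (Pointwise; []; _∷_)
  open import Data.List.Relation.Unary.All using ([]; _∷_)
  open import Data.List.Relation.Unary.AllPairs using ([]; _∷_)
  open import Data.Maybe using (Maybe; just; nothing)
  import Data.Maybe.Properties as Maybeₚ
  open import Data.Nat using (ℕ; zero; suc)
  open import Data.Product using (_×_; _,_; proj₁; proj₂)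
  open import Data.Rational.Solver using (module +-*-Solver)
  open import Data.Sum using (_⊎_; inj₁; inj₂)
  open import Function using (_∘_)
  open import Relation.Binary.PropositionalEquality
  open import Relation.Nullary using (¬_; Dec; yes)
  open import Relation.Nullary.Decidable using (toWitness; _×-dec_)
  open Reals
  open RealRing
  open VectorSpaces
  open Tropical
  open MatroidFans
  open Configuration
  open Parametrization
  open Coordinates

  open ℝ
  open +-*-Solver using (solve; _:+_; _:-_; _:=_)

  private
    abstract
      lines-symmetric : ∀ a b c → third a b ≡ just c → third b a ≡ just c × third b c ≡ just a
      lines-symmetric a b c eq = decide (third a b) refl c eq (checked a b)
        where
        Symmetric : Flat → Flat → Maybe Flat → Set
        Symmetric a b nothing  = ℕ
        Symmetric a b (just c) = third b a ≡ just c × third b c ≡ just a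
        symmetric? : ∀ a b m → Dec (Symmetric a b m)
        symmetric? a b nothing  = yes 0
        symmetric? a b (just c) = Maybeₚ.≡-dec Fin._≟_ (third b a) (just c) ×-dec
                                  Maybeₚ.≡-dec Fin._≟_ (third b c) (just a)
        checked : ∀ a b → Symmetric a b (third a b)
        checked = toWitness {a? = Finₚ.all? λ a → Finₚ.all? λ b → symmetric? a b (third a b)} _
        decide : ∀ m → third a b ≡ m → ∀ c → m ≡ just c → Symmetric a b (third a b) →
                 third b a ≡ just c × third b c ≡ just a
        decide _ eq c refl s = subst (Symmetric a b) eq s

  line-swap : ∀ {a b c} → Line a b c → Line b a c
  line-swap {a} {b} {c} (collinear eq) = collinear (proj₁ (lines-symmetric a b c eq))

  line-rotate : ∀ {a b c} → Line a b c → Line b c a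
  line-rotate {a} {b} {c} (collinear eq) = collinear (proj₂ (lines-symmetric a b c eq))

  line-flip : ∀ {a b c} → Line a b c → Line a c b
  line-flip = line-rotate ∘ line-swap

  -- Since the points of a line may be permuted, this says that the minimum on each line is attained
  -- at least twice. The negative form avoids deciding where real values are smallest.
  Ultrametric : (Flat → ℝ) → Set
  Ultrametric x = ∀ {a b c} → Line a b c → ¬ (¬ (x b ≤ᴿ x a) × ¬ (x c ≤ᴿ x a))

  infix 4 _⊑_

  _⊑_ : (Flat → ℝ) → (Flat → ℝ) → Set
  x ⊑ y = ∀ {a b c} → Line a b c → x a ≤ᴿ x b → y a ≤ᴿ y b

  -- Primes mark opposite vertices; the lines are ABC, AB′C′, A′BC′ and A′B′C. Given A + A′ ≤ B +
  -- B′, two patterns are impossible: A exceeding both B and B′ (`above`), and A and A′ both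
  -- exceeding B′ (`between`). Either would force a unique minimum on one of the lines.
  module Quadrilateral
    (A A′ B B′ C C′ : ℝ)
    (min-ABC   : ¬ (¬ (B ≤ᴿ A) × ¬ (C ≤ᴿ A))) (min-BAC : ¬ (¬ (A ≤ᴿ B) × ¬ (C ≤ᴿ B)))
    (min-CAB   : ¬ (¬ (A ≤ᴿ C) × ¬ (B ≤ᴿ C)))
    (min-C′AB′ : ¬ (¬ (A ≤ᴿ C′) × ¬ (B′ ≤ᴿ C′)))
    (min-A′BC′ : ¬ (¬ (B ≤ᴿ A′) × ¬ (C′ ≤ᴿ A′)))
    (min-B′A′C : ¬ (¬ (A′ ≤ᴿ B′) × ¬ (C ≤ᴿ B′)))
    (sum : A +ᴿ A′ ≤ᴿ B +ᴿ B′) where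

    private
      infix 4 _≤_
      _≤_ : ℝ → ℝ → Set
      _≤_ = _≤ᴿ_

      compare : ∀ {p q r s} → p +ᴿ q ≤ r +ᴿ s → r ≤ p → q ≤ s
      compare {p} {q} {r} {s} h k = ≤-linear₂ {q} {s} {p +ᴿ q} {r +ᴿ s} {r} {p} h k λ n →
        solve 4 (λ p q r s → s :- q := ((r :+ s) :- (p :+ q)) :+ (p :- r)) refl
          (seq p n) (seq q n) (seq r n) (seq s n)

    above : ¬ (¬ (A ≤ B) × ¬ (A ≤ B′))
    above (A≰B , A≰B′) = min-A′BC′
      ( (λ B≤A′ → A≰B′ (swap B≤A′))
      , (λ C′≤A′ → B′≤C′ λ h → A≰B (swap′ (≤-trans {B′} {C′} {A′} h C′≤A′))) )
      where
      swap : B ≤ A′ → A ≤ B′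
      swap h = ≤-linear₂ {A} {B′} {A +ᴿ A′} {B +ᴿ B′} {B} {A′} sum h λ n →
        solve 4 (λ p q r s → s :- p := ((r :+ s) :- (p :+ q)) :+ (q :- r)) refl
          (seq A n) (seq A′ n) (seq B n) (seq B′ n)
      swap′ : B′ ≤ A′ → A ≤ B
      swap′ h = ≤-linear₂ {A} {B} {A +ᴿ A′} {B +ᴿ B′} {B′} {A′} sum h λ n →
        solve 4 (λ p q r s → r :- p := ((r :+ s) :- (p :+ q)) :+ (q :- s)) refl
          (seq A n) (seq A′ n) (seq B n) (seq B′ n)
      B′≤C′ : ¬ ¬ (B′ ≤ C′)
      B′≤C′ k = min-C′AB′ ((λ A≤C′ → A≰B′ (≤-trans {A} {C′} {B′} A≤C′ (≰⇒≥ {B′} {C′} k))) , k)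

    between : ¬ (¬ (A ≤ B′) × ¬ (A′ ≤ B′))
    between (A≰B′ , A′≰B′) = C≤B′ λ h → min-CAB
      ( (λ A≤C → A≰B′ (≤-trans {A} {C} {B′} A≤C h))
      , (λ B≤C → A′≰B′ (compare {A} {A′} {B} {B′} sum
          (≤-trans {B} {B′} {A} (≤-trans {B} {C} {B′} B≤C h) (≰⇒≥ {A} {B′} A≰B′)))) )
      where
      C≤B′ : ¬ ¬ (C ≤ B′)
      C≤B′ k = min-B′A′C (A′≰B′ , k)

  -- A comparison of sums splits into comparisons of collinear entries, under one of the two
  -- matchings of the summands. Therefore the order along lines already decides which terms of a
  -- four-point relation are minimal. `Q₁`, `Q₂` and `Q₃` are relabellings of one quadrilateral that
  -- exclude all other patterns.
  dominates : ∀ {x} → Ultrametric x → ∀ {f f′ g g′ h h′} →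
              Line f g h → Line f g′ h′ → Line f′ g h′ → Line f′ g′ h →
              x f +ᴿ x f′ ≤ᴿ x g +ᴿ x g′ →
              ¬ ¬ ((x f ≤ᴿ x g × x f′ ≤ᴿ x g′) ⊎ (x f ≤ᴿ x g′ × x f′ ≤ᴿ x g))
  dominates {x} u {f} {f′} {g} {g′} {h} {h′} fgh fg′h′ f′gh′ f′g′h sum none = f≰g f≤g
    where
    module Q₁ = Quadrilateral (x f) (x f′) (x g) (x g′) (x h) (x h′)
      (u fgh) (u (line-swap fgh)) (u (line-rotate (line-rotate fgh))) (u (line-rotate (line-rotate fg′h′)))
      (u f′gh′) (u (line-swap f′g′h)) sum
    module Q₂ = Quadrilateral (x f′) (x f) (x g′) (x g) (x h) (x h′)
      (u f′g′h) (u (line-swap f′g′h)) (u (line-rotate (line-rotate f′g′h))) (u (line-rotate (line-rotate f′gh′)))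
      (u fg′h′) (u (line-swap fgh))
      (≤-resp-≈ {x f +ᴿ x f′} {x f′ +ᴿ x f} {x g +ᴿ x g′} {x g′ +ᴿ x g}
        (ℝᶜ.+-comm (x f) (x f′)) (ℝᶜ.+-comm (x g) (x g′)) sum)
    module Q₃ = Quadrilateral (x f) (x f′) (x g′) (x g) (x h′) (x h)
      (u fg′h′) (u (line-swap fg′h′)) (u (line-rotate (line-rotate fg′h′))) (u (line-rotate (line-rotate fgh)))
      (u f′g′h) (u (line-swap f′gh′))
      (≤-resp-≈ {x f +ᴿ x f′} {x f +ᴿ x f′} {x g +ᴿ x g′} {x g′ +ᴿ x g}
        (≈-refl {x f +ᴿ x f′}) (ℝᶜ.+-comm (x g) (x g′)) sum)
    f≰g : ¬ (x f ≤ᴿ x g)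
    f≰g f≤g = Q₁.between (f≰g′ , f′≰g′)
      where
      f′≰g′ : ¬ (x f′ ≤ᴿ x g′)
      f′≰g′ f′≤g′ = none (inj₁ (f≤g , f′≤g′))
      f≰g′ : ¬ (x f ≤ᴿ x g′)
      f≰g′ f≤g′ = Q₂.above (f′≰g′ , λ f′≤g → none (inj₂ (f≤g′ , f′≤g)))
    f≤g : x f ≤ᴿ x g
    f≤g = ≤-stable {x f} {x g} λ f≰g → Q₁.above (f≰g , λ f≤g′ →
      Q₃.between (f≰g , λ f′≤g → none (inj₂ (f≤g′ , f′≤g))))

  quad-mono : ∀ {x y} → Ultrametric x → x ⊑ y → ∀ {f f′ g g′ h h′} →
              Line f g h → Line f g′ h′ → Line f′ g h′ → Line f′ g′ h →
              x f +ᴿ x f′ ≤ᴿ x g +ᴿ x g′ → y f +ᴿ y f′ ≤ᴿ y g +ᴿ y g′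
  quad-mono {x} {y} u x⊑y {f} {f′} {g} {g′} fgh fg′h′ f′gh′ f′g′h sum =
    ≤-stable {y f +ᴿ y f′} {y g +ᴿ y g′} λ k → dominates {x} u fgh fg′h′ f′gh′ f′g′h sum λ
      { (inj₁ (p , q)) → k (+-mono-≤ {y f} {y g} {y f′} {y g′} (x⊑y fgh p) (x⊑y f′g′h q))
      ; (inj₂ (p , q)) → k (≤-resp-≈ {y f +ᴿ y f′} {y f +ᴿ y f′} {y g′ +ᴿ y g} {y g +ᴿ y g′}
          (≈-refl {y f +ᴿ y f′}) (ℝᶜ.+-comm (y g′) (y g))
          (+-mono-≤ {y f} {y g′} {y f′} {y g} (x⊑y fg′h′ p) (x⊑y f′gh′ q))) }

  sameValue : ∀ (x : Flat → ℝ) {p q} → SameForm p q → value x p ≈ᴿ value x q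
  sameValue x {f , g} (inj₁ (refl , refl)) = ≈-refl {x f +ᴿ x g}
  sameValue x {f , g} (inj₂ (refl , refl)) = ℝᶜ.+-comm (x f) (x g)

  LineForms : List Form → (h a b c : Flat) → Set
  LineForms qs h a b c = Pointwise SameForm qs ((h , a) ∷ (h , b) ∷ (h , c) ∷ [])

  module _ (x : Flat → ℝ) where

    comparison⁺ : ∀ {p q h a b} → SameForm p (h , a) → SameForm q (h , b) →
                  value x p ≤ᴿ value x q → x a ≤ᴿ x b
    comparison⁺ {p} {q} {h} {a} {b} p≡ q≡ le = +-cancelˡ-≤ (x h) {x a} {x b}
      (≤-resp-≈ {value x p} {x h +ᴿ x a} {value x q} {x h +ᴿ x b} (sameValue x p≡) (sameValue x q≡) le)

    comparison⁻ : ∀ {p q h a b} → SameForm p (h , a) → SameForm q (h , b) →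
                  x a ≤ᴿ x b → value x p ≤ᴿ value x q
    comparison⁻ {p} {q} {h} {a} {b} p≡ q≡ le =
      ≤-resp-≈ {x h +ᴿ x a} {value x p} {x h +ᴿ x b} {value x q}
        (≈-sym {value x p} {x h +ᴿ x a} (sameValue x p≡)) (≈-sym {value x q} {x h +ᴿ x b} (sameValue x q≡))
        (+-mono-≤ {x h} {x h} {x a} {x b} (≤-refl {x h}) le)

  attains-mono : ∀ {x y} → Ultrametric x → x ⊑ y → ∀ {qs} → Kind Line qs → ∀ i →
                 Attains qs x i → Attains qs y i
  attains-mono {x} {y} u x⊑y (binomial {p} {q} p≡q) i _ = equal i
    where
    equal : ∀ i → Attains (p ∷ q ∷ []) y i
    equal zero       zero       = ≤-refl {value y p}
    equal zero       (suc zero) = proj₁ (sameValue y p≡q)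
    equal (suc zero) zero       = proj₂ (sameValue y p≡q)
    equal (suc zero) (suc zero) = ≤-refl {value y q}
  attains-mono {x} {y} u x⊑y (line {p} {q} {r} h {a} {b} {c} p≡ q≡ r≡ abc) = go
    where
    step : ∀ {p q a b c} → SameForm p (h , a) → SameForm q (h , b) → Line a b c →
           value x p ≤ᴿ value x q → value y p ≤ᴿ value y q
    step p≡ q≡ l le = comparison⁻ y p≡ q≡ (x⊑y l (comparison⁺ x p≡ q≡ le))
    go : ∀ i → Attains (p ∷ q ∷ r ∷ []) x i → Attains (p ∷ q ∷ r ∷ []) y i
    go zero             att zero             = ≤-refl {value y p}
    go zero             att (suc zero)       = step p≡ q≡ abc (att (suc zero))
    go zero             att (suc (suc zero)) = step p≡ r≡ (line-flip abc) (att (suc (suc zero)))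
    go (suc zero)       att zero             = step q≡ p≡ (line-swap abc) (att zero)
    go (suc zero)       att (suc zero)       = ≤-refl {value y q}
    go (suc zero)       att (suc (suc zero)) = step q≡ r≡ (line-rotate abc) (att (suc (suc zero)))
    go (suc (suc zero)) att zero             = step r≡ p≡ (line-rotate (line-rotate abc)) (att zero)
    go (suc (suc zero)) att (suc zero)       = step r≡ q≡ (line-swap (line-rotate abc)) (att (suc zero))
    go (suc (suc zero)) att (suc (suc zero)) = ≤-refl {value y r}
  -- Permuting the three pairs of opposite vertices permutes the four lines, so each comparison is
  -- `quad-mono` after relabelling.
  attains-mono {x} {y} u x⊑y (quad {f} {f′} {g} {g′} {h} {h′} l₁ l₂ l₃ l₄) = go
    where
    qs : List Form
    qs = (f , f′) ∷ (g , g′) ∷ (h , h′) ∷ []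
    go : ∀ i → Attains qs x i → Attains qs y i
    go zero             att zero             = ≤-refl {y f +ᴿ y f′}
    go zero             att (suc zero)       = quad-mono {x} {y} u x⊑y l₁ l₂ l₃ l₄ (att (suc zero))
    go zero             att (suc (suc zero)) =
      quad-mono {x} {y} u x⊑y (line-flip l₁) (line-flip l₂) (line-flip l₄) (line-flip l₃) (att (suc (suc zero)))
    go (suc zero)       att zero             =
      quad-mono {x} {y} u x⊑y (line-swap l₁) (line-swap l₃) (line-swap l₂) (line-swap l₄) (att zero)
    go (suc zero)       att (suc zero)       = ≤-refl {y g +ᴿ y g′}
    go (suc zero)       att (suc (suc zero)) =
      quad-mono {x} {y} u x⊑y (line-rotate l₁) (line-rotate l₃) (line-rotate l₄) (line-rotate l₂) (att (suc (suc zero)))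
    go (suc (suc zero)) att zero             =
      quad-mono {x} {y} u x⊑y (line-rotate (line-rotate l₁)) (line-rotate (line-rotate l₄))
        (line-rotate (line-rotate l₂)) (line-rotate (line-rotate l₃)) (att zero)
    go (suc (suc zero)) att (suc zero)       =
      quad-mono {x} {y} u x⊑y (line-swap (line-rotate l₁)) (line-swap (line-rotate l₄))
        (line-swap (line-rotate l₃)) (line-swap (line-rotate l₂)) (att (suc zero))
    go (suc (suc zero)) att (suc (suc zero)) = ≤-refl {y h +ᴿ y h′}

  kindOf : ∀ s i j k l → Distinct s i j k l → Kind Line (forms (closure s) i j k l)
  kindOf s i j k l ((s≢i ∷ s≢j ∷ s≢k ∷ s≢l ∷ []) ∷ (i≢j ∷ i≢k ∷ i≢l ∷ []) ∷ (j≢k ∷ j≢l ∷ []) ∷ (k≢l ∷ []) ∷ _) =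
    kind s i j k l ((s≢i ∘ sym) ∷ []) ((s≢j ∘ sym) ∷ (i≢j ∘ sym) ∷ [])
      ((s≢k ∘ sym) ∷ (i≢k ∘ sym) ∷ (j≢k ∘ sym) ∷ [])
      ((s≢l ∘ sym) ∷ (i≢l ∘ sym) ∷ (j≢l ∘ sym) ∷ (k≢l ∘ sym) ∷ [])

  -- The weights t and t′ are arbitrary because they cancel in every relation; only the order of x
  -- along lines determines the cone.
  φ-mono : ∀ {x y} t t′ → Ultrametric x → x ⊑ y → _≼_ desargues (φ t x) (φ t′ y)
  φ-mono {x} {y} t t′ u x⊑y =
    index-elim (λ P → ∀ i → AttainsMinimum (G desargues P) (φ t x) i → AttainsMinimum (G desargues P) (φ t′ y) i)
      λ s i j k l d p att → attains⁻ s i j k l d t′ y {p}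
        (attains-mono {x} {y} u x⊑y (kindOf s i j k l d) (toForm s i j k l d p) (attains⁺ s i j k l d t x {p} att))

-- Every line comes from a Plücker relation

module Realization where

  open import Data.Empty using (⊥-elim)
  open import Data.Fin as Fin using (Fin; zero; suc)
  import Data.Fin.Properties as Finₚ
  open import Data.Fin.Subset using (Subset; inside; outside)
  open import Data.Vec using ([]; _∷_)
  open import Data.List as List using (List; []; _∷_; length; concatMap)
  open import Data.List.Relation.Binary.Pointwise using ([]; _∷_)
  open import Data.Maybe as Maybe using (Maybe; just; nothing; is-just; _<∣>_)
  open import Data.Nat using (ℕ; zero; suc)
  open import Data.Product using (∃; _×_; _,_; proj₁; proj₂)
  open import Data.Sum using (inj₁; inj₂)
  open import Function using (_∘_)
  open import Relation.Binary.PropositionalEquality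
  open import Relation.Nullary using (¬_; Dec; yes; no)
  open import Relation.Nullary.Decidable using (toWitness; dec⇒maybe; T?)
  open import Data.Bool using (T; true)
  open Reals
  open RealRing
  open VectorSpaces
  open Tropical
  open MatroidFans
  open Configuration
  open Parametrization
  open Coordinates
  open LineOrder

  open ℝ

  -- After cancelling x h from its three terms, the relation compares exactly x a, x b and x c.
  record Realized (a b c : Flat) : Set where
    constructor realized
    field
      s i j k l : E₁₀
      distinct  : Distinct s i j k l
      h         : Flat
      lineForms : LineForms (forms (closure s) i j k l) h a b c

  private
    -- The digits are s, i, j, k and l; there is one relation for each of the 25 lines.
    codes : List ℕ
    codes =
      1234 ∷ 1235 ∷ 1345 ∷ 1349 ∷ 1359 ∷ 1459 ∷ 10236 ∷ 10237 ∷ 10247 ∷ 10267 ∷ 10367 ∷ 20356 ∷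
      20358 ∷ 20368 ∷ 20568 ∷ 30178 ∷ 30189 ∷ 30278 ∷ 40256 ∷ 40268 ∷ 40568 ∷ 50167 ∷ 50267 ∷
      60159 ∷ 70348 ∷ []

    lineForms? : ∀ qs → Maybe (∃ λ h → ∃ λ a → ∃ λ b → ∃ λ c → LineForms qs h a b c)
    lineForms? (p ∷ q ∷ r ∷ []) = common (proj₁ p) <∣> common (proj₂ p)
      where
      common : ∀ h → Maybe (∃ λ h → ∃ λ a → ∃ λ b → ∃ λ c → LineForms (p ∷ q ∷ r ∷ []) h a b c)
      common h = other h p Maybe.>>= λ (a , p≡) → other h q Maybe.>>= λ (b , q≡) →
             Maybe.map (λ (c , r≡) → h , a , b , c , p≡ ∷ q≡ ∷ r≡ ∷ []) (other h r)
    lineForms? _ = nothing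

    RealizedLine : Set
    RealizedLine = ∃ λ a → ∃ λ b → ∃ λ c → Realized a b c

    realize : (s i j k l : E₁₀) → Maybe RealizedLine
    realize s i j k l = dec⇒maybe (distinct? s i j k l) Maybe.>>= λ d →
      Maybe.map (λ (h , a , b , c , fs) → a , b , c , realized s i j k l d h fs)
        (lineForms? (forms (closure s) i j k l))

    -- Permuting j, k and l permutes the terms.
    realizeAll : ℕ → List RealizedLine
    realizeAll n = List.catMaybes
      (realize s i j k l ∷ realize s i j l k ∷ realize s i k j l ∷
       realize s i k l j ∷ realize s i l j k ∷ realize s i l k j ∷ [])
      where
      s i j k l : E₁₀
      s = digit 10000 n
      i = digit 1000 n
      j = digit 100 n
      k = digit 10 n
      l = digit 1 n

    find : ∀ a b c → List RealizedLine → Maybe (Realized a b c)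
    find a b c [] = nothing
    find a b c ((a′ , b′ , c′ , r) ∷ rs) = match (a′ Fin.≟ a) (b′ Fin.≟ b) (c′ Fin.≟ c)
      where
      match : Dec (a′ ≡ a) → Dec (b′ ≡ b) → Dec (c′ ≡ c) → Maybe (Realized a b c)
      match (yes refl) (yes refl) (yes refl) = just r
      match (yes _)    (yes _)    (no _)     = find a b c rs
      match (yes _)    (no _)     _          = find a b c rs
      match (no _)     _          _          = find a b c rs

    Found : List RealizedLine → Flat → Flat → Maybe Flat → Set
    Found rs a b nothing  = T true
    Found rs a b (just c) = T (is-just (find a b c rs))

    found? : ∀ rs a b m → Dec (Found rs a b m)
    found? rs a b nothing  = yes _
    found? rs a b (just c) = T? (is-just (find a b c rs))

    allFound? : ∀ rs → Dec (∀ a b → Found rs a b (third a b))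
    allFound? rs = Finₚ.all? λ a → Finₚ.all? λ b → found? rs a b (third a b)

    abstract
      allFound : ∃ λ rs → ∀ a b → Found rs a b (third a b)
      allFound = concatMap realizeAll codes , toWitness {a? = allFound? (concatMap realizeAll codes)} _

    extract : ∀ {A : Set} (m : Maybe A) → T (is-just m) → A
    extract (just x) _ = x

  line-realized : ∀ {a b c} → Line a b c → Realized a b c
  line-realized {a} {b} {c} (collinear eq) =
    extract (find a b c (proj₁ allFound)) (subst (Found (proj₁ allFound) a b) eq (proj₂ allFound a b))

  private
    line-attains⁺ : ∀ x {h a b c qs} → LineForms qs h a b c → ∀ {i j} → i ≢ j → Attains qs x i → Attains qs x j →
                    ¬ (¬ (x b ≤ᴿ x a) × ¬ (x c ≤ᴿ x a))
    line-attains⁺ x (p ∷ q ∷ r ∷ []) {zero} {zero} i≢j _ _ = ⊥-elim (i≢j refl)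
    line-attains⁺ x (p ∷ q ∷ r ∷ []) {suc zero} i≢j att _ (b≰a , _) = b≰a (comparison⁺ x q p (att zero))
    line-attains⁺ x (p ∷ q ∷ r ∷ []) {suc (suc zero)} i≢j att _ (_ , c≰a) = c≰a (comparison⁺ x r p (att zero))
    line-attains⁺ x (p ∷ q ∷ r ∷ []) {zero} {suc zero} i≢j _ att (b≰a , _) = b≰a (comparison⁺ x q p (att zero))
    line-attains⁺ x (p ∷ q ∷ r ∷ []) {zero} {suc (suc zero)} i≢j _ att (_ , c≰a) = c≰a (comparison⁺ x r p (att zero))

    notEmpty : ∀ {h a b c qs} → LineForms qs h a b c → Fin (length qs)
    notEmpty (_ ∷ _ ∷ _ ∷ []) = zero

  dressian⇒ultrametric : ∀ t x → Dressian desargues (φ t x) → Ultrametric x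
  dressian⇒ultrametric t x φ∈D l = go (line-realized l)
    where
    go : ∀ {a b c} → Realized a b c → ¬ (¬ (x b ≤ᴿ x a) × ¬ (x c ≤ᴿ x a))
    go (realized s i j k l d h fs) = split (φ∈D (index s i j k l d))
      where
      split : TropicalHypersurface (G desargues (index s i j k l d)) (φ t x) → _
      split (inj₁ eq) = ⊥-elim (Finₚ.¬Fin0 (subst (Fin ∘ length) eq (fromForm s i j k l d (notEmpty fs))))
      split (inj₂ (p , q , p≢q , attp , attq)) = line-attains⁺ x fs
        (λ eq → p≢q (toForm-injective s i j k l d eq))
        (attains⁺ s i j k l d t x attp) (attains⁺ s i j k l d t x attq)

  private
    -- If x c were smaller than x a, it would be the unique minimum of the line.
    first-minimal : ∀ {x} → Ultrametric x → ∀ {a b c} → Line a b c → x a ≤ᴿ x b → x a ≤ᴿ x c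
    first-minimal {x} u {a} {b} {c} l a≤b = ≤-stable {x a} {x c} λ a≰c →
      u (line-rotate (line-rotate l))
        (a≰c , λ b≤c → a≰c (≤-trans {x a} {x b} {x c} a≤b b≤c))

    line-attains : ∀ x {h a b c qs} (fs : LineForms qs h a b c) → x a ≤ᴿ x b → x a ≤ᴿ x c →
                   Attains qs x (notEmpty fs)
    line-attains x {qs = p ∷ _} (p≡ ∷ q≡ ∷ r≡ ∷ []) a≤b a≤c zero = ≤-refl {value x p}
    line-attains x (p≡ ∷ q≡ ∷ r≡ ∷ []) a≤b a≤c (suc zero) = comparison⁻ x p≡ q≡ a≤b
    line-attains x (p≡ ∷ q≡ ∷ r≡ ∷ []) a≤b a≤c (suc (suc zero)) = comparison⁻ x p≡ r≡ a≤c

    line-attains⁻ : ∀ x {h a b c qs} (fs : LineForms qs h a b c) → Attains qs x (notEmpty fs) → x a ≤ᴿ x b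
    line-attains⁻ x (p≡ ∷ q≡ ∷ r≡ ∷ []) att = comparison⁺ x p≡ q≡ (att (suc zero))

  -- If x a ≤ x b on a line, then x a is minimal there by `first-minimal`, so its term in the
  -- relation realizing the line is minimal at φ t x. By hypothesis that term is minimal at φ t′ y
  -- too, whence y a ≤ y b.
  φ-reflects : ∀ {x y} t t′ → Ultrametric x → _≼_ desargues (φ t x) (φ t′ y) → x ⊑ y
  φ-reflects {x} {y} t t′ u φ≼φ {a} {b} {c} l a≤b = go (line-realized l)
    where
    go : Realized a b c → y a ≤ᴿ y b
    go (realized s i j k m d h fs) = line-attains⁻ y fs (subst (Attains (forms (closure s) i j k m) y) (to∘from s i j k m d (notEmpty fs))
      (attains⁺ s i j k m d t′ y (φ≼φ (index s i j k m d) (fromForm s i j k m d (notEmpty fs))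
        (attains⁻ s i j k m d t x (subst (Attains (forms (closure s) i j k m) x) (sym (to∘from s i j k m d (notEmpty fs)))
          (line-attains x fs a≤b (first-minimal {x} u l a≤b)))))))

  module _ {t x} (φ≈0 : φ t x ≈ᵥ 0ᵥ) where

    private
      extend≈0 : (∀ e → t e ≈ᴿ 0ᴿ) → ∀ e → extend t e ≈ᴿ 0ᴿ
      extend≈0 t≈0 zero    = ≈-refl {0ᴿ}
      extend≈0 t≈0 (suc e) = t≈0 e

      weight≈0 : ∀ {n} (σ : Subset n) {u : Fin n → ℝ} → (∀ e → u e ≈ᴿ 0ᴿ) → weight σ u ≈ᴿ 0ᴿ
      weight≈0 [] u≈0 = ≈-refl {0ᴿ}
      weight≈0 (inside ∷ σ) {u} u≈0 =
        ≈-trans {u zero +ᴿ weight σ (u ∘ suc)} {0ᴿ +ᴿ 0ᴿ} {0ᴿ}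
          (+-cong {u zero} {0ᴿ} {weight σ (u ∘ suc)} {0ᴿ} (u≈0 zero) (weight≈0 σ (u≈0 ∘ suc))) (ℝᶜ.+-identityˡ 0ᴿ)
      weight≈0 (outside ∷ σ) u≈0 = weight≈0 σ (u≈0 ∘ suc)

    φ≈0⇒weights≈0 : ∀ e → t e ≈ᴿ 0ᴿ
    φ≈0⇒weights≈0 e = linked-determines {t} {x} {e} φ≈0

    φ≈0⇒flats≈0 : ∀ F → x F ≈ᴿ 0ᴿ
    φ≈0⇒flats≈0 F = let (β , flat≡) = representative-basis F ; W = weight (Basis.set β) (extend t) in
      ≈-trans {x F} {x F +ᴿ W} {0ᴿ}
        (≈-trans {x F} {x F +ᴿ 0ᴿ} {x F +ᴿ W} (≈-sym {x F +ᴿ 0ᴿ} {x F} (ℝᶜ.+-identityʳ (x F)))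
          (+-cong {x F} {x F} {0ᴿ} {W} (≈-refl {x F}) (≈-sym {W} {0ᴿ} (weight≈0 (Basis.set β) (extend≈0 φ≈0⇒weights≈0)))))
        (subst (λ F → x F +ᴿ W ≈ᴿ 0ᴿ) flat≡ (φ≈0 β))

-- Chains of closed sets and the list of cells

module Cells where

  open import Data.Bool using (Bool; true; false; if_then_else_; _∧_; _∨_; not; T)
  import Data.Bool.Properties as Boolₚ
  open import Data.Bool.ListAction using () renaming (all to allL)
  open import Data.Empty using (⊥-elim)
  open import Data.Fin as Fin using (Fin; zero; suc; #_; toℕ)
  open import Data.Fin.Subset as Subset using (Subset; inside; outside; Nonempty) renaming (_∈_ to _∈ₛ_; _∉_ to _∉ₛ_; _⊆_ to _⊆ₛ_)
  import Data.Fin.Subset.Properties as Subsetₚ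
  open import Data.List as List using (List; []; _∷_; _++_; length; concatMap; filter; cartesianProduct)
  open import Data.List.Membership.Propositional using (_∈_)
  import Data.List.Membership.Propositional.Properties as ∈ₚ
  open import Data.List.Relation.Unary.All as All using (All; []; _∷_)
  open import Data.List.Relation.Unary.AllPairs using (AllPairs; []; _∷_)
  import Data.List.Relation.Unary.AllPairs.Properties as AllPairsₚ
  open import Data.List.Relation.Unary.Linked using (Linked; []; [-]; _∷_)
  import Data.List.Relation.Unary.Linked.Properties as Linkedₚ
  open import Data.List.Relation.Unary.Any using (here; there)
  open import Data.Maybe as Maybe using (Maybe; just; nothing)
  open import Data.Nat as ℕ using (ℕ; zero; suc; s≤s)
  import Data.Nat.Properties as ℕₚ
  open import Data.Nat.DivMod using (_/_; _%_)
  open import Data.Product using (∃; _×_; _,_; proj₁; proj₂)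
  open import Data.Sum using (_⊎_; inj₁; inj₂)
  open import Data.Unit using (tt)
  open import Data.Vec as Vec using (Vec; []; _∷_; lookup; tabulate; _[_]≔_)
  import Data.Vec.Properties as Vecₚ
  open import Function.Bundles using (mk⇔)
  open import Relation.Binary.PropositionalEquality
  open import Relation.Nullary using (¬_; Dec; yes; no; does)
  open import Relation.Nullary.Decidable using (_×-dec_; ¬?; dec-true; does-⇔)
  open Reals
  open RealRing
  open LinearAlgebra
  open VectorSpaces
  open Tropical
  open MatroidFans
  open Configuration
  open Parametrization
  open LineOrder

  Triple : Set
  Triple = Flat × Flat × Flat

  IsLine : Triple → Set
  IsLine (a , b , c) = Line a b c

  linesOver : List (Flat × Flat) → List Triple
  linesOver []             = []
  linesOver ((a , b) ∷ ps) = Maybe.maybe′ (λ c → (a , b , c) ∷ linesOver ps) (linesOver ps) (third a b)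

  linesOver-complete : ∀ ps {a b c} → (a , b) ∈ ps → third a b ≡ just c → (a , b , c) ∈ linesOver ps
  linesOver-complete ((a , b) ∷ ps) (here refl) eq =
    subst (λ m → (a , b , _) ∈ Maybe.maybe′ (λ c → (a , b , c) ∷ linesOver ps) (linesOver ps) m) (sym eq) (here refl)
  linesOver-complete ((a , b) ∷ ps) (there p) eq = weaken (third a b) (linesOver-complete ps p eq)
    where
    weaken : ∀ {t} m → t ∈ linesOver ps →
             t ∈ Maybe.maybe′ (λ c → (a , b , c) ∷ linesOver ps) (linesOver ps) m
    weaken nothing  t∈ = t∈
    weaken (just _) t∈ = there t∈

  linesOver-sound : ∀ ps → All IsLine (linesOver ps)
  linesOver-sound []             = []
  linesOver-sound ((a , b) ∷ ps) = go (third a b) refl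
    where
    go : ∀ m → third a b ≡ m →
         All IsLine (Maybe.maybe′ (λ c → (a , b , c) ∷ linesOver ps) (linesOver ps) m)
    go nothing  _  = linesOver-sound ps
    go (just c) eq = collinear eq ∷ linesOver-sound ps

  abstract
    lines : List Triple
    lines = linesOver (cartesianProduct (List.allFin 15) (List.allFin 15))

    lines-complete : ∀ {a b c} → Line a b c → (a , b , c) ∈ lines
    lines-complete {a} {b} (collinear eq) = linesOver-complete (cartesianProduct (List.allFin 15) (List.allFin 15))
      (∈ₚ.∈-cartesianProduct⁺ (∈ₚ.∈-allFin a) (∈ₚ.∈-allFin b)) eq

    lines-sound : All IsLine lines
    lines-sound = linesOver-sound (cartesianProduct (List.allFin 15) (List.allFin 15))

  -- A cell is given by a point in its relative interior: the height of each flat.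
  Height : Set
  Height = Vec ℕ 15

  real : Height → Flat → ℝ
  real h F = natᴿ (lookup h F)

  bit : Bool → ℕ
  bit true  = 1
  bit false = 0

  -- The outcomes of all comparisons of ordered collinear pairs, packed as binary digits of one
  -- number. With `lines`, equal codes mean equal orders (`code-⊑`, `⊑-code`), so distinctness of
  -- cells becomes a statement about increasing numbers.
  code : List Triple → Height → ℕ
  code ls h = List.foldr (λ (a , b , _) n → bit (lookup h a ℕ.≤ᵇ lookup h b) ℕ.+ 2 ℕ.* n) 0 ls

  private
    bit-injective : ∀ p q m n → bit p ℕ.+ 2 ℕ.* m ≡ bit q ℕ.+ 2 ℕ.* n → p ≡ q × m ≡ n
    bit-injective false false m n eq = refl , ℕₚ.*-cancelˡ-≡ m n 2 eq
    bit-injective true  true  m n eq = refl , ℕₚ.*-cancelˡ-≡ m n 2 (ℕₚ.suc-injective eq)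
    bit-injective true  false m n eq = ⊥-elim (ℕₚ.even≢odd n m (sym eq))
    bit-injective false true  m n eq = ⊥-elim (ℕₚ.even≢odd m n eq)

    code-injective : ∀ ls h h′ → code ls h ≡ code ls h′ → ∀ {a b c} → (a , b , c) ∈ ls →
                     (lookup h a ℕ.≤ᵇ lookup h b) ≡ (lookup h′ a ℕ.≤ᵇ lookup h′ b)
    code-injective ((a , b , _) ∷ ls) h h′ eq (here refl) =
      proj₁ (bit-injective (lookup h a ℕ.≤ᵇ lookup h b) (lookup h′ a ℕ.≤ᵇ lookup h′ b) (code ls h) (code ls h′) eq)
    code-injective ((a , b , _) ∷ ls) h h′ eq (there t∈) =
      code-injective ls h h′ (proj₂ (bit-injective (lookup h a ℕ.≤ᵇ lookup h b)
        (lookup h′ a ℕ.≤ᵇ lookup h′ b) (code ls h) (code ls h′) eq)) t∈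

  ⊑-heights : ∀ h h′ → (∀ {a b c} → Line a b c → lookup h a ℕ.≤ lookup h b → lookup h′ a ℕ.≤ lookup h′ b) →
              real h ⊑ real h′
  ⊑-heights h h′ mono l le = natᴿ-mono (mono l (natᴿ-cancel le))

  code-⊑ : ∀ h h′ → code lines h ≡ code lines h′ → real h ⊑ real h′
  code-⊑ h h′ eq = ⊑-heights h h′ λ {a} {b} l le → ℕₚ.≤ᵇ⇒≤ (lookup h′ a) (lookup h′ b)
    (subst T (code-injective lines h h′ eq (lines-complete l)) (ℕₚ.≤⇒≤ᵇ le))

  ⊑-code : ∀ h h′ → real h ⊑ real h′ → real h′ ⊑ real h → code lines h ≡ code lines h′
  ⊑-code h h′ h⊑h′ h′⊑h = go lines lines-sound
    where
    mono : ∀ g g′ → real g ⊑ real g′ → ∀ {a b c} → Line a b c →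
           lookup g a ℕ.≤ lookup g b → lookup g′ a ℕ.≤ lookup g′ b
    mono g g′ g⊑g′ {a} {b} l le =
      natᴿ-cancel {lookup g′ a} {lookup g′ b} (g⊑g′ l (natᴿ-mono {lookup g a} {lookup g b} le))
    go : ∀ ls → All IsLine ls → code ls h ≡ code ls h′
    go []                 []       = refl
    go ((a , b , _) ∷ ls) (l ∷ ps) = cong₂ (λ p n → bit p ℕ.+ 2 ℕ.* n)
      (does-⇔ (mk⇔ (mono h h′ h⊑h′ l) (mono h′ h h′⊑h l))
        (lookup h a ℕ.≤? lookup h b) (lookup h′ a ℕ.≤? lookup h′ b))
      (go ls ps)

  Closed : Subset 15 → Set
  Closed S = ∀ {a b c} → Line a b c → a ∈ₛ S → b ∈ₛ S → c ∈ₛ S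

  allSubsets : ∀ n → List (Subset n)
  allSubsets zero    = [] ∷ []
  allSubsets (suc n) = List.map (inside ∷_) (allSubsets n) ++ List.map (outside ∷_) (allSubsets n)

  ∈-allSubsets : ∀ {n} (S : Subset n) → S ∈ allSubsets n
  ∈-allSubsets []            = here refl
  ∈-allSubsets (inside  ∷ S) = ∈ₚ.∈-++⁺ˡ (∈ₚ.∈-map⁺ (inside ∷_) (∈-allSubsets S))
  ∈-allSubsets (outside ∷ S) =
    ∈ₚ.∈-++⁺ʳ (List.map (inside ∷_) (allSubsets _)) (∈ₚ.∈-map⁺ (outside ∷_) (∈-allSubsets S))

  closedOn : Subset 15 → Triple → Bool
  closedOn S (a , b , c) = not (lookup S a ∧ lookup S b) ∨ lookup S c

  -- The full and the empty set are excluded because raising by them separates no flats.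
  closed : List Triple → Subset 15 → Bool
  closed ls S = allL (closedOn S) ls ∧ not (does (Subset.⊤ Subsetₚ.⊆? S)) ∧ does (Subsetₚ.nonempty? S)

  closedSets : List Triple → List (Subset 15)
  closedSets ls = filter (λ S → closed ls S Boolₚ.≟ true) (allSubsets 15)

  Below : Subset 15 → Subset 15 → Set
  Below S T = T ⊆ₛ S × ¬ (S ⊆ₛ T)

  below? : ∀ S T → Dec (Below S T)
  below? S T = (T Subsetₚ.⊆? S) ×-dec ¬? (S Subsetₚ.⊆? T)

  raise : Subset 15 → Height → Height
  raise = Vec.zipWith (λ b n → bit b ℕ.+ n)

  -- The first argument is a variable, not an expression to be evaluated for each element.
  member : ℕ → List ℕ → Bool
  member m []       = false
  member m (n ∷ ns) = (n ℕ.≡ᵇ m) ∨ member m ns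

  -- The height of a flat counts the members of the chain that contain it, and `Ss` holds the sets
  -- that may continue the chain. Initial segments are chains as well, so the code is tested at
  -- every node.
  allChains : List Triple → List ℕ → ℕ → List (Subset 15) → Height → Bool
  -- Running out of fuel is a failure; success with fuel 5 therefore also shows that no chain has
  -- more than four members.
  allChains ls codes zero    Ss h = false
  allChains ls codes (suc n) Ss h = member (code ls h) codes ∧
    allL (λ S → allChains ls codes n (filter (below? S) Ss) (raise S h)) Ss

  allL-sound : ∀ {A : Set} (p : A → Bool) xs → allL p xs ≡ true → ∀ {x} → x ∈ xs → p x ≡ true
  allL-sound p (x ∷ xs) eq (here refl) = Boolₚ.∧-conicalˡ (p x) _ eq
  allL-sound p (x ∷ xs) eq (there x∈)  = allL-sound p xs (Boolₚ.∧-conicalʳ (p x) _ eq) x∈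

  allL-complete : ∀ {A : Set} (p : A → Bool) {xs} → All (λ x → p x ≡ true) xs → allL p xs ≡ true
  allL-complete p []         = refl
  allL-complete p (px ∷ pxs) = cong₂ _∧_ px (allL-complete p pxs)

  member-sound : ∀ m ns → member m ns ≡ true → m ∈ ns
  member-sound m (n ∷ ns) eq with n ℕ.≡ᵇ m in n≡m
  ... | true  = here (sym (ℕₚ.≡ᵇ⇒≡ n m (subst T (sym n≡m) tt)))
  ... | false = there (member-sound m ns eq)

  -- A real height function takes the same order on collinear flats as the chain
  -- of closed sets on which it exceeds a given value; the chain is built from below.
  module Peel (x : Flat → ℝ) (_≤?_ : ∀ a b → Dec (x a ≤ᴿ x b)) (u : Ultrametric x) where

    private
      trans≤ : ∀ {a b c} → x a ≤ᴿ x b → x b ≤ᴿ x c → x a ≤ᴿ x c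
      trans≤ {a} {b} {c} = ≤-trans {x a} {x b} {x c}

      minimum : ∀ a as → ∃ λ m → m ∈ a ∷ as × (∀ {b} → b ∈ a ∷ as → x m ≤ᴿ x b)
      minimum a [] = a , here refl , λ { (here refl) → ≤-refl {x a} }
      minimum a (a′ ∷ as) with minimum a′ as
      ... | m , m∈ , m≤ = decide (a ≤? m)
        where
        decide : Dec (x a ≤ᴿ x m) → ∃ λ m → m ∈ a ∷ a′ ∷ as × (∀ {b} → b ∈ a ∷ a′ ∷ as → x m ≤ᴿ x b)
        decide (yes a≤m) = a , here refl , λ { (here refl) → ≤-refl {x a} ; (there b∈) → trans≤ a≤m (m≤ b∈) }
        decide (no a≰m)  = m , there m∈ , λ { (here refl) → ≰⇒≥ {x a} {x m} a≰m ; (there b∈) → m≤ b∈ }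

      least : ∀ S → Nonempty S → ∃ λ m → m ∈ₛ S × (∀ {b} → b ∈ₛ S → x m ≤ᴿ x b)
      least S (a , a∈S) = from (filter (Subsetₚ._∈? S) (List.allFin 15)) refl
        where
        flats = filter (Subsetₚ._∈? S) (List.allFin 15)
        inside⇒∈ : ∀ {b} → b ∈ₛ S → b ∈ flats
        inside⇒∈ {b} b∈S = ∈ₚ.∈-filter⁺ (Subsetₚ._∈? S) (∈ₚ.∈-allFin b) b∈S
        from : ∀ xs → xs ≡ flats → ∃ λ m → m ∈ₛ S × (∀ {b} → b ∈ₛ S → x m ≤ᴿ x b)
        from [] eq with subst (a ∈_) (sym eq) (inside⇒∈ a∈S)
        ... | ()
        from (y ∷ ys) eq with minimum y ys
        ... | m , m∈ , m≤ = m , proj₂ (∈ₚ.∈-filter⁻ (Subsetₚ._∈? S) {xs = List.allFin 15} (subst (m ∈_) eq m∈)) ,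
                            λ b∈S → m≤ (subst (_ ∈_) (sym eq) (inside⇒∈ b∈S))

      -- S is the last set of the chain built so far. Outside S the heights already order flats as x
      -- does, and all of S lies strictly above; on S the height is constant although x may still
      -- vary.
      record Invariant (h : Height) (S : Subset 15) : Set where
        field
          inhabited : Nonempty S
          lower     : ∀ {a b} → lookup h a ℕ.< lookup h b → ¬ (x b ≤ᴿ x a)
          level     : ∀ {a b} → lookup h a ≡ lookup h b → (x a ≤ᴿ x b × x b ≤ᴿ x a) ⊎ (a ∈ₛ S × b ∈ₛ S)
          top       : ∀ {a b} → a ∈ₛ S → b ∉ₛ S → lookup h b ℕ.< lookup h a
          flat-top  : ∀ {a b} → a ∈ₛ S → b ∈ₛ S → lookup h a ≡ lookup h b

      OrderEquivalent : Height → Set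
      OrderEquivalent h = ∀ a b → (x a ≤ᴿ x b → lookup h a ℕ.≤ lookup h b) × (lookup h a ℕ.≤ lookup h b → x a ≤ᴿ x b)

      module Step {h S} (inv : Invariant h S) where
        open Invariant inv
        m : Flat
        m = proj₁ (least S inhabited)
        m∈S : m ∈ₛ S
        m∈S = proj₁ (proj₂ (least S inhabited))
        m≤ : ∀ {b} → b ∈ₛ S → x m ≤ᴿ x b
        m≤ = proj₂ (proj₂ (least S inhabited))

        Upper : Flat → Set
        Upper b = b ∈ₛ S × ¬ (x b ≤ᴿ x m)

        upper? : ∀ b → Dec (Upper b)
        upper? b = (b Subsetₚ.∈? S) ×-dec ¬? (b ≤? m)

        U : Subset 15
        U = tabulate (λ b → does (upper? b))

        lookup-U : ∀ b → lookup U b ≡ does (upper? b)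
        lookup-U = Vecₚ.lookup∘tabulate (λ b → does (upper? b))

        ∈U⁺ : ∀ {b} → Upper b → b ∈ₛ U
        ∈U⁺ {b} p = Vecₚ.lookup⇒[]= b U (trans (lookup-U b) (dec-true (upper? b) p))

        ∈U⁻ : ∀ {b} → b ∈ₛ U → Upper b
        ∈U⁻ {b} b∈ = true⇒ (upper? b) (trans (sym (lookup-U b)) (Vecₚ.[]=⇒lookup b∈))
          where
          true⇒ : ∀ {P : Set} (p? : Dec P) → does p? ≡ true → P
          true⇒ (yes p) _ = p

        ∉U⇒≤ : ∀ {b} → b ∉ₛ U → b ∈ₛ S → x b ≤ᴿ x m
        ∉U⇒≤ {b} b∉U b∈S = ≤-stable {x b} {x m} λ b≰m → b∉U (∈U⁺ (b∈S , b≰m))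

        above : ∀ {a b} → a ∈ₛ U → b ∉ₛ U → ¬ (x a ≤ᴿ x b)
        above {a} {b} a∈U b∉U a≤b with b Subsetₚ.∈? S
        ... | yes b∈S = proj₂ (∈U⁻ a∈U) (trans≤ a≤b (∉U⇒≤ b∉U b∈S))
        ... | no  b∉S = lower (top (proj₁ (∈U⁻ a∈U)) b∉S) a≤b

        -- If a and b were in U but not c, then x c would be smaller than both, a unique minimum on
        -- the line.
        U-closed : Closed U
        U-closed {a} {b} {c} l a∈U b∈U with c Subsetₚ.∈? U
        ... | yes c∈U = c∈U
        ... | no  c∉U = ⊥-elim (u (line-rotate (line-rotate l)) (above a∈U c∉U , above b∈U c∉U))

        U-below : Below S U
        U-below = (λ b∈U → proj₁ (∈U⁻ b∈U)) , λ S⊆U → proj₂ (∈U⁻ (S⊆U m∈S)) (≤-refl {x m})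

        raise-∈ : ∀ {b} → b ∈ₛ U → lookup (raise U h) b ≡ suc (lookup h b)
        raise-∈ {b} b∈U = trans (Vecₚ.lookup-zipWith _ b U h)
          (cong (λ z → bit z ℕ.+ lookup h b) (Vecₚ.[]=⇒lookup b∈U))

        raise-∉ : ∀ {b} → b ∉ₛ U → lookup (raise U h) b ≡ lookup h b
        raise-∉ {b} b∉U = trans (Vecₚ.lookup-zipWith _ b U h)
          (cong (λ z → bit z ℕ.+ lookup h b) (Boolₚ.¬-not λ eq → b∉U (Vecₚ.lookup⇒[]= b U eq)))

        finished : ¬ Nonempty U → OrderEquivalent h
        finished empty a b = forwards , backwards
          where
          equal : lookup h a ≡ lookup h b → x a ≤ᴿ x b
          equal eq with level eq
          ... | inj₁ (a≤b , _)   = a≤b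
          ... | inj₂ (a∈S , b∈S) = trans≤ (∉U⇒≤ (λ a∈U → empty (a , a∈U)) a∈S) (m≤ b∈S)
          forwards : x a ≤ᴿ x b → lookup h a ℕ.≤ lookup h b
          forwards a≤b = ℕₚ.≮⇒≥ λ b<a → lower b<a a≤b
          backwards : lookup h a ℕ.≤ lookup h b → x a ≤ᴿ x b
          backwards le with ℕₚ.m≤n⇒m<n∨m≡n le
          ... | inj₁ lt = ≰⇒≥ {x b} {x a} (lower lt)
          ... | inj₂ eq = equal eq

        next : Nonempty U → Invariant (raise U h) U
        next nonempty = record
          { inhabited = nonempty
          ; lower     = lower′
          ; level     = level′
          ; top       = top′
          ; flat-top  = λ a∈U b∈U → trans (raise-∈ a∈U)
              (trans (cong suc (flat-top (proj₁ (∈U⁻ a∈U)) (proj₁ (∈U⁻ b∈U)))) (sym (raise-∈ b∈U))) }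
          where
          H : Flat → ℕ
          H = lookup (raise U h)
          top′ : ∀ {a b} → a ∈ₛ U → b ∉ₛ U → H b ℕ.< H a
          top′ {a} {b} a∈U b∉U = subst₂ ℕ._<_ (sym (raise-∉ b∉U)) (sym (raise-∈ a∈U)) (s≤s hb≤ha)
            where
            hb≤ha : lookup h b ℕ.≤ lookup h a
            hb≤ha with b Subsetₚ.∈? S
            ... | yes b∈S = ℕₚ.≤-reflexive (flat-top b∈S (proj₁ (∈U⁻ a∈U)))
            ... | no  b∉S = ℕₚ.<⇒≤ (top (proj₁ (∈U⁻ a∈U)) b∉S)
          lower′ : ∀ {a b} → H a ℕ.< H b → ¬ (x b ≤ᴿ x a)
          lower′ {a} {b} lt with a Subsetₚ.∈? U | b Subsetₚ.∈? U
          ... | yes a∈U | yes b∈U = lower (ℕₚ.≤-pred (subst₂ ℕ._<_ (raise-∈ a∈U) (raise-∈ b∈U) lt))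
          ... | no  a∉U | no  b∉U = lower (subst₂ ℕ._<_ (raise-∉ a∉U) (raise-∉ b∉U) lt)
          ... | yes a∈U | no  b∉U = ⊥-elim (ℕₚ.<-asym lt (top′ a∈U b∉U))
          ... | no  a∉U | yes b∈U = above b∈U a∉U
          level′ : ∀ {a b} → H a ≡ H b → (x a ≤ᴿ x b × x b ≤ᴿ x a) ⊎ (a ∈ₛ U × b ∈ₛ U)
          level′ {a} {b} eq with a Subsetₚ.∈? U | b Subsetₚ.∈? U
          ... | yes a∈U | yes b∈U = inj₂ (a∈U , b∈U)
          ... | yes a∈U | no  b∉U = ⊥-elim (ℕₚ.<-irrefl (sym eq) (top′ a∈U b∉U))
          ... | no  a∉U | yes b∈U = ⊥-elim (ℕₚ.<-irrefl eq (top′ b∈U a∉U))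
          ... | no  a∉U | no  b∉U with level (trans (sym (raise-∉ a∉U)) (trans eq (raise-∉ b∉U)))
          ...   | inj₁ e             = inj₁ e
          ...   | inj₂ (a∈S , b∈S) = inj₁ ( trans≤ (∉U⇒≤ a∉U a∈S) (m≤ b∈S) , trans≤ (∉U⇒≤ b∉U b∈S) (m≤ a∈S) )

      -- The chain belonging to x is one of those visited by `allChains`: as long as U is nonempty,
      -- it is a closed set below S and so occurs in `Ss`. When U is empty, x is constant on S and h
      -- has the order of x.
      chains-sound : ∀ {codes} n Ss h S → allChains lines codes n Ss h ≡ true → Invariant h S →
                     (∀ {T} → Closed T → Nonempty T → Below S T → T ∈ Ss) →
                     ∃ λ h′ → code lines h′ ∈ codes × OrderEquivalent h′
      chains-sound {codes} (suc n) Ss h S eq inv complete = decide (Subsetₚ.nonempty? U)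
        where
        open Step inv
        decide : Dec (Nonempty U) → ∃ λ h′ → code lines h′ ∈ codes × OrderEquivalent h′
        decide (no empty)     = h , member-sound (code lines h) codes
          (Boolₚ.∧-conicalˡ (member (code lines h) codes) _ eq) , finished empty
        decide (yes nonempty) = chains-sound n (filter (below? U) Ss) (raise U h) U
          (allL-sound (λ T → allChains lines codes n (filter (below? T) Ss) (raise T h)) Ss
            (Boolₚ.∧-conicalʳ (member (code lines h) codes) _ eq) (complete U-closed nonempty U-below))
          (next nonempty)
          λ T-closed T-nonempty (T⊆U , U⊈T) → ∈ₚ.∈-filter⁺ (below? U)
            (complete T-closed T-nonempty ((λ t → proj₁ U-below (T⊆U t)) , λ S⊆T → U⊈T λ t → S⊆T (proj₁ U-below t)))
            (T⊆U , U⊈T)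

      ground : Height
      ground = Vec.replicate 15 0

      start : Invariant ground Subset.⊤
      start = record
        { inhabited = zero , Subsetₚ.∈⊤
        ; lower     = λ {a} {b} lt → ⊥-elim (ℕₚ.n≮0 (subst (lookup ground a ℕ.<_) (Vecₚ.lookup-replicate b 0) lt))
        ; level     = λ _ → inj₂ (Subsetₚ.∈⊤ , Subsetₚ.∈⊤)
        ; top       = λ _ b∉⊤ → ⊥-elim (b∉⊤ Subsetₚ.∈⊤)
        ; flat-top  = λ {a} {b} _ _ → trans (Vecₚ.lookup-replicate a 0) (sym (Vecₚ.lookup-replicate b 0)) }

      ∈-closedSets : ∀ {T} → Closed T → Nonempty T → Below Subset.⊤ T → T ∈ closedSets lines
      ∈-closedSets {T} T-closed T-nonempty (_ , ⊤⊈T) = ∈ₚ.∈-filter⁺ (λ S → closed lines S Boolₚ.≟ true) (∈-allSubsets T)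
        (cong₂ _∧_ (allL-complete (closedOn T) (All.map (λ {t} → onLine {t}) lines-sound))
          (cong₂ _∧_ (cong not (dec-no (Subset.⊤ Subsetₚ.⊆? T) ⊤⊈T)) (dec-true (Subsetₚ.nonempty? T) T-nonempty)))
        where
        dec-no : ∀ {P : Set} (p? : Dec P) → ¬ P → does p? ≡ false
        dec-no (yes p) ¬p = ⊥-elim (¬p p)
        dec-no (no _)  _  = refl
        onLine : ∀ {t} → IsLine t → closedOn T t ≡ true
        onLine {a , b , c} l = go (lookup T a) (lookup T b) refl refl
          where
          go : ∀ p q → lookup T a ≡ p → lookup T b ≡ q → not (p ∧ q) ∨ lookup T c ≡ true
          go false q     _ _ = refl
          go true  false _ _ = refl
          go true  true  p q = Vecₚ.[]=⇒lookup (T-closed l (Vecₚ.lookup⇒[]= a T p) (Vecₚ.lookup⇒[]= b T q))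

    peel : ∀ {codes} → allChains lines codes 5 (closedSets lines) ground ≡ true →
           ∃ λ h → code lines h ∈ codes × real h ⊑ x × x ⊑ real h
    peel eq =
      let (h , h∈ , equiv) = chains-sound 5 (closedSets lines) ground Subset.⊤ eq start ∈-closedSets
      in h , h∈ , (λ {a} {b} _ le → proj₂ (equiv a b) (natᴿ-cancel le)) , (λ {a} {b} _ le → natᴿ-mono (proj₁ (equiv a b) le))

  -- The last of the 15 decimal digits is the height of the first flat.
  decimals : List ℕ → List Height
  decimals = List.map (digits 15)
    where
    digits : ∀ k → ℕ → Vec ℕ k
    digits zero    n = []
    digits (suc k) n = n % 10 ∷ digits k (n / 10)

  increasing : List ℕ → Bool
  increasing (m ∷ n ∷ ns) = (m ℕ.<ᵇ n) ∧ increasing (n ∷ ns)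
  increasing _            = true

  increasing-sound : ∀ ns → increasing ns ≡ true → Linked ℕ._<_ ns
  increasing-sound []           _  = []
  increasing-sound (m ∷ [])     _  = [-]
  increasing-sound (m ∷ n ∷ ns) eq =
    ℕₚ.<ᵇ⇒< m n (subst T (sym (Boolₚ.∧-conicalˡ (m ℕ.<ᵇ n) _ eq)) tt) ∷
    increasing-sound (n ∷ ns) (Boolₚ.∧-conicalʳ (m ℕ.<ᵇ n) _ eq)

  -- The cells whose cone has dimension m modulo lineality, with increasing codes.
  abstract
    cells : Fin 5 → List Height
    cells zero = decimals
      (0 ∷ [])
    cells (suc zero) = decimals
      (100000000000000 ∷ 100000000011000 ∷ 100110110100100 ∷ 100100010100100 ∷ 100010100100100 ∷
       100000000100100 ∷ 111000000111100 ∷ 111000111000010 ∷ 110000011000010 ∷ 101000101000010 ∷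
       100000001000010 ∷ 100110001011010 ∷ 111111000000001 ∷ 110011000000001 ∷ 101101000000001 ∷
       100001000000001 ∷ 100001110011001 ∷ 100001001100111 ∷ 10000000000000 ∷ 10000000010100 ∷
       10101101101000 ∷ 10100001101000 ∷ 10001100101000 ∷ 10000000101000 ∷ 11000110000010 ∷
       10000010000010 ∷ 10101010010110 ∷ 11110000000001 ∷ 10010000000001 ∷ 10010101010101 ∷
       10010010101011 ∷ 1000000000000 ∷ 1000000001100 ∷ 1011011110000 ∷ 1010001110000 ∷
       1001010110000 ∷ 1000000110000 ∷ 1000100000010 ∷ 1011100001110 ∷ 1100000000001 ∷
       1100011001101 ∷ 1100100110011 ∷ 100000000000 ∷ 100000010010 ∷ 101101001000 ∷ 100001001000 ∷
       110110000100 ∷ 100010000100 ∷ 10000000000 ∷ 10000001010 ∷ 11011010000 ∷ 10001010000 ∷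
       10100000100 ∷ 1000000000 ∷ 1000000110 ∷ 1010010000 ∷ 1100001000 ∷ 100000000 ∷ 100010001 ∷
       10000000 ∷ 10001001 ∷ 1000000 ∷ 1000101 ∷ 100000 ∷ 100011 ∷ 10000 ∷ 1000 ∷ 100 ∷ 10 ∷ 1 ∷ [])
    cells (suc (suc zero)) = decimals
      (120000000000000 ∷ 211000000111100 ∷ 211000111000010 ∷ 210000011000010 ∷ 211111000000001 ∷
       210011000000001 ∷ 102000000000000 ∷ 201000101000010 ∷ 201101000000001 ∷ 100200000000000 ∷
       200110001011010 ∷ 200110110100100 ∷ 200100010100100 ∷ 100020000000000 ∷ 200010100100100 ∷
       200001000000001 ∷ 200001001100111 ∷ 200001110011001 ∷ 100000200000000 ∷ 100000020000000 ∷
       200000001000010 ∷ 200000000100100 ∷ 200000000011000 ∷ 211000000122100 ∷ 200110001022010 ∷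
       200001110022001 ∷ 100000000021000 ∷ 100000000012000 ∷ 211000000211200 ∷ 100210110100100 ∷
       100200010100100 ∷ 100120110100100 ∷ 100110210100100 ∷ 100110120100100 ∷ 100110110200100 ∷
       100220220100200 ∷ 200120210200200 ∷ 200210120200200 ∷ 100100020100100 ∷ 100100010200100 ∷
       100200020100200 ∷ 200100010200200 ∷ 100020100100100 ∷ 100010200100100 ∷ 100010100200100 ∷
       100020200100200 ∷ 200010100200200 ∷ 200001001200211 ∷ 100000000200100 ∷ 100000000100200 ∷
       121000000111100 ∷ 121000000121200 ∷ 121000000212100 ∷ 112000000111100 ∷ 112000000112200 ∷
       112000000221100 ∷ 111000000211100 ∷ 111000000121100 ∷ 111000000112100 ∷ 111000000111200 ∷
       121000111000010 ∷ 120000011000010 ∷ 112000111000010 ∷ 111000211000010 ∷ 111000121000010 ∷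
       111000112000010 ∷ 122000221000020 ∷ 212000212000020 ∷ 221000122000020 ∷ 110000021000010 ∷
       110000012000010 ∷ 120000021000020 ∷ 210000012000020 ∷ 102000101000010 ∷ 101000201000010 ∷
       101000102000010 ∷ 102000201000020 ∷ 201000102000020 ∷ 200110002011020 ∷ 200001002100121 ∷
       100000002000010 ∷ 100000001000020 ∷ 100210001011010 ∷ 100210001021020 ∷ 100210002012010 ∷
       100120001011010 ∷ 100120001012020 ∷ 100120002021010 ∷ 100110002011010 ∷ 100110001021010 ∷
       100110001012010 ∷ 100110001011020 ∷ 121111000000001 ∷ 120011000000001 ∷ 112111000000001 ∷
       111211000000001 ∷ 111121000000001 ∷ 111112000000001 ∷ 122221000000002 ∷ 212212000000002 ∷
       221122000000002 ∷ 110021000000001 ∷ 110012000000001 ∷ 120021000000002 ∷ 210012000000002 ∷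
       102101000000001 ∷ 101201000000001 ∷ 101102000000001 ∷ 102201000000002 ∷ 201102000000002 ∷
       100002000000001 ∷ 200002110011002 ∷ 200002001100112 ∷ 100001000000002 ∷ 100002110011001 ∷
       100002120021001 ∷ 100002210012001 ∷ 100001210011001 ∷ 100001210021002 ∷ 100001120011001 ∷
       100001120012002 ∷ 100001110021001 ∷ 100001110012001 ∷ 100001110011002 ∷ 100002001100111 ∷
       100002001100221 ∷ 100001002100111 ∷ 100001002100212 ∷ 100001001200111 ∷ 100001001200122 ∷
       100001001100211 ∷ 100001001100121 ∷ 100001001100112 ∷ 12000000000000 ∷ 21000110000010 ∷
       21110000000001 ∷ 10200000000000 ∷ 20101101101000 ∷ 20100001101000 ∷ 20101010010110 ∷
       20010000000001 ∷ 20010010101011 ∷ 20010101010101 ∷ 10002000000000 ∷ 20001100101000 ∷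
       10000200000000 ∷ 20000010000010 ∷ 10000002000000 ∷ 20000000101000 ∷ 20000000010100 ∷
       20101010020210 ∷ 20010101020201 ∷ 10000000020100 ∷ 10000000010200 ∷ 10201101101000 ∷
       10200001101000 ∷ 10102101101000 ∷ 10101201101000 ∷ 10101102101000 ∷ 10101101201000 ∷
       10202202102000 ∷ 20102201202000 ∷ 20201102202000 ∷ 10100002101000 ∷ 10100001201000 ∷
       10200002102000 ∷ 20100001202000 ∷ 20010010202011 ∷ 10002100101000 ∷ 10001200101000 ∷
       10001100201000 ∷ 10002200102000 ∷ 20001100202000 ∷ 10000000201000 ∷ 10000000102000 ∷
       12000110000010 ∷ 11000210000010 ∷ 11000120000010 ∷ 12000210000020 ∷ 21000120000020 ∷
       20101020010120 ∷ 20010020101021 ∷ 10000020000010 ∷ 10000010000020 ∷ 10201010010110 ∷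
       10201010020120 ∷ 10201020010210 ∷ 10102010010110 ∷ 10102010010220 ∷ 10102020020110 ∷
       10101020010110 ∷ 10101010020110 ∷ 10101010010210 ∷ 10101010010120 ∷ 12110000000001 ∷
       11210000000001 ∷ 11120000000001 ∷ 12210000000002 ∷ 21120000000002 ∷ 10020000000001 ∷
       20020101010102 ∷ 20020010101012 ∷ 10010000000002 ∷ 10020101010101 ∷ 10020102020101 ∷
       10020201010201 ∷ 10010201010101 ∷ 10010201020102 ∷ 10010102010101 ∷ 10010102010202 ∷
       10010101020101 ∷ 10010101010201 ∷ 10010101010102 ∷ 10020010101011 ∷ 10020010102021 ∷
       10010020101011 ∷ 10010020102012 ∷ 10010010201011 ∷ 10010010201022 ∷ 10010010102011 ∷
       10010010101021 ∷ 10010010101012 ∷ 2100000000001 ∷ 2100100110011 ∷ 2100011001101 ∷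
       1020000000000 ∷ 2011011110000 ∷ 2010001110000 ∷ 2011100001110 ∷ 1002000000000 ∷
       2001010110000 ∷ 2000100000010 ∷ 1000020000000 ∷ 1000002000000 ∷ 2000000110000 ∷
       2000000001100 ∷ 2100011002201 ∷ 2011100002210 ∷ 1000000002100 ∷ 1000000001200 ∷
       2100100220011 ∷ 1021011110000 ∷ 1020001110000 ∷ 1012011110000 ∷ 1011021110000 ∷
       1011012110000 ∷ 1011011210000 ∷ 1022022120000 ∷ 2012021220000 ∷ 2021012220000 ∷
       1010002110000 ∷ 1010001210000 ∷ 1020002120000 ∷ 2010001220000 ∷ 1002010110000 ∷
       1001020110000 ∷ 1001010210000 ∷ 1002020120000 ∷ 2001010220000 ∷ 1000000210000 ∷
       1000000120000 ∷ 2100200110021 ∷ 2011200001120 ∷ 1000200000010 ∷ 1000100000020 ∷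
       1021100001110 ∷ 1021100002120 ∷ 1021200001210 ∷ 1012100001110 ∷ 1012100001220 ∷
       1012200002110 ∷ 1011200001110 ∷ 1011100002110 ∷ 1011100001210 ∷ 1011100001120 ∷
       1200000000001 ∷ 2200100110012 ∷ 2200011001102 ∷ 1100000000002 ∷ 1200011001101 ∷
       1200012002101 ∷ 1200021001201 ∷ 1100021001101 ∷ 1100021002102 ∷ 1100012001101 ∷
       1100012001202 ∷ 1100011002101 ∷ 1100011001201 ∷ 1100011001102 ∷ 1200100110011 ∷
       1200100120021 ∷ 1100200110011 ∷ 1100200120012 ∷ 1100100210011 ∷ 1100100210022 ∷
       1100100120011 ∷ 1100100110021 ∷ 1100100110012 ∷ 120000000000 ∷ 210110000100 ∷ 102000000000 ∷
       201101001000 ∷ 100200000000 ∷ 200010000100 ∷ 200001001000 ∷ 100000200000 ∷ 200000010010 ∷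
       100000020010 ∷ 100000010020 ∷ 102101001000 ∷ 101201001000 ∷ 101102001000 ∷ 102201002000 ∷
       201102002000 ∷ 100002001000 ∷ 100001002000 ∷ 120110000100 ∷ 110210000100 ∷ 110120000100 ∷
       120210000200 ∷ 210120000200 ∷ 100020000100 ∷ 100010000200 ∷ 12000000000 ∷ 21011010000 ∷
       20100000100 ∷ 10020000000 ∷ 20001010000 ∷ 10000200000 ∷ 20000001010 ∷ 10000002010 ∷
       10000001020 ∷ 12011010000 ∷ 11021010000 ∷ 11012010000 ∷ 12021020000 ∷ 21012020000 ∷
       10002010000 ∷ 10001020000 ∷ 10200000100 ∷ 10100000200 ∷ 2100001000 ∷ 2010010000 ∷
       1002000000 ∷ 1000200000 ∷ 2000000110 ∷ 1000000210 ∷ 1000000120 ∷ 1020010000 ∷ 1010020000 ∷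
       1200001000 ∷ 1100002000 ∷ 120000000 ∷ 102000000 ∷ 100200000 ∷ 200010001 ∷ 100020001 ∷
       100010002 ∷ 12000000 ∷ 10200000 ∷ 20001001 ∷ 10002001 ∷ 10001002 ∷ 1200000 ∷ 2000101 ∷
       1000201 ∷ 1000102 ∷ 200011 ∷ 100021 ∷ 100012 ∷ [])
    cells (suc (suc (suc zero))) = decimals
      (123000000000000 ∷ 231000000111100 ∷ 231000111000010 ∷ 231111000000001 ∷ 120300000000000 ∷
       230011000000001 ∷ 120000300000000 ∷ 230000011000010 ∷ 213000000111100 ∷ 311000000211200 ∷
       311000000122100 ∷ 213000111000010 ∷ 211000311000010 ∷ 211000131000010 ∷ 312000212000020 ∷
       321000122000020 ∷ 210000031000010 ∷ 310000012000020 ∷ 213111000000001 ∷ 211311000000001 ∷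
       211131000000001 ∷ 312212000000002 ∷ 321122000000002 ∷ 210031000000001 ∷ 310012000000002 ∷
       203101000000001 ∷ 102030000000000 ∷ 203000101000010 ∷ 102000030000000 ∷ 201000301000010 ∷
       301000102000020 ∷ 201301000000001 ∷ 301102000000002 ∷ 100230000000000 ∷ 200310001011010 ∷
       200310110100100 ∷ 100200300000000 ∷ 200300010100100 ∷ 200130001011010 ∷ 300110002011020 ∷
       300110001022010 ∷ 200130110100100 ∷ 200110310100100 ∷ 200110130100100 ∷ 300120210200200 ∷
       300210120200200 ∷ 200100030100100 ∷ 300100010200200 ∷ 200030100100100 ∷ 100020030000000 ∷
       200010300100100 ∷ 300010100200200 ∷ 300002110011002 ∷ 300002001100112 ∷ 300001002100121 ∷
       300001001200211 ∷ 200001310011001 ∷ 200001130011001 ∷ 300001110022001 ∷ 100000230000000 ∷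
       211000000132100 ∷ 211000000123100 ∷ 200110001032010 ∷ 200110001023010 ∷ 200001110032001 ∷
       200001110023001 ∷ 211000000311200 ∷ 211000000211300 ∷ 100230110100100 ∷ 100210310100100 ∷
       100210110300100 ∷ 100320220100200 ∷ 200310120200200 ∷ 100200010300100 ∷ 100300020100200 ∷
       100120130100100 ∷ 100120110300100 ∷ 100230220100200 ∷ 200130210200200 ∷ 100110230100100 ∷
       100110210300100 ∷ 100220320100200 ∷ 200120310200200 ∷ 100110120300100 ∷ 100220230100200 ∷
       200210130200200 ∷ 200120210300200 ∷ 200210120300200 ∷ 100230320100300 ∷ 100320230100300 ∷
       300120210300300 ∷ 100100020300100 ∷ 100200030100200 ∷ 200100010300200 ∷ 100200020100300 ∷
       100020100300100 ∷ 100030200100200 ∷ 100010200300100 ∷ 100020300100200 ∷ 200010100300200 ∷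
       100020200100300 ∷ 200001001300211 ∷ 200001001200311 ∷ 123000000111100 ∷ 131000000212100 ∷
       131000000121200 ∷ 121000000131200 ∷ 121000000121300 ∷ 121000000312100 ∷ 121000000213100 ∷
       113000000221100 ∷ 113000000112200 ∷ 112000000113200 ∷ 112000000112300 ∷ 112000000321100 ∷
       112000000231100 ∷ 123000111000010 ∷ 121000311000010 ∷ 121000113000010 ∷ 132000221000020 ∷
       231000122000020 ∷ 120000013000010 ∷ 130000021000020 ∷ 112000131000010 ∷ 112000113000010 ∷
       123000221000020 ∷ 213000212000020 ∷ 111000231000010 ∷ 111000213000010 ∷ 122000321000020 ∷
       212000312000020 ∷ 111000123000010 ∷ 122000231000020 ∷ 221000132000020 ∷ 212000213000020 ∷
       221000123000020 ∷ 123000321000030 ∷ 132000231000030 ∷ 312000213000030 ∷ 110000023000010 ∷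
       120000031000020 ∷ 210000013000020 ∷ 120000021000030 ∷ 102000103000010 ∷ 103000201000020 ∷
       101000203000010 ∷ 102000301000020 ∷ 201000103000020 ∷ 102000201000030 ∷ 200110003011020 ∷
       200110002011030 ∷ 200001003100121 ∷ 200001002100131 ∷ 100230001011010 ∷ 100310002012010 ∷
       100310001021020 ∷ 100210001031020 ∷ 100210001021030 ∷ 100210003012010 ∷ 100210002013010 ∷
       100130002021010 ∷ 100130001012020 ∷ 100120001013020 ∷ 100120001012030 ∷ 100120003021010 ∷
       100120002031010 ∷ 123111000000001 ∷ 121311000000001 ∷ 121113000000001 ∷ 132221000000002 ∷
       231122000000002 ∷ 120013000000001 ∷ 130021000000002 ∷ 112131000000001 ∷ 112113000000001 ∷
       123221000000002 ∷ 213212000000002 ∷ 111231000000001 ∷ 111213000000001 ∷ 122321000000002 ∷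
       212312000000002 ∷ 111123000000001 ∷ 122231000000002 ∷ 221132000000002 ∷ 212213000000002 ∷
       221123000000002 ∷ 123321000000003 ∷ 132231000000003 ∷ 312213000000003 ∷ 110023000000001 ∷
       120031000000002 ∷ 210013000000002 ∷ 120021000000003 ∷ 102103000000001 ∷ 103201000000002 ∷
       101203000000001 ∷ 102301000000002 ∷ 201103000000002 ∷ 102201000000003 ∷ 200003110011002 ∷
       200003001100112 ∷ 200002110011003 ∷ 200002001100113 ∷ 100003210012001 ∷ 100003120021001 ∷
       100002130021001 ∷ 100002120031001 ∷ 100002310012001 ∷ 100002210013001 ∷ 100001230011001 ∷
       100001310021002 ∷ 100001210031002 ∷ 100001210021003 ∷ 100001130012002 ∷ 100001120013002 ∷
       100001120012003 ∷ 100002003100111 ∷ 100002001300111 ∷ 100003001100221 ∷ 100002001100321 ∷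
       100002001100231 ∷ 100001002300111 ∷ 100001003100212 ∷ 100001002100312 ∷ 100001002100213 ∷
       100001001300122 ∷ 100001001200132 ∷ 100001001200123 ∷ 23110000000001 ∷ 12003000000000 ∷
       23000110000010 ∷ 12000003000000 ∷ 21000310000010 ∷ 31000120000020 ∷ 21310000000001 ∷
       31120000000002 ∷ 10203000000000 ∷ 20301010010110 ∷ 20301101101000 ∷ 10200300000000 ∷
       20300001101000 ∷ 20103101101000 ∷ 20101301101000 ∷ 20101103101000 ∷ 30102201202000 ∷
       30201102202000 ∷ 20100003101000 ∷ 30100001202000 ∷ 20103010010110 ∷ 30101020010120 ∷
       30101010020210 ∷ 30020101010102 ∷ 30020010101012 ∷ 30010020101021 ∷ 30010010202011 ∷
       20010301010101 ∷ 20010103010101 ∷ 30010101020201 ∷ 20003100101000 ∷ 10002003000000 ∷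
       20001300101000 ∷ 30001100202000 ∷ 10000203000000 ∷ 20101010030210 ∷ 20101010020310 ∷
       20010101030201 ∷ 20010101020301 ∷ 10203101101000 ∷ 10201301101000 ∷ 10201101301000 ∷
       10302202102000 ∷ 20301102202000 ∷ 10200001301000 ∷ 10300002102000 ∷ 10102103101000 ∷
       10102101301000 ∷ 10203202102000 ∷ 20103201202000 ∷ 10101203101000 ∷ 10101201301000 ∷
       10202302102000 ∷ 20102301202000 ∷ 10101102301000 ∷ 10202203102000 ∷ 20201103202000 ∷
       20102201302000 ∷ 20201102302000 ∷ 10203302103000 ∷ 10302203103000 ∷ 30102201303000 ∷
       10100002301000 ∷ 10200003102000 ∷ 20100001302000 ∷ 10200002103000 ∷ 20010010302011 ∷
       20010010203011 ∷ 10002100301000 ∷ 10003200102000 ∷ 10001200301000 ∷ 10002300102000 ∷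
       20001100302000 ∷ 10002200103000 ∷ 12000130000010 ∷ 13000210000020 ∷ 11000230000010 ∷
       12000310000020 ∷ 21000130000020 ∷ 12000210000030 ∷ 20101030010120 ∷ 20101020010130 ∷
       20010030101021 ∷ 20010020101031 ∷ 10203010010110 ∷ 10301020010210 ∷ 10301010020120 ∷
       10201010030120 ∷ 10201010020130 ∷ 10201030010210 ∷ 10201020010310 ∷ 10103020020110 ∷
       10103010010220 ∷ 10102010010320 ∷ 10102010010230 ∷ 10102030020110 ∷ 10102020030110 ∷
       12130000000001 ∷ 13210000000002 ∷ 11230000000001 ∷ 12310000000002 ∷ 21130000000002 ∷
       12210000000003 ∷ 20030101010102 ∷ 20030010101012 ∷ 20020101010103 ∷ 20020010101013 ∷
       10030201010201 ∷ 10030102020101 ∷ 10020103020101 ∷ 10020102030101 ∷ 10020301010201 ∷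
       10020201010301 ∷ 10010203010101 ∷ 10010301020102 ∷ 10010201030102 ∷ 10010201020103 ∷
       10010103010202 ∷ 10010102010302 ∷ 10010102010203 ∷ 10020030101011 ∷ 10020010301011 ∷
       10030010102021 ∷ 10020010103021 ∷ 10020010102031 ∷ 10010020301011 ∷ 10010030102012 ∷
       10010020103012 ∷ 10010020102013 ∷ 10010010301022 ∷ 10010010201032 ∷ 10010010201023 ∷
       3200100110012 ∷ 3200011001102 ∷ 3100200110021 ∷ 3100100220011 ∷ 2100031001101 ∷
       2100013001101 ∷ 3100011002201 ∷ 1023000000000 ∷ 2031011110000 ∷ 2031100001110 ∷
       1020030000000 ∷ 2030001110000 ∷ 2013011110000 ∷ 2011031110000 ∷ 2011013110000 ∷
       3012021220000 ∷ 3021012220000 ∷ 2010003110000 ∷ 3010001220000 ∷ 2013100001110 ∷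
       3011200001120 ∷ 3011100002210 ∷ 2003010110000 ∷ 1002003000000 ∷ 2001030110000 ∷
       3001010220000 ∷ 1000023000000 ∷ 2100011003201 ∷ 2100011002301 ∷ 2011100003210 ∷
       2011100002310 ∷ 2100100320011 ∷ 2100100230011 ∷ 1023011110000 ∷ 1021031110000 ∷
       1021011310000 ∷ 1032022120000 ∷ 2031012220000 ∷ 1020001310000 ∷ 1030002120000 ∷
       1012013110000 ∷ 1012011310000 ∷ 1023022120000 ∷ 2013021220000 ∷ 1011023110000 ∷
       1011021310000 ∷ 1022032120000 ∷ 2012031220000 ∷ 1011012310000 ∷ 1022023120000 ∷
       2021013220000 ∷ 2012021320000 ∷ 2021012320000 ∷ 1023032130000 ∷ 1032023130000 ∷
       3012021330000 ∷ 1010002310000 ∷ 1020003120000 ∷ 2010001320000 ∷ 1020002130000 ∷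
       1002010310000 ∷ 1003020120000 ∷ 1001020310000 ∷ 1002030120000 ∷ 2001010320000 ∷
       1002020130000 ∷ 2100300110021 ∷ 2100200110031 ∷ 2011300001120 ∷ 2011200001130 ∷
       1023100001110 ∷ 1031200001210 ∷ 1031100002120 ∷ 1021100003120 ∷ 1021100002130 ∷
       1021300001210 ∷ 1021200001310 ∷ 1013200002110 ∷ 1013100001220 ∷ 1012100001320 ∷
       1012100001230 ∷ 1012300002110 ∷ 1012200003110 ∷ 2300100110012 ∷ 2300011001102 ∷
       2200100110013 ∷ 2200011001103 ∷ 1300021001201 ∷ 1300012002101 ∷ 1200013002101 ∷
       1200012003101 ∷ 1200031001201 ∷ 1200021001301 ∷ 1100023001101 ∷ 1100031002102 ∷
       1100021003102 ∷ 1100021002103 ∷ 1100013001202 ∷ 1100012001302 ∷ 1100012001203 ∷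
       1200300110011 ∷ 1200100310011 ∷ 1300100120021 ∷ 1200100130021 ∷ 1200100120031 ∷
       1100200310011 ∷ 1100300120012 ∷ 1100200130012 ∷ 1100200120013 ∷ 1100100310022 ∷
       1100100210032 ∷ 1100100210023 ∷ 123000000000 ∷ 230110000100 ∷ 120000300000 ∷ 210310000100 ∷
       310120000200 ∷ 203101001000 ∷ 102000300000 ∷ 201301001000 ∷ 301102002000 ∷ 100200300000 ∷
       102103001000 ∷ 103201002000 ∷ 101203001000 ∷ 102301002000 ∷ 201103002000 ∷ 102201003000 ∷
       120130000100 ∷ 130210000200 ∷ 110230000100 ∷ 120310000200 ∷ 210130000200 ∷ 120210000300 ∷
       23011010000 ∷ 12000300000 ∷ 21031010000 ∷ 31012020000 ∷ 10020300000 ∷ 12013010000 ∷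
       13021020000 ∷ 11023010000 ∷ 12031020000 ∷ 21013020000 ∷ 12021030000 ∷ 1002300000 ∷
       123000000 ∷ 120300000 ∷ 102300000 ∷ 12300000 ∷ [])
    cells (suc (suc (suc (suc zero)))) = decimals
      (234111000000001 ∷ 234000111000010 ∷ 234000000111100 ∷ 231000411000010 ∷ 341000122000020 ∷
       231411000000001 ∷ 341122000000002 ∷ 120300400000000 ∷ 213000141000010 ∷ 314000212000020 ∷
       211000341000010 ∷ 312000412000020 ∷ 321000142000020 ∷ 412000213000030 ∷ 213141000000001 ∷
       314212000000002 ∷ 211341000000001 ∷ 312412000000002 ∷ 321142000000002 ∷ 412213000000003 ∷
       102030040000000 ∷ 200340110100100 ∷ 200340001011010 ∷ 200310410100100 ∷ 300410120200200 ∷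
       200130140100100 ∷ 300140210200200 ∷ 200110340100100 ∷ 300120410200200 ∷ 300210140200200 ∷
       400120210300300 ∷ 200001340011001 ∷ 100230110400100 ∷ 100340220100200 ∷ 100210310400100 ∷
       100320420100200 ∷ 200310120400200 ∷ 100420230100300 ∷ 100120130400100 ∷ 100230240100200 ∷
       200130210400200 ∷ 100240320100300 ∷ 100110230400100 ∷ 100220340100200 ∷ 200120310400200 ∷
       100230420100300 ∷ 200210130400200 ∷ 100320240100300 ∷ 300120210400300 ∷ 100230320100400 ∷
       123000114000010 ∷ 134000221000020 ∷ 121000314000010 ∷ 132000421000020 ∷ 231000124000020 ∷
       142000231000030 ∷ 112000134000010 ∷ 123000241000020 ∷ 213000214000020 ∷ 124000321000030 ∷
       111000234000010 ∷ 122000341000020 ∷ 212000314000020 ∷ 123000421000030 ∷ 221000134000020 ∷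
       132000241000030 ∷ 312000214000030 ∷ 123000321000040 ∷ 123114000000001 ∷ 134221000000002 ∷
       121314000000001 ∷ 132421000000002 ∷ 231124000000002 ∷ 142231000000003 ∷ 112134000000001 ∷
       123241000000002 ∷ 213214000000002 ∷ 124321000000003 ∷ 111234000000001 ∷ 122341000000002 ∷
       212314000000002 ∷ 123421000000003 ∷ 221134000000002 ∷ 132241000000003 ∷ 312214000000003 ∷
       123321000000004 ∷ 100002003400111 ∷ 12003004000000 ∷ 20304101101000 ∷ 20304010010110 ∷
       20301401101000 ∷ 30401102202000 ∷ 20103104101000 ∷ 30104201202000 ∷ 20101304101000 ∷
       30102401202000 ∷ 30201104202000 ∷ 40102201303000 ∷ 20010304010101 ∷ 10203101401000 ∷
       10304202102000 ∷ 10201301401000 ∷ 10302402102000 ∷ 20301102402000 ∷ 10402203103000 ∷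
       10102103401000 ∷ 10203204102000 ∷ 20103201402000 ∷ 10204302103000 ∷ 10101203401000 ∷
       10202304102000 ∷ 20102301402000 ∷ 10203402103000 ∷ 20201103402000 ∷ 10302204103000 ∷
       30102201403000 ∷ 10203302104000 ∷ 10020030401011 ∷ 2100034001101 ∷ 2034100001110 ∷
       2034011110000 ∷ 2031041110000 ∷ 3041012220000 ∷ 2013014110000 ∷ 3014021220000 ∷
       2011034110000 ∷ 3012041220000 ∷ 3021014220000 ∷ 4012021330000 ∷ 1023011410000 ∷
       1034022120000 ∷ 1021031410000 ∷ 1032042120000 ∷ 2031012420000 ∷ 1042023130000 ∷
       1012013410000 ∷ 1023024120000 ∷ 2013021420000 ∷ 1024032130000 ∷ 1011023410000 ∷
       1022034120000 ∷ 2012031420000 ∷ 1023042130000 ∷ 2021013420000 ∷ 1032024130000 ∷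
       3012021430000 ∷ 1023032140000 ∷ 1200300410011 ∷ 123000400000 ∷ 123400000 ∷ [])

    length-cells : length (cells (# 0)) ≡ 1 × length (cells (# 1)) ≡ 70 × length (cells (# 2)) ≡ 370 ×
                   length (cells (# 3)) ≡ 510 × length (cells (# 4)) ≡ 150
    length-cells = refl , refl , refl , refl , refl

    -- Order within each dimension is enough for distinctness, since cells with different m have
    -- cones of different dimensions.
    codes-increasing : all (λ m → increasing (List.map (code lines) (cells m))) ≡ true
    codes-increasing = refl

  codes-distinct : ∀ m → AllPairs (λ h h′ → code lines h ℕ.< code lines h′) (cells m)
  codes-distinct m = AllPairsₚ.map⁻ (Linkedₚ.Linked⇒AllPairs ℕₚ.<-trans
    (increasing-sound (List.map (code lines) (cells m))
      (all-sound (λ m → increasing (List.map (code lines) (cells m))) codes-increasing m)))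

  representativeAt : Height → ℕ → Flat
  representativeAt h k = first λ F → lookup h F ℕ.≡ᵇ k

  -- Spreads from the representatives along lines through flats of equal height;
  -- a single pass over the lines reaches all flats.
  pass : List Triple → Height → Vec Bool 15 → Vec Bool 15
  pass []                 h known = known
  pass ((a , b , _) ∷ ls) h known =
    pass ls h (if (lookup h a ℕ.≡ᵇ lookup h b) ∧ lookup known b then known [ a ]≔ true else known)

  initial : Height → Vec Bool 15
  initial h = tabulate λ F → does (F Fin.≟ representativeAt h (lookup h F))

  notLeast : Height → Triple → Bool
  notLeast h (a , b , c) = (lookup h b ℕ.≤ᵇ lookup h a) ∨ (lookup h c ℕ.≤ᵇ lookup h a)

  -- The four conjuncts give the four fields of `IsCell`, in the same order.
  checkCell : List Triple → ℕ → Height → Bool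
  checkCell ls m h =
    allL (notLeast h) ls ∧ all (λ F → lookup h F ℕ.≤ᵇ m) ∧
    all {suc m} (λ k → lookup h (representativeAt h (toℕ k)) ℕ.≡ᵇ toℕ k) ∧
    Vec.foldr (λ _ → Bool) _∧_ true (pass ls h (initial h))

  abstract
    cells-checked : all (λ m → allL (checkCell lines (toℕ m)) (cells m)) ≡ true
    cells-checked = refl

    -- Completeness of the list: each chain of closed sets has the order of a listed cell.
    chains-checked : allChains lines (concatMap (λ m → List.map (code lines) (cells m)) (List.allFin 5)) 5
                       (closedSets lines) (Vec.replicate 15 0) ≡ true
    chains-checked = refl

-- Verified properties of the cells, and ultrametrics as points of the Dressian

module CellConditions where

  open import Data.Bool using (Bool; true; false; if_then_else_; _∧_; T)
  import Data.Bool.Properties as Boolₚ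
  open import Data.Empty using (⊥-elim)
  open import Data.Fin as Fin using (Fin; zero; suc; toℕ)
  import Data.Fin.Properties as Finₚ
  open import Data.Fin.Subset using (Subset)
  open import Data.List as List using (List; []; _∷_)
  open import Data.List.Membership.Propositional using (_∈_)
  open import Data.List.Relation.Unary.All using (All; []; _∷_)
  open import Data.Nat as ℕ using (ℕ; zero; suc)
  import Data.Nat.Properties as ℕₚ
  open import Data.Product using (∃; _×_; _,_; proj₁; proj₂)
  open import Data.Rational as ℚ using (ℚ; 0ℚ; 1ℚ)
  import Data.Rational.Properties as ℚₚ
  open import Data.Rational.Solver using (module +-*-Solver)
  open import Data.Sum using (inj₂; [_,_]′)
  open import Data.Unit using (tt)
  open import Data.Vec as Vec using (Vec; []; _∷_; lookup)
  open import Function using (_∘_)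
  open import Function.Bundles using (Equivalence)
  import Data.Vec.Properties as Vecₚ
  open import Relation.Binary.PropositionalEquality
  open import Relation.Nullary using (¬_; Dec; yes; no; does)
  open import Relation.Nullary.Decidable using (¬?; _×-dec_)
  open Reals
  open RealRing
  open LinearAlgebra
  open VectorSpaces
  open Tropical
  open MatroidFans
  open Configuration
  open Parametrization
  open Coordinates
  open LineOrder
  open Realization
  open Cells

  open ℝ
  open +-*-Solver using (solve; _:+_; _:-_; _:*_; _:=_)
  open Elimination ℝ-commutativeRing using (sum; sum-cong; sum-zero)

  weight-cong : ∀ {n} (σ : Subset n) {t u : Fin n → ℝ} → (∀ e → t e ≈ᴿ u e) → weight σ t ≈ᴿ weight σ u
  weight-cong [] _ = ≈-refl {0ᴿ}
  weight-cong (true ∷ σ) {t} {u} eq =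
    +-cong {t zero} {u zero} {weight σ (t ∘ suc)} {weight σ (u ∘ suc)} (eq zero) (weight-cong σ (eq ∘ suc))
  weight-cong (false ∷ σ) eq = weight-cong σ (eq ∘ suc)

  extend-cong : ∀ {t u} → (∀ e → t e ≈ᴿ u e) → ∀ e → extend t e ≈ᴿ extend u e
  extend-cong eq zero    = ≈-refl {0ᴿ}
  extend-cong eq (suc e) = eq e

  weight-0 : ∀ {n} (σ : Subset n) (t : Fin n → ℝ) m → (∀ e → seq (t e) m ≡ 0ℚ) → seq (weight σ t) m ≡ 0ℚ
  weight-0 []          t m eq = refl
  weight-0 (true  ∷ σ) t m eq = trans (cong₂ ℚ._+_ (eq zero) (weight-0 σ (t ∘ suc) m (eq ∘ suc))) (ℚₚ.+-identityˡ 0ℚ)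
  weight-0 (false ∷ σ) t m eq = weight-0 σ (t ∘ suc) m (eq ∘ suc)

  weight-linear : ∀ {n} (σ : Subset n) c (t u : Fin n → ℝ) m →
                  seq (weight σ (λ e → c *ᴿ t e +ᴿ u e)) m ≡
                  seq c m ℚ.* seq (weight σ t) m ℚ.+ seq (weight σ u) m
  weight-linear [] c t u m = sym (trans (cong (ℚ._+ 0ℚ) (ℚₚ.*-zeroʳ (seq c m))) (ℚₚ.+-identityˡ 0ℚ))
  weight-linear (true ∷ σ) c t u m = trans
    (cong (seq c m ℚ.* seq (t zero) m ℚ.+ seq (u zero) m ℚ.+_) (weight-linear σ c (t ∘ suc) (u ∘ suc) m))
    (solve 5 (λ c a b p q → (c :* a :+ b) :+ (c :* p :+ q) := c :* (a :+ p) :+ (b :+ q)) refl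
      (seq c m) (seq (t zero) m) (seq (u zero) m) (seq (weight σ (t ∘ suc)) m) (seq (weight σ (u ∘ suc)) m))
  weight-linear (false ∷ σ) c t u m = weight-linear σ c (t ∘ suc) (u ∘ suc) m

  weight-≗ : ∀ {n} (σ : Subset n) {t u : Fin n → ℝ} m → (∀ e → seq (t e) m ≡ seq (u e) m) →
             seq (weight σ t) m ≡ seq (weight σ u) m
  weight-≗ []          m eq = refl
  weight-≗ (true  ∷ σ) m eq = cong₂ ℚ._+_ (eq zero) (weight-≗ σ m (eq ∘ suc))
  weight-≗ (false ∷ σ) m eq = weight-≗ σ m (eq ∘ suc)

  φ-cong : ∀ {t u x y} → (∀ e → t e ≈ᴿ u e) → (∀ F → x F ≈ᴿ y F) → φ t x ≈ᵥ φ u y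
  φ-cong {t} {u} {x} {y} t≈u x≈y β = +-cong {x F} {y F} {weight σ (extend t)} {weight σ (extend u)}
    (x≈y F) (weight-cong σ (extend-cong {t} {u} t≈u))
    where
    σ = Basis.set β
    F = flat σ

  φ-0 : φ (λ _ → 0ᴿ) (λ _ → 0ᴿ) ≈ᵥ 0ᵥ
  φ-0 β = ≗⇒≈ {φ (λ _ → 0ᴿ) (λ _ → 0ᴿ) β} {0ᴿ} λ m → trans (ℚₚ.+-identityˡ _)
    (weight-0 (Basis.set β) (extend (λ _ → 0ᴿ)) m λ { zero → refl ; (suc e) → refl })

  φ-linear : ∀ c t u x y → φ (λ e → c *ᴿ t e +ᴿ u e) (λ F → c *ᴿ x F +ᴿ y F) ≈ᵥ (c *ᵥ φ t x) +ᵥ φ u y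
  φ-linear c t u x y β = ≗⇒≈ {φ (λ e → c *ᴿ t e +ᴿ u e) (λ F → c *ᴿ x F +ᴿ y F) β} {((c *ᵥ φ t x) +ᵥ φ u y) β} λ m →
    trans (cong (seq c m ℚ.* seq (x F) m ℚ.+ seq (y F) m ℚ.+_)
            (trans (weight-≗ σ m λ { zero → sym (trans (cong (ℚ._+ 0ℚ) (ℚₚ.*-zeroʳ (seq c m))) (ℚₚ.+-identityˡ 0ℚ))
                                   ; (suc e) → refl })
                   (weight-linear σ c (extend t) (extend u) m)))
      (solve 5 (λ c a b p q → (c :* a :+ b) :+ (c :* p :+ q) := c :* (a :+ p) :+ (b :+ q)) refl
        (seq c m) (seq (x F) m) (seq (y F) m) (seq (weight σ (extend t)) m) (seq (weight σ (extend u)) m))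
    where
    σ = Basis.set β
    F = flat σ

  linearCombination-φ : ∀ {k} (c : Fin k → ℝ) (t : Fin k → Fin 9 → ℝ) (x : Fin k → Flat → ℝ) →
    linearCombination c (λ i → φ (t i) (x i)) ≈ᵥ φ (λ e → sum (λ i → c i *ᴿ t i e)) (λ F → sum (λ i → c i *ᴿ x i F))
  linearCombination-φ {zero}  c t x β = ≈-sym {φ (λ _ → 0ᴿ) (λ _ → 0ᴿ) β} {0ᴿ} (φ-0 β)
  linearCombination-φ {suc k} c t x β = ≈-trans
    {c zero *ᴿ φ (t zero) (x zero) β +ᴿ L} {c zero *ᴿ φ (t zero) (x zero) β +ᴿ R} {S}
    (+-cong {c zero *ᴿ φ (t zero) (x zero) β} {c zero *ᴿ φ (t zero) (x zero) β} {L} {R}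
      (≈-refl {c zero *ᴿ φ (t zero) (x zero) β}) (linearCombination-φ (c ∘ suc) (t ∘ suc) (x ∘ suc) β))
    (≈-sym {S} {c zero *ᴿ φ (t zero) (x zero) β +ᴿ R}
      (φ-linear (c zero) (t zero) (λ e → sum (λ i → c (suc i) *ᴿ t (suc i) e))
        (x zero) (λ F → sum (λ i → c (suc i) *ᴿ x (suc i) F)) β))
    where
    L R S : ℝ
    L = linearCombination (c ∘ suc) (λ i → φ (t (suc i)) (x (suc i))) β
    R = φ (λ e → sum (λ i → c (suc i) *ᴿ t (suc i) e)) (λ F → sum (λ i → c (suc i) *ᴿ x (suc i) F)) β
    S = φ (λ e → sum (λ i → c i *ᴿ t i e)) (λ F → sum (λ i → c i *ᴿ x i F)) β

  -- Kronecker's delta, expressed through `natᴿ` so that identities between indicators can be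
  -- verified for natural numbers.
  δ : ∀ {n} → Fin n → Fin n → ℝ
  δ i j = natᴿ (bit (does (i Fin.≟ j)))

  natᴿ-1 : natᴿ 1 ≈ᴿ 1ᴿ
  natᴿ-1 = ≗⇒≈ {natᴿ 1} {1ᴿ} λ _ → ℚₚ.+-identityʳ 1ℚ

  sum-δ : ∀ {n} (c : Fin n → ℝ) j → sum (λ i → c i *ᴿ δ i j) ≈ᴿ c j
  sum-δ {suc n} c zero = ≈-trans {c zero *ᴿ natᴿ 1 +ᴿ S} {c zero *ᴿ 1ᴿ +ᴿ 0ᴿ} {c zero}
    (+-cong {c zero *ᴿ natᴿ 1} {c zero *ᴿ 1ᴿ} {S} {0ᴿ}
      (*-cong {c zero} {c zero} {natᴿ 1} {1ᴿ} (≈-refl {c zero}) natᴿ-1)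
      (sum-zero (λ i → c (suc i) *ᴿ 0ᴿ) λ i → ℝᶜ.zeroʳ (c (suc i))))
    (≈-trans {c zero *ᴿ 1ᴿ +ᴿ 0ᴿ} {c zero *ᴿ 1ᴿ} {c zero}
      (ℝᶜ.+-identityʳ (c zero *ᴿ 1ᴿ)) (ℝᶜ.*-identityʳ (c zero)))
    where
    S : ℝ
    S = sum (λ i → c (suc i) *ᴿ 0ᴿ)
  sum-δ {suc n} c (suc j) = ≈-trans {c zero *ᴿ 0ᴿ +ᴿ S} {0ᴿ +ᴿ c (suc j)} {c (suc j)}
    (+-cong {c zero *ᴿ 0ᴿ} {0ᴿ} {S} {c (suc j)} (ℝᶜ.zeroʳ (c zero)) (sum-δ (c ∘ suc) j))
    (ℝᶜ.+-identityˡ (c (suc j)))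
    where
    S : ℝ
    S = sum (λ i → c (suc i) *ᴿ δ i j)

  -- `constant` bounds the dimension of the cone from above: a compatible y has one value per level.
  -- `attained` bounds it from below, because no level is empty.
  record IsCell (m : ℕ) (h : Height) : Set where
    field
      ultrametric : Ultrametric (real h)
      bounded     : ∀ F → lookup h F ℕ.≤ m
      attained    : ∀ (k : Fin (suc m)) → lookup h (representativeAt h (toℕ k)) ≡ toℕ k
      constant    : ∀ {y} → real h ⊑ y → ∀ F → y F ≈ᴿ y (representativeAt h (lookup h F))

  private
    T⁻ : ∀ {b} → b ≡ true → T b
    T⁻ refl = tt

    module _ (h : Height) {y : Flat → ℝ} (h⊑y : real h ⊑ y) where

      Justified : Vec Bool 15 → Set
      Justified known = ∀ F → lookup known F ≡ true → y F ≈ᴿ y (representativeAt h (lookup h F))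

      initial-justified : Justified (initial h)
      initial-justified F eq = subst (λ G → y F ≈ᴿ y G)
        (true⇒ (F Fin.≟ representativeAt h (lookup h F))
          (trans (sym (Vecₚ.lookup∘tabulate (λ G → does (G Fin.≟ representativeAt h (lookup h G))) F)) eq)) (≈-refl {y F})
        where
        true⇒ : ∀ {P : Set} (p? : Dec P) → does p? ≡ true → P
        true⇒ (yes p) _ = p

      -- For collinear a and b of equal height, `real h ⊑ y` applies in both directions and makes y
      -- a and y b equal.
      mark : ∀ {a b c} known → Line a b c → Justified known →
             Justified (if (lookup h a ℕ.≡ᵇ lookup h b) ∧ lookup known b then known Vec.[ a ]≔ true else known)
      mark {a} {b} known l just = go (lookup h a ℕ.≡ᵇ lookup h b) (lookup known b) refl refl
        where
        go : ∀ p q → (lookup h a ℕ.≡ᵇ lookup h b) ≡ p → lookup known b ≡ q →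
             Justified (if p ∧ q then known Vec.[ a ]≔ true else known)
        go false _     _ _ = just
        go true  false _ _ = just
        go true  true  p q F eq = decide (F Fin.≟ a)
          where
          ha≡hb : lookup h a ≡ lookup h b
          ha≡hb = ℕₚ.≡ᵇ⇒≡ (lookup h a) (lookup h b) (T⁻ p)
          ya≈yb : y a ≈ᴿ y b
          ya≈yb = h⊑y l (natᴿ-mono (ℕₚ.≤-reflexive ha≡hb)) ,
                  h⊑y (line-swap l) (natᴿ-mono (ℕₚ.≤-reflexive (sym ha≡hb)))
          decide : Dec (F ≡ a) → y F ≈ᴿ y (representativeAt h (lookup h F))
          decide (yes refl) = ≈-trans {y a} {y b} {y (representativeAt h (lookup h a))} ya≈yb
            (subst (λ k → y b ≈ᴿ y (representativeAt h k)) (sym ha≡hb) (just b q))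
          decide (no F≢a) = just F (trans (sym (Vecₚ.lookup∘update′ F≢a known true)) eq)

      pass-justified : ∀ {ls known} → All IsLine ls → Justified known → Justified (pass ls h known)
      pass-justified []       just = just
      pass-justified {known = known} (l ∷ ls) just = pass-justified ls (mark known l just)

    allTrue : ∀ {n} (v : Vec Bool n) → Vec.foldr (λ _ → Bool) _∧_ true v ≡ true → ∀ i → lookup v i ≡ true
    allTrue (b ∷ v) eq zero    = Boolₚ.∧-conicalˡ b _ eq
    allTrue (b ∷ v) eq (suc i) = allTrue v (Boolₚ.∧-conicalʳ b _ eq) i

    fromCheck : ∀ m h → checkCell lines m h ≡ true → IsCell m h
    fromCheck m h eq = record
      { ultrametric = λ {a} {b} {c} l (b≰a , c≰a) → 
          [ (λ t → b≰a (natᴿ-mono (ℕₚ.≤ᵇ⇒≤ (lookup h b) (lookup h a) t)))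
          , (λ t → c≰a (natᴿ-mono (ℕₚ.≤ᵇ⇒≤ (lookup h c) (lookup h a) t)))
          ]′ (Equivalence.to Boolₚ.T-∨ (T⁻ (allL-sound (notLeast h) lines check₁ (lines-complete l))))
      ; bounded  = λ F → ℕₚ.≤ᵇ⇒≤ (lookup h F) m (T⁻ (all-sound (λ F → lookup h F ℕ.≤ᵇ m) check₂ F))
      ; attained = λ k → ℕₚ.≡ᵇ⇒≡ _ (toℕ k)
          (T⁻ (all-sound (λ k → lookup h (representativeAt h (toℕ k)) ℕ.≡ᵇ toℕ k) check₃ k))
      ; constant = λ {y} h⊑y F → pass-justified h {y} h⊑y {lines} {initial h} lines-sound (initial-justified h {y} h⊑y) F
          (allTrue (pass lines h (initial h)) check₄ F) }
      where
      A B C D : Bool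
      A = List.foldr _∧_ true (List.map (notLeast h) lines)
      B = all (λ F → lookup h F ℕ.≤ᵇ m)
      C = all {suc m} (λ k → lookup h (representativeAt h (toℕ k)) ℕ.≡ᵇ toℕ k)
      D = Vec.foldr (λ _ → Bool) _∧_ true (pass lines h (initial h))
      check₁ : A ≡ true
      check₁ = Boolₚ.∧-conicalˡ A (B ∧ C ∧ D) eq
      check₂ : B ≡ true
      check₂ = Boolₚ.∧-conicalˡ B (C ∧ D) (Boolₚ.∧-conicalʳ A (B ∧ C ∧ D) eq)
      check₃ : C ≡ true
      check₃ = Boolₚ.∧-conicalˡ C D (Boolₚ.∧-conicalʳ B (C ∧ D) (Boolₚ.∧-conicalʳ A (B ∧ C ∧ D) eq))
      check₄ : D ≡ true
      check₄ = Boolₚ.∧-conicalʳ C D (Boolₚ.∧-conicalʳ B (C ∧ D) (Boolₚ.∧-conicalʳ A (B ∧ C ∧ D) eq))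

  isCell : ∀ m {h} → h ∈ cells m → IsCell (toℕ m) h
  isCell m {h} h∈ = fromCheck (toℕ m) h (allL-sound (checkCell lines (toℕ m)) (cells m)
    (all-sound (λ m → List.foldr _∧_ true (List.map (checkCell lines (toℕ m)) (cells m))) cells-checked m) h∈)

  private
    sinks : ∀ {x} → Ultrametric x → ∀ {a b c} → Line a b c → ¬ (x b ≤ᴿ x a) → x c ≤ᴿ x a
    sinks {x} u {a} {b} {c} l b≰a = ≤-stable {x c} {x a} λ c≰a → u l (b≰a , c≰a)

  -- Suppose x f + x f′ is smaller than both other sums. Strictness and `sinks` (on a line, if b
  -- exceeds a, then c does not) propagate around the quadrilateral. If x f < x g, they give g ≤ f′
  -- ≤ h′ ≤ f for the values, a contradiction; if x g ≤ x f, they give x f < x h′ together with h′ ≤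
  -- f′ ≤ g′ ≤ f.
  quad-ultrametric : ∀ {x} → Ultrametric x → ∀ {f f′ g g′ h h′} →
    Line f g h → Line f g′ h′ → Line f′ g h′ → Line f′ g′ h →
    ¬ (¬ (x g +ᴿ x g′ ≤ᴿ x f +ᴿ x f′) × ¬ (x h +ᴿ x h′ ≤ᴿ x f +ᴿ x f′))
  quad-ultrametric {x} u {f} {f′} {g} {g′} {h} {h′} fgh fg′h′ f′gh′ f′g′h (g≰f , h≰f) = case₁ case₂
    where
    sum-≤ : ∀ {a b c d} → x a ≤ᴿ x c → x b ≤ᴿ x d → x a +ᴿ x b ≤ᴿ x c +ᴿ x d
    sum-≤ {a} {b} {c} {d} = +-mono-≤ {x a} {x c} {x b} {x d}
    commute : ∀ {a b c d} → x a +ᴿ x b ≤ᴿ x c +ᴿ x d → x a +ᴿ x b ≤ᴿ x d +ᴿ x c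
    commute {a} {b} {c} {d} = ≤-resp-≈ {x a +ᴿ x b} {x a +ᴿ x b} {x c +ᴿ x d} {x d +ᴿ x c}
      (≈-refl {x a +ᴿ x b}) (ℝᶜ.+-comm (x c) (x d))
    tr : ∀ {a b c} → x a ≤ᴿ x b → x b ≤ᴿ x c → x a ≤ᴿ x c
    tr {a} {b} {c} = ≤-trans {x a} {x b} {x c}
    s : ∀ {a b c} → Line a b c → ¬ (x b ≤ᴿ x a) → x c ≤ᴿ x a
    s = sinks {x} u
    case₁ : ¬ ¬ (x g ≤ᴿ x f)
    case₁ f<g =
      let h≤f    = s fgh f<g
          f′<h′  = λ h′≤f′ → h≰f (sum-≤ h≤f h′≤f′)
          g≤f′   = s (line-flip f′gh′) f′<h′
          f<g′   = λ g′≤f → g≰f (commute (sum-≤ g≤f′ g′≤f))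
          h′≤f   = s fg′h′ f<g′
      in f<g (tr g≤f′ (tr (≰⇒≥ {x h′} {x f′} f′<h′) h′≤f))
    case₂ : ¬ (x g ≤ᴿ x f)
    case₂ g≤f =
      let f′<g′ = λ g′≤f′ → g≰f (sum-≤ g≤f g′≤f′)
          h≤f′  = s f′g′h f′<g′
          f<h′  = λ h′≤f → h≰f (commute (sum-≤ h≤f′ h′≤f))
          g′≤f  = s (line-flip fg′h′) f<h′
          f′<g  = λ g≤f′ → g≰f (commute (sum-≤ g≤f′ g′≤f))
          h′≤f′ = s f′gh′ f′<g
      in f<h′ (tr h′≤f′ (tr (≰⇒≥ {x g′} {x f′} f′<g′) g′≤f))

  private
    classicalMinimum : ∀ n (V : Fin (suc n) → ℝ) → ¬ ¬ (∃ λ i → ∀ j → V i ≤ᴿ V j)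
    classicalMinimum zero    V k = k (zero , λ { zero → ≤-refl {V zero} })
    classicalMinimum (suc n) V k = classicalMinimum n (V ∘ suc) λ (i , i≤) →
      let 0≰i = λ 0≤i → k (zero , λ { zero → ≤-refl {V zero} ; (suc j) → ≤-trans {V zero} {V (suc i)} {V (suc j)} 0≤i (i≤ j) })
      in k (suc i , λ { zero → ≰⇒≥ {V zero} {V (suc i)} 0≰i ; (suc j) → i≤ j })

    twice : ∀ {n} (V : Fin (suc n) → ℝ) → (∀ i → ¬ (∀ j → i ≢ j → ¬ (V j ≤ᴿ V i))) →
            ¬ ¬ (∃ λ i → ∃ λ j → i ≢ j × (∀ k → V i ≤ᴿ V k) × (∀ k → V j ≤ᴿ V k))
    twice {n} V notUnique none = classicalMinimum n V λ (i , i≤) → notUnique i λ j i≢j j≤i →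
      none (i , j , i≢j , i≤ , λ k → ≤-trans {V j} {V i} {V k} j≤i (i≤ k))

    AttainedTwice : (qs : List Form) → (Flat → ℝ) → Set
    AttainedTwice qs x = ∃ λ i → ∃ λ j → i ≢ j × Attains qs x i × Attains qs x j

    attainedTwice : ∀ {x} → Ultrametric x → ∀ {qs} → Kind Line qs → ¬ ¬ AttainedTwice qs x
    attainedTwice {x} u (binomial {p} {q} p≡q) = twice (λ i → value x (List.lookup (p ∷ q ∷ []) i)) λ
      { zero       k → k (suc zero) (λ ()) (proj₂ (sameValue x p≡q))
      ; (suc zero) k → k zero (λ ()) (proj₁ (sameValue x p≡q)) }
    attainedTwice {x} u (line {p} {q} {r} h p≡ q≡ r≡ abc) = twice (λ i → value x (List.lookup (p ∷ q ∷ r ∷ []) i)) λ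
      { zero             k → u abc ( (λ le → k (suc zero) (λ ()) (comparison⁻ x q≡ p≡ le))
                                   , (λ le → k (suc (suc zero)) (λ ()) (comparison⁻ x r≡ p≡ le)))
      ; (suc zero)       k → u (line-swap abc) ( (λ le → k zero (λ ()) (comparison⁻ x p≡ q≡ le))
                                               , (λ le → k (suc (suc zero)) (λ ()) (comparison⁻ x r≡ q≡ le)))
      ; (suc (suc zero)) k → u (line-rotate (line-rotate abc))
                                               ( (λ le → k zero (λ ()) (comparison⁻ x p≡ r≡ le))
                                               , (λ le → k (suc zero) (λ ()) (comparison⁻ x q≡ r≡ le))) }
    attainedTwice {x} u (quad {f} {f′} {g} {g′} {h} {h′} l₁ l₂ l₃ l₄) =
      twice (λ i → value x (List.lookup ((f , f′) ∷ (g , g′) ∷ (h , h′) ∷ []) i)) λ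
      { zero             k → quad-ultrametric {x} u l₁ l₂ l₃ l₄ (k (suc zero) (λ ()) , k (suc (suc zero)) (λ ()))
      ; (suc zero)       k → quad-ultrametric {x} u (line-swap l₁) (line-swap l₃) (line-swap l₂) (line-swap l₄)
                               (k zero (λ ()) , k (suc (suc zero)) (λ ()))
      ; (suc (suc zero)) k → quad-ultrametric {x} u (line-rotate (line-rotate l₁)) (line-rotate (line-rotate l₄))
                               (line-rotate (line-rotate l₂)) (line-rotate (line-rotate l₃))
                               (k zero (λ ()) , k (suc zero) (λ ())) }

  point : Height → X → ℕ
  point h β = lookup h (flat (Basis.set β))

  point≈φ : ∀ h → natural (point h) ≈ᵥ φ (λ _ → 0ᴿ) (real h)
  point≈φ h β = ≗⇒≈ {natural (point h) β} {φ (λ _ → 0ᴿ) (real h) β} λ m → sym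
    (trans (cong (natℚ (point h β) ℚ.+_) (weight-0 (Basis.set β) (extend (λ _ → 0ᴿ)) m λ { zero → refl ; (suc e) → refl }))
      (ℚₚ.+-identityʳ (natℚ (point h β))))

  -- `attainedTwice` provides two minimal terms only up to double negation. At a natural point
  -- minimality is decidable, so they can be found by search.
  ultrametric⇒dressian : ∀ h → Ultrametric (real h) → Dressian desargues (natural (point h))
  ultrametric⇒dressian h u = index-elim (λ P → TropicalHypersurface (G desargues P) (natural (point h))) atRelation
    where
    n : X → ℕ
    n = point h
    atRelation : ∀ s i j k l (d : Distinct s i j k l) →
                 TropicalHypersurface (G desargues (index s i j k l d)) (natural n)
    atRelation s i j k l d = decide (Finₚ.any? λ p → Finₚ.any? λ q → ¬? (p Fin.≟ q) ×-dec
        (attainsMinimum? f n p ×-dec attainsMinimum? f n q))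
      where
      f : Polynomial X
      f = G desargues (index s i j k l d)
      attains : ∀ p → Attains (forms (closure s) i j k l) (real h) p →
                AttainsMinimum f (natural n) (fromForm s i j k l d p)
      attains p att = AttainsMinimum-resp-≈ f {φ (λ _ → 0ᴿ) (real h)} {natural n}
        (λ β → ≈-sym {natural n β} {φ (λ _ → 0ᴿ) (real h) β} (point≈φ h β))
        (attains⁻ s i j k l d (λ _ → 0ᴿ) (real h)
          (subst (Attains (forms (closure s) i j k l) (real h)) (sym (to∘from s i j k l d p)) att))
      Twice : Set
      Twice = ∃ λ p → ∃ λ q → p ≢ q × (AttainsMinimum f (natural n) p × AttainsMinimum f (natural n) q)
      decide : Dec Twice → TropicalHypersurface f (natural n)
      decide (yes t) = inj₂ t
      decide (no ¬t) = ⊥-elim (attainedTwice {real h} u (kindOf s i j k l d) λ (p , q , p≢q , attp , attq) →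
        ¬t (fromForm s i j k l d p , fromForm s i j k l d q ,
            (λ eq → p≢q (trans (sym (to∘from s i j k l d p)) (trans (cong (toForm s i j k l d) eq) (to∘from s i j k l d q)))) ,
            (attains p attp , attains q attq)))

-- Cones of the cells, their dimensions and their number

module CellCones where

  open import Data.Bool using (true; false; T)
  open import Data.Empty using (⊥-elim)
  open import Data.Fin as Fin using (Fin; zero; suc; #_; toℕ; _↑ˡ_; _↑ʳ_; splitAt)
  import Data.Fin.Properties as Finₚ
  open import Data.List as List using (List; _∷_; length)
  open import Data.List.Membership.Propositional using (_∈_)
  import Data.List.Membership.Propositional as ∈
  import Data.List.Membership.Propositional.Properties as ∈ₚ
  open import Data.List.Relation.Unary.AllPairs using (AllPairs; _∷_)
  open import Data.List.Relation.Unary.All as All using (All; _∷_)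
  open import Data.List.Relation.Unary.Any as Any using (here; there)
  open import Data.Nat as ℕ using (ℕ; zero; suc; z≤n; s≤s)
  import Data.Nat.Properties as ℕₚ
  open import Data.Product using (∃; _×_; _,_; proj₁; proj₂)
  open import Data.Rational as ℚ using (ℚ; 1ℚ)
  import Data.Rational.Properties as ℚₚ
  open import Data.Rational.Solver using (module +-*-Solver)
  open import Data.Sum using (inj₁; inj₂; [_,_]′)
  open import Data.Unit using (tt)
  open import Data.Vec using (_∷_; lookup)
  open import Function using (_∘_)
  open import Level using (0ℓ)
  open import Relation.Binary.PropositionalEquality
  open import Relation.Binary.Definitions using (Tri; tri<; tri≈; tri>)
  open import Relation.Nullary using (¬_; Dec; yes; no; does)
  open import Relation.Nullary.Decidable using (dec-true; dec-false)
  open import Relation.Unary using (Pred; _⊆_; _≐_)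
  open Reals
  open RealRing
  open LinearAlgebra
  open VectorSpaces
  open Tropical
  open MatroidFans
  open Configuration
  open Parametrization
  open Coordinates
  open LineOrder
  open Realization
  open Cells
  open CellConditions

  open ℝ
  open +-*-Solver using (solve; _:+_; _:-_; _:*_; _:=_)
  open Elimination ℝ-commutativeRing using (sum; sum-cong; sum-zero)
  module Cell {m h} (isC : IsCell m h) where
    open IsCell isC

    h∈D : Dressian desargues (natural (point h))
    h∈D = ultrametric⇒dressian h ultrametric

    C : Pred (Point X) 0ℓ
    C = cone (dressianFan desargues) (coneIndex desargues (point h) h∈D)

    -- With `∈C⁻` this describes the cone of a cell: up to ≈ it consists of the φ t y with arbitrary
    -- weights t and `real h ⊑ y`.
    ∈C⁺ : ∀ t {y} → real h ⊑ y → C (φ t y)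
    ∈C⁺ t {y} h⊑y = ≼⇒∈cone desargues (point h) h∈D {φ t y} λ P i att →
      φ-mono {real h} {y} (λ _ → 0ᴿ) t ultrametric h⊑y P i
        (AttainsMinimum-resp-≈ (G desargues P) (point≈φ h) att)

    ∈C⁻ : ∀ {w} → C w → w ≈ᵥ φ (weights w) (flatValues w) × real h ⊑ flatValues w
    ∈C⁻ {w} w∈C = w≈ , φ-reflects {real h} {flatValues w} (λ _ → 0ᴿ) (weights w) ultrametric λ P i att →
        AttainsMinimum-resp-≈ (G desargues P) {w} {φ (weights w) (flatValues w)} w≈
          (∈cone⇒≼ desargues (point h) h∈D {w} w∈C P i
            (AttainsMinimum-resp-≈ (G desargues P) {φ (λ _ → 0ᴿ) (real h)} {natural (point h)}
              (λ β → ≈-sym {natural (point h) β} {φ (λ _ → 0ᴿ) (real h) β} (point≈φ h β)) att))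
      where
      w≈ : w ≈ᵥ φ (weights w) (flatValues w)
      w≈ = dressian⇒φ (cone⊆Dressian desargues (coneIndex desargues (point h) h∈D) {w} w∈C)

    private
      level : Flat → Fin (suc m)
      level F = Fin.fromℕ< (s≤s (bounded F))

      toℕ-level : ∀ F → toℕ (level F) ≡ lookup h F
      toℕ-level F = Finₚ.toℕ-fromℕ< (s≤s (bounded F))

      weightIndex : Fin 9 → Fin (9 ℕ.+ suc m)
      weightIndex e = e ↑ˡ suc m

      levelIndex : Fin (suc m) → Fin (9 ℕ.+ suc m)
      levelIndex k = 9 ↑ʳ k

      disjoint : ∀ e k → weightIndex e ≢ levelIndex k
      disjoint e k eq with trans (sym (Finₚ.splitAt-↑ˡ 9 e (suc m)))
                            (trans (cong (splitAt 9) eq) (Finₚ.splitAt-↑ʳ 9 (suc m) k))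
      ... | ()

      indices : ∀ {p} (Q : Fin (9 ℕ.+ suc m) → Set p) → (∀ e → Q (weightIndex e)) → (∀ k → Q (levelIndex k)) → ∀ i → Q i
      indices Q f g i = go (splitAt 9 i) refl
        where
        go : ∀ s → splitAt 9 i ≡ s → Q i
        go (inj₁ e) eq = subst Q (Finₚ.splitAt⁻¹-↑ˡ eq) (f e)
        go (inj₂ k) eq = subst Q (Finₚ.splitAt⁻¹-↑ʳ {9} eq) (g k)

      δ-≢ : ∀ {n} {i j : Fin n} → i ≢ j → δ i j ≡ natᴿ 0
      δ-≢ {i = i} {j} i≢j = cong (natᴿ ∘ bit) (dec-false (i Fin.≟ j) i≢j)

    -- The nine normalized weights, and the indicators of the levels of the cell.
    basisVector : Fin (9 ℕ.+ suc m) → Point X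
    basisVector i = φ (λ e → δ i (weightIndex e)) (λ F → δ i (levelIndex (level F)))

    combination : ∀ c → linearCombination c basisVector ≈ᵥ
                  φ (λ e → c (weightIndex e)) (λ F → c (levelIndex (level F)))
    combination c β = ≈-trans {linearCombination c basisVector β} {φ t x β} {φ t′ x′ β}
      (linearCombination-φ c (λ i e → δ i (weightIndex e)) (λ i F → δ i (levelIndex (level F))) β)
      (φ-cong {t} {t′} {x} {x′} (λ e → sum-δ c (weightIndex e)) (λ F → sum-δ c (levelIndex (level F))) β)
      where
      t t′ : Fin 9 → ℝ
      t e  = sum (λ i → c i *ᴿ δ i (weightIndex e))
      t′ e = c (weightIndex e)
      x x′ : Flat → ℝ
      x F  = sum (λ i → c i *ᴿ δ i (levelIndex (level F)))
      x′ F = c (levelIndex (level F))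

    private
      atLeast : ℕ → Flat → ℝ
      atLeast j F = natᴿ (bit (j ℕ.≤ᵇ lookup h F))

      ⊑atLeast : ∀ j → real h ⊑ atLeast j
      ⊑atLeast j {a} {b} _ le = natᴿ-mono (bit-mono (j ℕ.≤ᵇ lookup h a) (j ℕ.≤ᵇ lookup h b) λ t →
        ℕₚ.≤⇒≤ᵇ (ℕₚ.≤-trans (ℕₚ.≤ᵇ⇒≤ j (lookup h a) t) (natᴿ-cancel le)))
        where
        bit-mono : ∀ p q → (T p → T q) → bit p ℕ.≤ bit q
        bit-mono false _     _ = z≤n
        bit-mono true  true  _ = s≤s z≤n
        bit-mono true  false f = ⊥-elim (f tt)

      level-difference : ∀ k F → bit (toℕ k ℕ.≤ᵇ lookup h F) ≡
        bit (does (levelIndex k Fin.≟ levelIndex (level F))) ℕ.+ bit (suc (toℕ k) ℕ.≤ᵇ lookup h F)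
      level-difference k F = go (ℕₚ.<-cmp (toℕ k) (lookup h F))
        where
        below : ∀ {j} → j ℕ.≤ lookup h F → bit (j ℕ.≤ᵇ lookup h F) ≡ 1
        below {j} le = cong bit (dec-true (j ℕ.≤? lookup h F) le)
        above : ∀ {j} → ¬ (j ℕ.≤ lookup h F) → bit (j ℕ.≤ᵇ lookup h F) ≡ 0
        above {j} ≰ = cong bit (dec-false (j ℕ.≤? lookup h F) ≰)
        different : toℕ k ≢ lookup h F → bit (does (levelIndex k Fin.≟ levelIndex (level F))) ≡ 0
        different ≢ = cong bit (dec-false (levelIndex k Fin.≟ levelIndex (level F)) λ eq →
          ≢ (trans (cong toℕ (Finₚ.↑ʳ-injective 9 k (level F) eq)) (toℕ-level F)))
        go : Tri (toℕ k ℕ.< lookup h F) (toℕ k ≡ lookup h F) (lookup h F ℕ.< toℕ k) → _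
        go (tri< lt ≢ _) = trans (below (ℕₚ.<⇒≤ lt)) (sym (cong₂ ℕ._+_ (different ≢) (below lt)))
        go (tri≈ _ eq _) = trans (below (ℕₚ.≤-reflexive eq)) (sym (cong₂ ℕ._+_
          (cong bit (dec-true (levelIndex k Fin.≟ levelIndex (level F))
            (cong levelIndex (Finₚ.toℕ-injective (trans eq (sym (toℕ-level F)))))))
          (above λ lt → ℕₚ.<-irrefl eq lt)))
        go (tri> _ ≢ gt) = trans (above (ℕₚ.<⇒≱ gt)) (sym (cong₂ ℕ._+_ (different ≢)
          (above λ lt → ℕₚ.<-asym gt lt)))

      subtract : ∀ d {a b} → a ≡ d ℕ.+ b → 1ᴿ *ᴿ natᴿ a +ᴿ ((-ᴿ 1ᴿ) *ᴿ natᴿ b +ᴿ 0ᴿ) ≈ᴿ natᴿ d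
      subtract d {_} {b} refl = ≗⇒≈ {1ᴿ *ᴿ natᴿ (d ℕ.+ b) +ᴿ ((-ᴿ 1ᴿ) *ᴿ natᴿ b +ᴿ 0ᴿ)} {natᴿ d} λ _ →
        trans (cong₂ ℚ._+_ (trans (ℚₚ.*-identityˡ (natℚ (d ℕ.+ b))) (natℚ-+ d b))
          (trans (ℚₚ.+-identityʳ ((ℚ.- 1ℚ) ℚ.* natℚ b))
            (trans (sym (ℚₚ.neg-distribˡ-* 1ℚ (natℚ b))) (cong ℚ.-_ (ℚₚ.*-identityˡ (natℚ b))))))
          (solve 2 (λ d b → (d :+ b) :- b := d) refl (natℚ d) (natℚ b))

      weightVector∈Span : ∀ e → Span C (basisVector (weightIndex e))
      weightVector∈Span e = singleton∈Span {C = C} (∈C⁺ (λ e′ → δ (weightIndex e) (weightIndex e′))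
        {λ F → δ (weightIndex e) (levelIndex (level F))} λ {a} {b} _ _ →
        subst₂ _≤ᴿ_ (sym (δ-≢ (disjoint e (level a)))) (sym (δ-≢ (disjoint e (level b)))) (≤-refl {natᴿ 0}))

      -- The indicator of one level need not respect the order of h. It is the difference of the
      -- indicators of height at least k and at least k + 1, which do.
      levelVector∈Span : ∀ k → Span C (basisVector (levelIndex k))
      levelVector∈Span k = 2 , c , (λ i → φ (λ _ → 0ᴿ) (atLeast (j i))) , (λ i → ∈C⁺ (λ _ → 0ᴿ) {atLeast (j i)} (⊑atLeast (j i))) ,
        λ β → ≈-trans {basisVector (levelIndex k) β} {φ t x β} {L β}
          (φ-cong {λ e → δ (levelIndex k) (weightIndex e)} {t} {λ F → δ (levelIndex k) (levelIndex (level F))} {x}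
            (λ e → subst (_≈ᴿ t e) (sym (δ-≢ (disjoint e k ∘ sym)))
              (≈-sym {t e} {0ᴿ} (sum-zero (λ i → c i *ᴿ 0ᴿ) λ i → ℝᶜ.zeroʳ (c i))))
            (λ F → ≈-sym {x F} {δ (levelIndex k) (levelIndex (level F))}
              (subtract (bit (does (levelIndex k Fin.≟ levelIndex (level F)))) (level-difference k F))) β)
          (≈-sym {L β} {φ t x β} (linearCombination-φ c (λ _ _ → 0ᴿ) (λ i → atLeast (j i)) β))
        where
        c : Fin 2 → ℝ
        c zero       = 1ᴿ
        c (suc zero) = -ᴿ 1ᴿ
        j : Fin 2 → ℕ
        j zero       = toℕ k
        j (suc zero) = suc (toℕ k)
        t : Fin 9 → ℝ
        t e = sum (λ i → c i *ᴿ 0ᴿ)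
        x : Flat → ℝ
        x F = sum (λ i → c i *ᴿ atLeast (j i) F)
        L : Point X
        L = linearCombination c (λ i → φ (λ _ → 0ᴿ) (atLeast (j i)))

      representativeOf : Fin (suc m) → Flat
      representativeOf k = representativeAt h (toℕ k)

      level-representative : ∀ k → level (representativeOf k) ≡ k
      level-representative k = Finₚ.toℕ-injective (trans (toℕ-level (representativeOf k)) (attained k))

      independent : LinearlyIndependent basisVector
      independent c lc≈0 = indices (λ i → c i ≈ᴿ 0ᴿ) (φ≈0⇒weights≈0 {t} {x} φ≈0) λ k →
        subst (λ k′ → c (levelIndex k′) ≈ᴿ 0ᴿ) (level-representative k) (φ≈0⇒flats≈0 {t} {x} φ≈0 (representativeOf k))
        where
        t : Fin 9 → ℝ
        t e = c (weightIndex e)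
        x : Flat → ℝ
        x F = c (levelIndex (level F))
        φ≈0 : φ t x ≈ᵥ 0ᵥ
        φ≈0 β = ≈-trans {φ t x β} {linearCombination c basisVector β} {0ᴿ}
          (≈-sym {linearCombination c basisVector β} {φ t x β} (combination c β)) (lc≈0 β)

      C⊆Spanned : C ⊆ Spanned basisVector
      C⊆Spanned {w} w∈C = c , λ β → ≈-trans {w β} {φ (weights w) (flatValues w) β} {L β} (proj₁ (∈C⁻ {w} w∈C) β)
          (≈-trans {φ (weights w) (flatValues w) β} {φ t x β} {L β}
            (φ-cong {weights w} {t} {flatValues w} {x}
              (λ e → subst (weights w e ≈ᴿ_) (sym (c-weight e)) (≈-refl {weights w e}))
              (λ F → subst (flatValues w F ≈ᴿ_) (sym (trans (c-level (level F))
                (cong (λ n → flatValues w (representativeAt h n)) (toℕ-level F))))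
                (constant {flatValues w} (proj₂ (∈C⁻ {w} w∈C)) F)) β)
            (≈-sym {L β} {φ t x β} (combination c β)))
        where
        c : Fin (9 ℕ.+ suc m) → ℝ
        c i = [ weights w , (λ k → flatValues w (representativeOf k)) ]′ (splitAt 9 i)
        t : Fin 9 → ℝ
        t e = c (weightIndex e)
        x : Flat → ℝ
        x F = c (levelIndex (level F))
        L : Point X
        L = linearCombination c basisVector
        c-weight : ∀ e → c (weightIndex e) ≡ weights w e
        c-weight e = cong [ weights w , (λ k → flatValues w (representativeOf k)) ]′ (Finₚ.splitAt-↑ˡ 9 e (suc m))
        c-level : ∀ k → c (levelIndex k) ≡ flatValues w (representativeOf k)
        c-level k = cong [ weights w , (λ k → flatValues w (representativeOf k)) ]′ (Finₚ.splitAt-↑ʳ 9 (suc m) k)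

    -- Nine weights and m + 1 levels.
    hasConeDimension : HasConeDimension C (10 ℕ.+ m)
    hasConeDimension = basisVector ,
      indices (λ i → Span C (basisVector i)) weightVector∈Span levelVector∈Span , independent ,
      λ w w∈Span → Span⊆ (spanned-isLinearSubspace basisVector) (λ {w} → C⊆Spanned {w}) {w} w∈Span

  CellIndex : Set
  CellIndex = Fin 5 × Height

  allCells : List CellIndex
  allCells = List.concatMap (λ m → List.map (m ,_) (cells m)) (List.allFin 5)

  ∈-allCells⁻ : ∀ {m h} → (m , h) ∈ allCells → h ∈ cells m
  ∈-allCells⁻ {m} {h} mh∈ =
    let (m′ , _ , mh∈′)  = ∈.find (∈ₚ.∈-concatMap⁻ (λ m → List.map (m ,_) (cells m)) {xs = List.allFin 5} mh∈)
        (h′ , h′∈ , eq) = ∈ₚ.∈-map⁻ (m′ ,_) mh∈′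
    in subst₂ (λ h m → h ∈ cells m) (sym (cong proj₂ eq)) (sym (cong proj₁ eq)) h′∈

  ∈-allCells⁺ : ∀ {m h} → h ∈ cells m → (m , h) ∈ allCells
  ∈-allCells⁺ {m} h∈ = ∈ₚ.∈-concatMap⁺ (λ m → List.map (m ,_) (cells m))
    (∈.lose (∈ₚ.∈-allFin m) (∈ₚ.∈-map⁺ (m ,_) h∈))

  cellIsCell : ∀ {m h} → (m , h) ∈ allCells → IsCell (toℕ m) h
  cellIsCell {m} mh∈ = isCell m (∈-allCells⁻ mh∈)

  private
    ¬¬-dec : ∀ {P : Set} → ¬ ¬ Dec P
    ¬¬-dec k = k (no λ p → k (yes p))

    ⊑-trans : ∀ {x y z} → x ⊑ y → y ⊑ z → x ⊑ z
    ⊑-trans x⊑y y⊑z l le = y⊑z l (x⊑y l le)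

    code∈⇒cell : ∀ {c} → c ∈ List.concatMap (λ m → List.map (code lines) (cells m)) (List.allFin 5) →
                 ∃ λ m → ∃ λ h → h ∈ cells m × c ≡ code lines h
    code∈⇒cell c∈ =
      let (m , _ , c∈′) = ∈.find (∈ₚ.∈-concatMap⁻ (λ m → List.map (code lines) (cells m)) {xs = List.allFin 5} c∈)
          (h , h∈ , eq) = ∈ₚ.∈-map⁻ (code lines) c∈′
      in m , h , h∈ , eq

    -- The comparisons between the 15 hyperplane values are finite in number, so all of them may be
    -- assumed decided under the double negation; then `peel` applies.
    everyPoint : ∀ w → Dressian desargues w → ¬ ¬ (∃ λ a → a ∈ allCells ×
                 _≼_ desargues w (natural (point (proj₂ a))) × _≼_ desargues (natural (point (proj₂ a))) w)
    everyPoint w w∈D none = ¬¬-∀ (λ a → ¬¬-∀ λ b → ¬¬-dec {x a ≤ᴿ x b}) λ _≤?_ →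
      let (h , c∈ , h⊑x , x⊑h)    = Peel.peel x _≤?_ ultra chains-checked
          (m , h′ , h′∈ , eq)      = code∈⇒cell c∈
          x⊑h′ : x ⊑ real h′
          x⊑h′ = ⊑-trans {x} {real h} {real h′} x⊑h (code-⊑ h h′ eq)
          h′⊑x : real h′ ⊑ x
          h′⊑x = ⊑-trans {real h′} {real h} {x} (code-⊑ h′ h (sym eq)) h⊑x
      in none ((m , h′) , ∈-allCells⁺ h′∈ ,
        (λ P i att → AttainsMinimum-resp-≈ (G desargues P) {v h′} {n h′}
          (λ β → ≈-sym {n h′ β} {v h′ β} (point≈φ h′ β))
          (φ-mono {x} {real h′} (weights w) (λ _ → 0ᴿ) ultra x⊑h′ P i (AttainsMinimum-resp-≈ (G desargues P) {w} {φ (weights w) x} w≈ att))) ,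
        (λ P i att → AttainsMinimum-resp-≈ (G desargues P) {φ (weights w) x} {w} (λ β → ≈-sym {w β} {φ (weights w) x β} (w≈ β))
          (φ-mono {real h′} {x} (λ _ → 0ᴿ) (weights w) (IsCell.ultrametric (isCell m h′∈)) h′⊑x P i
            (AttainsMinimum-resp-≈ (G desargues P) {n h′} {v h′} (point≈φ h′) att))))
      where
      x : Flat → ℝ
      x = flatValues w
      w≈ : w ≈ᵥ φ (weights w) x
      w≈ = dressian⇒φ w∈D
      ultra : Ultrametric x
      ultra = dressian⇒ultrametric (weights w) x λ P → TropicalHypersurface-resp-≈ desargues (G desargues P) {w} w≈ (w∈D P)
      n v : Height → Point X
      n h = natural (point h)
      v h = φ (λ _ → 0ᴿ) (real h)

  cellInDressian : ∀ {a} → a ∈ allCells → Dressian desargues (natural (point (proj₂ a)))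
  cellInDressian a∈ = Cell.h∈D (cellIsCell a∈)

  open Classification desargues allCells (point ∘ proj₂) cellInDressian everyPoint using (classify)

  module _ (m : Fin 5) where

    cellAt : Fin (length (cells m)) → Height
    cellAt i = List.lookup (cells m) i

    cellAt-isCell : ∀ i → IsCell (toℕ m) (cellAt i)
    cellAt-isCell i = isCell m (∈ₚ.∈-lookup {xs = cells m} i)

    module At i = Cell (cellAt-isCell i)

    private
      indexAt : Fin (length (cells m)) → Fan.Index (dressianFan desargues)
      indexAt i = coneIndex desargues (point (cellAt i)) (At.h∈D i)

      distinct-codes : ∀ {hs} → AllPairs (λ h h′ → code lines h ℕ.< code lines h′) hs →
                       ∀ i j → code lines (List.lookup hs i) ≡ code lines (List.lookup hs j) → i ≡ j
      distinct-codes (_ ∷ _)  zero    zero    _  = refl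
      distinct-codes (p ∷ _)  zero    (suc j) eq = ⊥-elim (ℕₚ.<-irrefl eq (All.lookup p (∈ₚ.∈-lookup j)))
      distinct-codes (p ∷ _)  (suc i) zero    eq = ⊥-elim (ℕₚ.<-irrefl (sym eq) (All.lookup p (∈ₚ.∈-lookup i)))
      distinct-codes (_ ∷ ps) (suc i) (suc j) eq = cong suc (distinct-codes ps i j eq)

      ≼⇒⊑ : ∀ i j → _≼_ desargues (natural (point (cellAt i))) (natural (point (cellAt j))) →
            real (cellAt i) ⊑ real (cellAt j)
      ≼⇒⊑ i j i≼j = φ-reflects {real (cellAt i)} {real (cellAt j)} (λ _ → 0ᴿ) (λ _ → 0ᴿ)
        (IsCell.ultrametric (cellAt-isCell i)) λ P k att →
          AttainsMinimum-resp-≈ (G desargues P) (point≈φ (cellAt j)) (i≼j P k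
            (AttainsMinimum-resp-≈ (G desargues P) {φ (λ _ → 0ᴿ) (real (cellAt i))} {natural (point (cellAt i))}
              (λ β → ≈-sym {natural (point (cellAt i)) β} {φ (λ _ → 0ᴿ) (real (cellAt i)) β} (point≈φ (cellAt i) β)) att))

      ≐⇒≡ : ∀ i j → At.C i ≐ At.C j → i ≡ j
      ≐⇒≡ i j (i⊆j , j⊆i) = distinct-codes (codes-distinct m) i j (⊑-code (cellAt i) (cellAt j)
        (≼⇒⊑ i j (≐⇒≼ desargues (point (cellAt j)) (At.h∈D j) (point (cellAt i)) (At.h∈D i)
          ((λ {w} → j⊆i {w}) , (λ {w} → i⊆j {w}))))
        (≼⇒⊑ j i (≐⇒≼ desargues (point (cellAt i)) (At.h∈D i) (point (cellAt j)) (At.h∈D j)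
          ((λ {w} → i⊆j {w}) , (λ {w} → j⊆i {w})))))

      -- The classification yields a cell with some number m′ in place of m; uniqueness of dimension
      -- forces them to agree.
      found : ∀ τ → HasConeDimension (cone (dressianFan desargues) τ) (10 ℕ.+ toℕ m) →
              ∃ λ i → cone (dressianFan desargues) τ ≐ At.C i
      found τ dim =
        let ((m′ , h) , a∈ , τ≐) = classify τ
            m≡ = Finₚ.toℕ-injective (ℕₚ.+-cancelˡ-≡ 10 (toℕ m′) (toℕ m)
                   (HasDimension-unique (Cell.hasConeDimension (cellIsCell a∈))
                     (HasConeDimension-resp-≐ {C = cone (dressianFan desargues) τ} {D = Cell.C (cellIsCell a∈)}
                       τ≐ dim)))
            h∈ = subst (λ m → h ∈ cells m) m≡ (∈-allCells⁻ a∈)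
            τ⊆ : cone (dressianFan desargues) τ ⊆ Cell.C (cellIsCell a∈)
            τ⊆ = λ {w} → proj₁ τ≐ {w}
            ⊆τ : Cell.C (cellIsCell a∈) ⊆ cone (dressianFan desargues) τ
            ⊆τ = λ {w} → proj₂ τ≐ {w}
        in Any.index h∈ ,
           (λ {w} w∈τ → same (Any-lookup h∈) (cellIsCell a∈) (cellAt-isCell (Any.index h∈)) {w} (τ⊆ {w} w∈τ)) ,
           (λ {w} w∈i → ⊆τ {w} (same (sym (Any-lookup h∈)) (cellAt-isCell (Any.index h∈)) (cellIsCell a∈) {w} w∈i))
        where
        Any-lookup : ∀ {h hs} (h∈ : h ∈ hs) → h ≡ List.lookup hs (Any.index h∈)
        Any-lookup (here eq)  = eq
        Any-lookup (there h∈) = Any-lookup h∈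
        same : ∀ {m m′ h h′} → h ≡ h′ → (c : IsCell m h) (c′ : IsCell m′ h′) → Cell.C c ⊆ Cell.C c′
        same {h = h} refl c c′ {w} w∈ = ≼⇒∈cone desargues (point h) (Cell.h∈D c′) {w}
          (∈cone⇒≼ desargues (point h) (Cell.h∈D c) {w} w∈)

    hasCones : HasConesOfDimension (dressianFan desargues) (10 ℕ.+ toℕ m) (length (cells m))
    hasCones = indexAt , (λ i → At.hasConeDimension i) , (λ i j i≢j i≐j → i≢j (≐⇒≡ i j i≐j)) , found

  zeroCell : Fin (length (cells (# 0)))
  zeroCell = subst Fin (sym (proj₁ length-cells)) zero

  -- For m = 0 all heights vanish, so the cell's point is the origin and its cone is the lineality
  -- space.
  lineality-hasDimension : HasDimension (Lineality desargues) 10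
  lineality-hasDimension = HasDimension-resp-≐ {U = Span C} {V = Lineality desargues}
    ((λ {w} → Span⊆ {U = Lineality desargues} {C = C} (lineality-isLinearSubspace desargues) (λ {v} → C⊆L {v}) {w}) ,
     (λ {w} w∈L → singleton∈Span {C = C} {w} (lineality⊆cone desargues (coneIndex desargues (point h) h∈D) {w} w∈L)))
    hasConeDimension
    where
    open At (# 0) zeroCell
    h : Height
    h = cellAt (# 0) zeroCell
    n : X → ℕ
    n = point h
    C⊆L : C ⊆ Lineality desargues
    C⊆L {w} w∈C P i = ∈cone⇒≼ desargues n h∈D {w} w∈C P i (AttainsMinimum-resp-≈ (G desargues P) {0ᵥ} {natural n}
      (λ β → ≈-sym {natural n β} {0ᴿ} (subst (λ k → natᴿ k ≈ᴿ 0ᴿ)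
        (sym (ℕₚ.n≤0⇒n≡0 (IsCell.bounded (cellAt-isCell (# 0) zeroCell) (flat (Basis.set β))))) (≈-refl {0ᴿ})))
      (IsLinearSubspace.zero∈ (lineality-isLinearSubspace desargues) P i))

  0∈Dressian : Dressian desargues 0ᵥ
  0∈Dressian = cone⊆Dressian desargues (coneIndex desargues (point (cellAt (# 0) zeroCell)) (At.h∈D (# 0) zeroCell)) {0ᵥ}
    (lineality⊆cone desargues (coneIndex desargues (point (cellAt (# 0) zeroCell)) (At.h∈D (# 0) zeroCell)) {0ᵥ}
      (IsLinearSubspace.zero∈ (lineality-isLinearSubspace desargues)))

  -- A cell of dimension i is the trace of a cone of dimension 10 + i + 1, so it belongs to m = i +
  -- 1. The case m = 0 is the lineality space itself, which leaves no trace on the sphere.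
  hasCells : ∀ {i N} (m : Fin 5) → toℕ m ≡ suc i → length (cells m) ≡ N →
             HasCells (dressianFan desargues) (Lineality desargues) i N
  hasCells {i} m m≡ N≡ = 10 , lineality-hasDimension ,
    subst₂ (HasConesOfDimension (dressianFan desargues))
      (cong (10 ℕ.+_) (trans m≡ (ℕₚ.+-comm 1 i))) N≡ (hasCones m)

  hasSphericalDimension : HasSphericalDimension (dressianFan desargues) (Lineality desargues) 3
  hasSphericalDimension = 10 , lineality-hasDimension , dimension , topCell
    where
    dimension : ∀ σ → ∃ λ k → k ℕ.≤ 14 × HasConeDimension (cone (dressianFan desargues) σ) k
    dimension σ =
      let ((m , h) , a∈ , σ≐) = classify σ
          D = Cell.C (cellIsCell a∈)
      in 10 ℕ.+ toℕ m , ℕₚ.+-monoʳ-≤ 10 (Finₚ.toℕ≤pred[n] m) ,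
         HasConeDimension-resp-≐ {C = D} {D = cone (dressianFan desargues) σ}
           ((λ {w} → proj₂ σ≐ {w}) , (λ {w} → proj₁ σ≐ {w})) (Cell.hasConeDimension (cellIsCell a∈))
    topCell : ∃ λ σ → HasConeDimension (cone (dressianFan desargues) σ) 14
    topCell = let i = subst Fin (sym (proj₂ (proj₂ (proj₂ (proj₂ length-cells))))) zero
              in proj₁ (hasCones (# 4)) i , proj₁ (proj₂ (hasCones (# 4))) i

open import Data.Fin using (#_)
open import Data.Product using (_,_)
open import Relation.Binary.PropositionalEquality using (refl)
open MatroidFans
open Cells using (length-cells)
open CellCones

proposition4p4 : Σ (Pred (Point (Basis desargues)) 0ℓ) λ L →
    IsLinealitySpace (Dressian desargues) L ×
    HasSphericalDimension (dressianFan desargues) L 3 ×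
    HasCells (dressianFan desargues) L 0 70 ×
    HasCells (dressianFan desargues) L 1 370 ×
    HasCells (dressianFan desargues) L 2 510 ×
    HasCells (dressianFan desargues) L 3 150
proposition4p4 =
  let (_ , length₁ , length₂ , length₃ , length₄) = length-cells in
  Lineality desargues , isLinealitySpace desargues 0∈Dressian , hasSphericalDimension ,
  hasCells (# 1) refl length₁ , hasCells (# 2) refl length₂ ,
  hasCells (# 3) refl length₃ , hasCells (# 4) refl length₄
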